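{- Let $p$ and $q$ be primes satisfying $p<q$, and let $M=p^sq^t$ where $s$ and $t$ are positive integers. For any integers $0\le j<i<M$, there exists $u(x)\in\mathbb{Z}[x]/\Phi_M(x)$ such that $(x^i-x^j)\cdot u(x)=c\pmod{\Phi_M(x)}$ and $\|u(x)\|_\infty\le d$, where $$(c,d)=\begin{cases}(q,\,q-1) & \text{if } p^s\mid (i-j),\\ (p,\,p-1) & \text{if } q^t\mid (i-j),\\ (1,\,p-1) & \text{otherwise.}\end{cases}$$
   Context: $\Phi_M(x)$ denotes the $M$th cyclotomic polynomial, of degree $\phi(M)$ (Euler's totient). $\mathbb{Z}[x]/\Phi_M(x)$ is the quotient of $\mathbb{Z}[x]$ by the ideal generated by $\Phi_M(x)$. For $g\in\mathbb{Z}[x]/\Phi_M(x)$, $\|g\|_\infty$ is the largest absolute value of the coefficients of the unique representative of $g$ in $\mathbb{Z}[x]$ of degree less than $\phi(M)$. -}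

module Defs where

open import Data.Bool using (if_then_else_)
open import Data.Fin using (Fin; toℕ)
open import Data.Fin.Properties using (toℕ<n)
open import Data.Integer as ℤ using (ℤ; +_; 0ℤ; 1ℤ; ∣_∣)
open import Data.List using (List; []; _∷_; _++_; map; replicate; foldr; tabulate; filter; length; upTo)
open import Data.List.Relation.Unary.All using (all?)
open import Data.Nat using (ℕ; zero; suc; _+_; _∸_; _*_; _^_; _<_; _⊔_)
open import Data.Nat.Coprimality using (coprime?)
open import Data.Nat.Divisibility using (_∣?_)
open import Data.Nat.Induction using (<-rec)
open import Data.Product using (_×_; _,_; proj₁; proj₂; ∃-syntax)
open import Data.Vec as Vec using (Vec)
open import Relation.Binary.PropositionalEquality using (_≡_)
open import Relation.Nullary using (does)

-- ℤ[x]: coefficients listed from the constant term upwards. Trailing zeros are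
-- allowed, so equality of polynomials is _≈_ and not _≡_.

Poly : Set
Poly = List ℤ

coeff : Poly → ℕ → ℤ
coeff []      _       = 0ℤ
coeff (a ∷ _) zero    = a
coeff (_ ∷ f) (suc k) = coeff f k

infix 4 _≈_
_≈_ : Poly → Poly → Set
f ≈ g = ∀ k → coeff f k ≡ coeff g k

const : ℤ → Poly
const a = a ∷ []

X^_ : ℕ → Poly
X^ n = replicate n 0ℤ ++ const 1ℤ

infixl 6 _+ᵖ_ _-ᵖ_
infixl 7 _*ᵖ_
infix  8 -ᵖ_

_+ᵖ_ : Poly → Poly → Poly
[]      +ᵖ g       = g
(a ∷ f) +ᵖ []      = a ∷ f
(a ∷ f) +ᵖ (b ∷ g) = (a ℤ.+ b) ∷ (f +ᵖ g)

-ᵖ_ : Poly → Poly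
-ᵖ f = map (ℤ.-_) f

_-ᵖ_ : Poly → Poly → Poly
f -ᵖ g = f +ᵖ (-ᵖ g)

_*ᵖ_ : Poly → Poly → Poly
[]      *ᵖ g = []
(a ∷ f) *ᵖ g = map (a ℤ.*_) g +ᵖ (0ℤ ∷ (f *ᵖ g))

-- Equality in ℤ[x]/(h); the elements of the quotient are represented by
-- arbitrary polynomials.

infix 4 _≈_[mod_]
_≈_[mod_] : Poly → Poly → Poly → Set
f ≈ g [mod h ] = ∃[ k ] f -ᵖ g ≈ k *ᵖ h

-- The degree of a nonzero polynomial; the zero polynomial gets 0.

degree : Poly → ℕ
degree []      = 0
degree (a ∷ f) = if does (all? (ℤ._≟ 0ℤ) f) then 0 else suc (degree f)

-- Quotient and remainder of f on division by g, where g must be monic of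
-- degree n: only the coefficients of g below xⁿ are read. If f = Q g + R with
-- deg R < n and l is the coefficient of xⁿ in a + x R, then
-- a + x f = (l + x Q) g + (a + x R - l g).

divMod : (n : ℕ) → Poly → Poly → Poly × Vec ℤ n
divMod n g = foldr step ([] , Vec.replicate n 0ℤ)
  where
  low : Vec ℤ n
  low = Vec.tabulate (λ k → coeff g (toℕ k))

  step : ℤ → Poly × Vec ℤ n → Poly × Vec ℤ n
  step a (Q , R) = (l ∷ Q) , Vec.zipWith (λ b c → b ℤ.- l ℤ.* c) (Vec.init v) low
    where
    v : Vec ℤ (suc n)
    v = a Vec.∷ R

    l : ℤ
    l = Vec.last v

quot : Poly → Poly → Poly
quot f g = proj₁ (divMod (degree g) g f)

-- The cyclotomic polynomials, by the recursion
-- Φₙ = (xⁿ - 1) / ∏ { Φ_d : d ∣ n , d < n }; n = 0 is a junk case.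

Φ : ℕ → Poly
Φ = <-rec (λ _ → Poly) λ n Φ′ →
  quot (X^ n -ᵖ X^ 0)
       (foldr _*ᵖ_ (const 1ℤ)
         (tabulate λ (d : Fin n) → if does (toℕ d ∣? n) then Φ′ (toℕ<n d) else const 1ℤ))

φ : ℕ → ℕ
φ n = length (filter (λ k → coprime? (suc k) n) (upTo n))

-- The representative of g modulo Φ M of degree less than φ M, M > 0.

representative : (M : ℕ) → Poly → Vec ℤ (φ M)
representative M g = proj₂ (divMod (φ M) (Φ M) g)

-- The norm ‖ g ‖∞ of the class of g in ℤ[x]/Φ M.

‖_‖∞[_] : Poly → ℕ → ℕ
‖ g ‖∞[ M ] = Vec.foldr′ (λ a m → ∣ a ∣ ⊔ m) 0 (representative M g)

-- The pair (c , d) for k = i - j. The order of the two tests does not matter: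
-- for coprime p and q both succeed only if p ^ s * q ^ t divides k, which is
-- impossible for 0 < k < p ^ s * q ^ t.

constants : (p q s t k : ℕ) → ℕ × ℕ
constants p q s t k =
  if does ((p ^ s) ∣? k) then (q , q ∸ 1)
  else if does ((q ^ t) ∣? k) then (p , p ∸ 1)
  else (1 , p ∸ 1)

{-# OPTIONS --safe #-}

-- Let ζ be the class of x, m = p^(s-1) q^(t-1), y = ζ^m and k = i - j.  The proper divisors
-- of n = p^a q^b are handled by inclusion-exclusion, which gives Φ n in closed form;
-- consequently Σ_{i<p} y^{qi} = Σ_{i<q} y^{pi} = 0, so Σ_{n<pq} F(n) yⁿ = 0 whenever F is
-- periodic mod p or mod q.
--
-- With g = gcd(k , m), N = m / g and κ = k / g we have ζ^{kN} = y^κ, and the geometric sum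
-- Σ_{l<N} ζ^{kl} reduces the inversion of ζ^k - 1 to that of y^κ - 1.  There
-- (y^κ - 1) Σ V(n) yⁿ = c for an explicit function V on ℤ/pq: if p ∣ κ, V is supported on the
-- multiples of p with values in [0 , q - 1]; if κ is prime to pq, V takes values in {-1 , 0}
-- and is constant on one class mod p.
--
-- Any V can be changed by functions periodic mod p or mod q so as to vanish on p + q - 1
-- consecutive exponents; the resulting values are sums of one difference V(n) - V(n') for
-- each class mod p, with n and n' in that class, so the bound is the sum of the oscillations
-- of V on these classes: q - 1 in the first case, p - 1 in the second.  The case q^t ∣ k is
-- the first one with p and q exchanged.
module Submission where

open import Algebra.Bundles using (CommutativeMonoid; CommutativeSemiring; CommutativeRing)
import Algebra.Properties.CommutativeSemigroup as CommSemigroup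
import Algebra.Properties.Group as GroupProperties
import Algebra.Properties.Ring as RingProperties
import Algebra.Properties.Semiring.Exp as Exp
import Algebra.Solver.Ring.NaturalCoefficients.Default as SemiringSolver
open import Data.Bool using (true; false; if_then_else_)
open import Data.Integer as ℤ using (ℤ; +_; 0ℤ; 1ℤ)
import Data.Integer.Properties as ℤ
open import Data.Integer.Tactic.RingSolver using () renaming (solve-∀ to ℤ-solve)
open import Data.Nat as ℕ using (ℕ; zero; suc; _+_; _*_; _∸_; _≤_; _<_; z≤n; s≤s; z<s; s<s; NonZero; _≟_; _≤?_)
import Data.Nat.Properties as ℕ
open import Data.Nat.Coprimality as Coprimality using (Coprime; coprime?; coprime-Bézout; coprime-divisor; coprime-factors; coprime-/gcd; prime⇒coprime)
open import Data.Nat.Divisibility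
open import Data.Nat.DivMod using (_/_; _%_; m≡m%n+[m/n]*n; m%n<n; n%n≡0; m%n%n≡m%n; m<n⇒m%n≡m; [m+n]%n≡m%n; [m+kn]%n≡m%n; m*n/n≡m; m/n*n≡m; n/n≡1; m<n⇒m/n≡0; m<n*o⇒m/o<n; +-distrib-/-∣ʳ)
open import Data.Nat.GCD using (gcd; gcd[m,n]∣m; gcd[m,n]∣n; gcd[m,n]≢0; module Bézout)
open import Data.Nat.Induction using (<-wellFounded)
open import Data.Nat.Primality using (Prime; prime⇒irreducible; prime⇒nonZero; prime⇒nonTrivial)
open import Data.Nat.Tactic.RingSolver using (solve-∀)
open import Data.Product using (_×_; _,_; proj₁; proj₂; ∃-syntax)
open import Data.Sum using (_⊎_; inj₁; inj₂)
open import Function using (_∘_)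
open import Level using (0ℓ; _⊔_)
open import Relation.Binary.PropositionalEquality as ≡ using (_≡_; cong; cong₂; subst; subst₂)
open import Relation.Nullary using (¬_; Dec; yes; no; contradiction; does)
open import Relation.Nullary.Decidable using (dec-true; dec-false; decidable-stable)

-- The bound concerns the representative of degree below φ(M), and reducing modulo Φ_M would lose
-- control of the coefficients. Removing p + q - 1 of the pq exponents leaves (p - 1)(q - 1) of
-- them. Once the unit y^(p+q-1) is factored out, the remaining products ζ^r y^n with r < m are
-- exactly the powers of ζ below φ(M), so the coefficients found already are those of the
-- representative. The oscillations come from a graph. An exponent n is an edge of K_{p,q} joining n
-- mod p to n mod q, functions periodic mod p or mod q are functions of the endpoints, and the
-- removed exponents form a spanning tree. Making V vanish on the tree turns its value at any other
-- edge into the alternating sum of V round the cycle closed by that edge. A simple cycle passes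
-- each class mod p at most once, along two edges of opposite sign. Treating the classes one at a
-- time keeps cycles out of the formal proof.

module BigOp {c ℓ} (M : CommutativeMonoid c ℓ) where
  open CommutativeMonoid M
  open CommSemigroup commutativeSemigroup using (interchange)
  open import Relation.Binary.Reasoning.Setoid setoid

  ∑ : ℕ → (ℕ → Carrier) → Carrier
  ∑ zero    F = ε
  ∑ (suc n) F = F 0 ∙ ∑ n (F ∘ suc)

  ∑-cong : ∀ n {F G} → (∀ i → i < n → F i ≈ G i) → ∑ n F ≈ ∑ n G
  ∑-cong zero    e = refl
  ∑-cong (suc n) e = ∙-cong (e 0 z<s) (∑-cong n λ i i<n → e (suc i) (s<s i<n))

  ∑-ε : ∀ n → ∑ n (λ _ → ε) ≈ ε
  ∑-ε zero    = refl
  ∑-ε (suc n) = trans (identityˡ _) (∑-ε n)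

  ∑-∙ : ∀ n F G → ∑ n (λ i → F i ∙ G i) ≈ ∑ n F ∙ ∑ n G
  ∑-∙ zero    F G = sym (identityˡ ε)
  ∑-∙ (suc n) F G = trans (∙-congˡ (∑-∙ n (F ∘ suc) (G ∘ suc))) (interchange (F 0) (G 0) _ _)

  ∑-split : ∀ m n F → ∑ (m + n) F ≈ ∑ m F ∙ ∑ n (λ i → F (m + i))
  ∑-split zero    n F = sym (identityˡ _)
  ∑-split (suc m) n F = trans (∙-congˡ (∑-split m n (F ∘ suc))) (sym (assoc (F 0) _ _))

  ∑-last : ∀ n F → ∑ (suc n) F ≈ ∑ n F ∙ F n
  ∑-last zero    F = comm (F 0) ε
  ∑-last (suc n) F = trans (∙-congˡ (∑-last n (F ∘ suc))) (sym (assoc (F 0) _ _))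

  ∑-comm : ∀ m n (F : ℕ → ℕ → Carrier) →
    ∑ m (λ i → ∑ n (λ j → F i j)) ≈ ∑ n (λ j → ∑ m (λ i → F i j))
  ∑-comm zero    n F = sym (∑-ε n)
  ∑-comm (suc m) n F = trans (∙-congˡ (∑-comm m n (F ∘ suc))) (sym (∑-∙ n (F 0) _))

  ∑-blocks : ∀ n m F → ∑ (n * m) F ≈ ∑ n (λ j → ∑ m (λ i → F (i + j * m)))
  ∑-blocks zero    m F = refl
  ∑-blocks (suc n) m F = begin
    ∑ (m + n * m) F
      ≈⟨ ∑-split m (n * m) F ⟩
    ∑ m F ∙ ∑ (n * m) (λ i → F (m + i))
      ≈⟨ ∙-cong (∑-cong m λ i _ → reflexive (≡.cong F (≡.sym (ℕ.+-identityʳ i)))) (∑-blocks n m _) ⟩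
    ∑ m (λ i → F (i + 0)) ∙ ∑ n (λ j → ∑ m (λ i → F (m + (i + j * m))))
      ≈⟨ ∙-congˡ (∑-cong n λ j _ → ∑-cong m λ i _ → reflexive (≡.cong F (left-comm m i (j * m)))) ⟩
    ∑ (suc n) (λ j → ∑ m (λ i → F (i + j * m)))  ∎
    where
    left-comm : ∀ x y z → x + (y + z) ≡ y + (x + z)
    left-comm = CommSemigroup.x∙yz≈y∙xz ℕ.+-commutativeSemigroup

  ∑-pick : ∀ n {k} → k < n → ∀ (F : ℕ → Carrier) → ∑ n (λ i → if does (k ≟ i) then F i else ε) ≈ F k
  ∑-pick (suc n) {zero}  _         F = trans (∙-congˡ (∑-ε n)) (identityʳ (F 0))
  ∑-pick (suc n) {suc k} (s≤s k<n) F = trans (identityˡ _) (∑-pick n k<n (F ∘ suc))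

-- Geometric sums in commutative semirings and rings

module Sum {c ℓ} (S : CommutativeSemiring c ℓ) where
  open CommutativeSemiring S hiding (_*_; _+_)
  open CommutativeSemiring S using () renaming (_*_ to _⊛_; _+_ to _⊕_)
  open BigOp +-commutativeMonoid public
    renaming (∑-∙ to ∑-+; ∑-ε to ∑-0)
  open Exp semiring public using (_^_; ^-congˡ; ^-homo-*; ^-assocʳ)
  open import Relation.Binary.Reasoning.Setoid setoid

  *-distribˡ-∑ : ∀ n x F → x ⊛ ∑ n F ≈ ∑ n (λ i → x ⊛ F i)
  *-distribˡ-∑ zero    x F = zeroʳ x
  *-distribˡ-∑ (suc n) x F = trans (distribˡ x _ _) (+-congˡ (*-distribˡ-∑ n x (F ∘ suc)))

  geo : ℕ → Carrier → Carrier
  geo n z = ∑ n (z ^_)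

  geo-suc : ∀ n z → geo (suc n) z ≈ 1# ⊕ z ⊛ geo n z
  geo-suc n z = +-congˡ (sym (*-distribˡ-∑ n z (z ^_)))

  geo-* : ∀ m n z → geo (m * n) z ≈ geo n z ⊛ geo m (z ^ n)
  geo-* m n z = begin
    geo (m * n) z                                     ≈⟨ ∑-blocks m n (z ^_) ⟩
    ∑ m (λ j → ∑ n (λ i → z ^ (i + j * n)))           ≈⟨ ∑-cong m (λ j _ → begin
      ∑ n (λ i → z ^ (i + j * n))                       ≈⟨ ∑-cong n (λ i _ → trans (^-homo-* z i (j * n)) (*-comm _ _)) ⟩
      ∑ n (λ i → z ^ (j * n) ⊛ z ^ i)                   ≈⟨ *-distribˡ-∑ n (z ^ (j * n)) (z ^_) ⟨
      z ^ (j * n) ⊛ geo n z                             ≈⟨ *-comm _ _ ⟩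
      geo n z ⊛ z ^ (j * n)                             ≡⟨ ≡.cong (λ k → geo n z ⊛ z ^ k) (ℕ.*-comm j n) ⟩
      geo n z ⊛ z ^ (n * j)                             ≈⟨ *-congˡ (^-assocʳ z n j) ⟨
      geo n z ⊛ (z ^ n) ^ j                             ∎) ⟩
    ∑ m (λ j → geo n z ⊛ (z ^ n) ^ j)                 ≈⟨ *-distribˡ-∑ m (geo n z) _ ⟨
    geo n z ⊛ geo m (z ^ n)                           ∎

module Geometric {c ℓ} (R : CommutativeRing c ℓ) where
  open CommutativeRing R hiding (_*_; _+_)
  open CommutativeRing R using () renaming (_*_ to _⊛_; _+_ to _⊕_)
  open Sum commutativeSemiring public
  open RingProperties ring using (x[y-z]≈xy-xz; [y-z]x≈yx-zx)
  open SemiringSolver commutativeSemiring using (solve; _:=_; _:*_)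
  open import Relation.Binary.Reasoning.Setoid setoid

  [x+y]-y≈x : ∀ x y → x ⊕ y - y ≈ x
  [x+y]-y≈x x y = trans (+-assoc x y _) (trans (+-congˡ (-‿inverseʳ y)) (+-identityʳ x))

  x≈y+z⇒x-z≈y : ∀ {x y z} → x ≈ y ⊕ z → x - z ≈ y
  x≈y+z⇒x-z≈y e = trans (+-congʳ e) ([x+y]-y≈x _ _)

  geo-telescope : ∀ n z → (z - 1#) ⊛ geo n z ≈ z ^ n - 1#
  geo-telescope n z = begin
    (z - 1#) ⊛ geo n z                ≈⟨ [y-z]x≈yx-zx (geo n z) z 1# ⟩
    z ⊛ geo n z - 1# ⊛ geo n z        ≈⟨ +-congˡ (-‿cong (*-identityˡ _)) ⟩
    z ⊛ geo n z - geo n z             ≈⟨ x≈y+z⇒x-z≈y zg ⟩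
    z ^ n - 1#                        ∎
    where
    zg : z ⊛ geo n z ≈ (z ^ n - 1#) ⊕ geo n z
    zg = begin
      z ⊛ geo n z                     ≈⟨ x≈y+z⇒x-z≈y (+-comm _ _) ⟨
      (1# ⊕ z ⊛ geo n z) - 1#         ≈⟨ +-congʳ (trans (sym (geo-suc n z)) (∑-last n (z ^_))) ⟩
      (geo n z ⊕ z ^ n) - 1#          ≈⟨ +-assoc _ _ _ ⟩
      geo n z ⊕ (z ^ n - 1#)          ≈⟨ +-comm _ _ ⟩
      (z ^ n - 1#) ⊕ geo n z          ∎

  -- A Bézout relation ap = 1 + bq gives 1 = geo (ap) z - z geo (bq) z, so geo p z
  -- and geo q z are comaximal; hence geo p z divides the cofactor of geo q z in geo (pq) z.
  geo-coprime : ∀ p q a b → a * p ≡ 1 + b * q → ∀ z →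
    ∃[ k ] geo p (z ^ q) ≈ geo p z ⊛ k
  geo-coprime p q a b ap≡1+bq z = A ⊛ G - z ⊛ B ⊛ H , sym (begin
    geo p z ⊛ (A ⊛ G - z ⊛ B ⊛ H)               ≈⟨ x[y-z]≈xy-xz (geo p z) _ _ ⟩
    geo p z ⊛ (A ⊛ G) - geo p z ⊛ (z ⊛ B ⊛ H)   ≈⟨ x≈y+z⇒x-z≈y main ⟩
    G                                           ∎)
    where
    A B G H : Carrier
    A = geo a (z ^ p)
    B = geo b (z ^ q)
    G = geo p (z ^ q)
    H = geo q (z ^ p)

    main : geo p z ⊛ (A ⊛ G) ≈ G ⊕ geo p z ⊛ (z ⊛ B ⊛ H)
    main = begin
      geo p z ⊛ (A ⊛ G)                      ≈⟨ *-assoc _ _ _ ⟨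
      (geo p z ⊛ A) ⊛ G                      ≈⟨ *-congʳ (geo-* a p z) ⟨
      geo (a * p) z ⊛ G                      ≡⟨ ≡.cong (λ n → geo n z ⊛ G) ap≡1+bq ⟩
      geo (suc (b * q)) z ⊛ G                ≈⟨ *-congʳ (trans (geo-suc (b * q) z) (+-congˡ (*-congˡ (geo-* b q z)))) ⟩
      (1# ⊕ z ⊛ (geo q z ⊛ B)) ⊛ G           ≈⟨ trans (distribʳ G 1# _) (+-congʳ (*-identityˡ G)) ⟩
      G ⊕ (z ⊛ (geo q z ⊛ B)) ⊛ G            ≈⟨ +-congˡ (solve 4 (λ x y b g → (x :* (y :* b)) :* g := (x :* b) :* (y :* g)) refl z (geo q z) B G) ⟩
      G ⊕ (z ⊛ B) ⊛ (geo q z ⊛ G)            ≈⟨ +-congˡ (*-congˡ (geo-* p q z)) ⟨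
      G ⊕ (z ⊛ B) ⊛ geo (p * q) z            ≡⟨ ≡.cong (λ n → G ⊕ (z ⊛ B) ⊛ geo n z) (ℕ.*-comm p q) ⟩
      G ⊕ (z ⊛ B) ⊛ geo (q * p) z            ≈⟨ +-congˡ (*-congˡ (geo-* q p z)) ⟩
      G ⊕ (z ⊛ B) ⊛ (geo p z ⊛ H)            ≈⟨ +-congˡ (solve 4 (λ x b y h → (x :* b) :* (y :* h) := y :* ((x :* b) :* h)) refl z B (geo p z) H) ⟩
      G ⊕ geo p z ⊛ (z ⊛ B ⊛ H)              ∎

-- Quotient of a commutative ring by a principal ideal

module QuotientRing {c ℓ} (R : CommutativeRing c ℓ) (h : CommutativeRing.Carrier R) where
  open CommutativeRing R hiding (_*_; _+_)
  open CommutativeRing R using () renaming (_*_ to _⊛_; _+_ to _⊕_)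
  open SemiringSolver commutativeSemiring using (solve; _:=_; _:*_; _:+_)
  open RingProperties ring using (-‿distribˡ-*; -‿+-comm)
  open CommSemigroup +-commutativeSemigroup using (interchange)
  open import Relation.Binary.Reasoning.Setoid setoid

  infix 4 _≈ₕ_
  -- The congruence is stated with a sum in place of a difference: compatibility with addition and
  -- multiplication then becomes an identity of commutative semirings, within reach of the semiring
  -- solver.
  record _≈ₕ_ (x y : Carrier) : Set (c ⊔ ℓ) where
    constructor _,ₕ_
    field
      multiplier : Carrier
      ≈multiple  : x ≈ y ⊕ multiplier ⊛ h
  open _≈ₕ_ public

  ≈⇒≈ₕ : ∀ {x y} → x ≈ y → x ≈ₕ y
  ≈⇒≈ₕ e = 0# ,ₕ trans e (sym (trans (+-congˡ (zeroˡ h)) (+-identityʳ _)))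

  multiple≈ₕ0 : ∀ k → k ⊛ h ≈ₕ 0#
  multiple≈ₕ0 k = k ,ₕ sym (+-identityˡ _)

  private
    symₕ : ∀ {x y} → x ≈ₕ y → y ≈ₕ x
    symₕ {x} {y} (k ,ₕ e) = (- k) ,ₕ (begin
      y                              ≈⟨ +-identityʳ y ⟨
      y ⊕ 0#                         ≈⟨ +-congˡ (-‿inverseʳ (k ⊛ h)) ⟨
      y ⊕ (k ⊛ h - k ⊛ h)            ≈⟨ +-assoc _ _ _ ⟨
      (y ⊕ k ⊛ h) - k ⊛ h            ≈⟨ +-cong (sym e) (-‿distribˡ-* k h) ⟩
      x ⊕ (- k) ⊛ h                  ∎)

    transₕ : ∀ {x y z} → x ≈ₕ y → y ≈ₕ z → x ≈ₕ z
    transₕ {x} {y} {z} (k ,ₕ e) (l ,ₕ e′) = (l ⊕ k) ,ₕ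
      trans e (trans (+-congʳ e′) (trans (+-assoc z _ _) (+-congˡ (sym (distribʳ h l k)))))

    +-congₕ : ∀ {x x′ y y′} → x ≈ₕ x′ → y ≈ₕ y′ → x ⊕ y ≈ₕ x′ ⊕ y′
    +-congₕ (k ,ₕ e) (l ,ₕ e′) = (k ⊕ l) ,ₕ
      trans (+-cong e e′) (trans (interchange _ _ _ _) (+-congˡ (sym (distribʳ h k l))))

    *-congₕ : ∀ {x x′ y y′} → x ≈ₕ x′ → y ≈ₕ y′ → x ⊛ y ≈ₕ x′ ⊛ y′
    *-congₕ {x} {x′} {y} {y′} (k ,ₕ e) (l ,ₕ e′) = (k ⊛ y′ ⊕ (x′ ⊕ k ⊛ h) ⊛ l) ,ₕ
      trans (*-cong e e′) (solve 5 (λ x y k l h →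
        (x :+ k :* h) :* (y :+ l :* h) := x :* y :+ (k :* y :+ (x :+ k :* h) :* l) :* h) refl x′ y′ k l h)

    -‿congₕ : ∀ {x y} → x ≈ₕ y → - x ≈ₕ - y
    -‿congₕ {x} {y} (k ,ₕ e) = (- k) ,ₕ (begin
      - x                  ≈⟨ -‿cong e ⟩
      - (y ⊕ k ⊛ h)        ≈⟨ -‿+-comm y (k ⊛ h) ⟨
      - y - k ⊛ h          ≈⟨ +-congˡ (-‿distribˡ-* k h) ⟩
      - y ⊕ (- k) ⊛ h      ∎)

  quotientRing : CommutativeRing c (c ⊔ ℓ)
  quotientRing = record
    { Carrier = Carrier ; _≈_ = _≈ₕ_ ; _+_ = _⊕_ ; _*_ = _⊛_ ; -_ = -_ ; 0# = 0# ; 1# = 1#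
    ; isCommutativeRing = record
      { *-comm = λ x y → ≈⇒≈ₕ (*-comm x y)
      ; isRing = record
        { +-isAbelianGroup = record
          { comm = λ x y → ≈⇒≈ₕ (+-comm x y)
          ; isGroup = record
            { isMonoid = record
              { identity = (λ x → ≈⇒≈ₕ (+-identityˡ x)) , (λ x → ≈⇒≈ₕ (+-identityʳ x))
              ; isSemigroup = record
                { assoc = λ x y z → ≈⇒≈ₕ (+-assoc x y z)
                ; isMagma = record
                  { isEquivalence = record { refl = ≈⇒≈ₕ refl ; sym = symₕ ; trans = transₕ }
                  ; ∙-cong = +-congₕ } } }
            ; inverse = (λ x → ≈⇒≈ₕ (-‿inverseˡ x)) , (λ x → ≈⇒≈ₕ (-‿inverseʳ x))
            ; ⁻¹-cong = -‿congₕ } }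
        ; *-cong = *-congₕ
        ; *-assoc = λ x y z → ≈⇒≈ₕ (*-assoc x y z)
        ; *-identity = (λ x → ≈⇒≈ₕ (*-identityˡ x)) , (λ x → ≈⇒≈ₕ (*-identityʳ x))
        ; distrib = (λ x y z → ≈⇒≈ₕ (distribˡ x y z)) , (λ x y z → ≈⇒≈ₕ (distribʳ x y z))
        } } }

-- Coprimality, residues and bounds for finite sums

module Arithmetic where

  open ≡ using (refl; sym; trans; module ≡-Reasoning)

  coprime-*ʳ : ∀ {e x y} → Coprime e x → Coprime e y → Coprime e (x * y)
  coprime-*ʳ e⊥x e⊥y (d∣e , d∣xy) =
    e⊥y (d∣e , coprime-divisor (λ (i∣d , i∣x) → e⊥x (∣-trans i∣d d∣e , i∣x)) d∣xy)

  coprime-^ʳ : ∀ {e x} → Coprime e x → ∀ a → Coprime e (x ℕ.^ a)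
  coprime-^ʳ e⊥x zero    (d∣e , d∣1) = ∣1⇒≡1 d∣1
  coprime-^ʳ e⊥x (suc a) = coprime-*ʳ e⊥x (coprime-^ʳ e⊥x a)

  prime∤⇒coprime : ∀ {p e} → Prime p → ¬ p ∣ e → Coprime e p
  prime∤⇒coprime pp p∤e (d∣e , d∣p) with prime⇒irreducible pp d∣p
  ... | inj₁ d≡1  = d≡1
  ... | inj₂ refl = contradiction d∣e p∤e

  opaque
    coprime-inverse : ∀ {m n} → Coprime m n → 1 < n → ∃[ a ] ∃[ b ] a * m ≡ 1 + b * n
    coprime-inverse {m} {n} m⊥n 1<n with coprime-Bézout m⊥n
    ... | Bézout.+- x y eq = x , y , sym eq
    ... | Bézout.-+ x y eq with x * m in xm≡s
    ...   | zero   = contradiction (∣1⇒≡1 (divides y eq)) (ℕ.<⇒≢ 1<n ∘ sym)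
    -- Here `1 + x * m` is a multiple of `n`, so `x * m` is -1 mod `n` and its square is 1; hence
    -- `x * (x * m)` inverts `m`. The multiplier `s′ * y` comes from (s + 1)² - 1 = s (s + 2).
    ...   | suc s′ = x * suc s′ , s′ * y , (begin
      x * suc s′ * m            ≡⟨ ℕ.*-assoc x (suc s′) m ⟩
      x * (suc s′ * m)          ≡⟨ cong (x *_) (ℕ.*-comm (suc s′) m) ⟩
      x * (m * suc s′)          ≡⟨ ℕ.*-assoc x m (suc s′) ⟨
      x * m * suc s′            ≡⟨ cong (_* suc s′) xm≡s ⟩
      suc s′ * suc s′           ≡⟨ square s′ ⟩
      1 + s′ * (2 + s′)         ≡⟨ cong (λ t → 1 + s′ * t) eq ⟩
      1 + s′ * (y * n)          ≡⟨ cong suc (ℕ.*-assoc s′ y n) ⟨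
      1 + s′ * y * n            ∎)
      where
      open ≡-Reasoning
      square : ∀ s → suc s * suc s ≡ 1 + s * (2 + s)
      square = solve-∀

  prime⇒n>1 : ∀ {p} → Prime p → 1 < p
  prime⇒n>1 {p} pp = ℕ.nonTrivial⇒n>1 p ⦃ prime⇒nonTrivial pp ⦄

  m<n*m : ∀ m {n} .⦃ _ : NonZero m ⦄ → 1 < n → m < n * m
  m<n*m m {n} 1<n = subst (m <_) (ℕ.*-comm m n) (ℕ.m<m*n m n 1<n)

  module Sumℕ = Sum ℕ.+-*-commutativeSemiring
  open Sumℕ using () renaming (∑ to ∑ℕ) public

  ∑ℕ-mono : ∀ n {F G : ℕ → ℕ} → (∀ i → i < n → F i ≤ G i) → ∑ℕ n F ≤ ∑ℕ n G
  ∑ℕ-mono zero    le = z≤n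
  ∑ℕ-mono (suc n) le = ℕ.+-mono-≤ (le 0 z<s) (∑ℕ-mono n λ i i<n → le (suc i) (s<s i<n))

  ∑ℕ-const : ∀ n c → ∑ℕ n (λ _ → c) ≡ n * c
  ∑ℕ-const zero    c = refl
  ∑ℕ-const (suc n) c = cong (_+_ c) (∑ℕ-const n c)

  opaque
    -- The Iverson bracket. It is opaque, so that a divisibility test in a goal stays a single term
    -- and is handled through the lemmas below.
    [_] : ∀ {a} {A : Set a} → Dec A → ℕ
    [ A? ] = if does A? then 1 else 0

    [true] : ∀ {a} {A : Set a} (A? : Dec A) → A → [ A? ] ≡ 1
    [true] A? a = cong (if_then 1 else 0) (dec-true A? a)

    [false] : ∀ {a} {A : Set a} (A? : Dec A) → ¬ A → [ A? ] ≡ 0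
    [false] A? ¬a = cong (if_then 1 else 0) (dec-false A? ¬a)

    [≤1] : ∀ {a} {A : Set a} (A? : Dec A) → [ A? ] ≤ 1
    [≤1] A? with does A?
    ... | true  = ℕ.≤-refl
    ... | false = z≤n

  open ≡-Reasoning

  module Sumℤ = Sum ℤ.+-*-commutativeSemiring
  open Sumℤ using () renaming (∑ to ∑ℤ) public

  Periodic : ∀ {a} {A : Set a} → ℕ → (ℕ → A) → Set a
  Periodic n F = ∀ i → F (i + n) ≡ F i

  -- Congruences of natural numbers are presented with a multiple of `n` added on each side, which
  -- avoids subtraction; `∣-+*` uses the same format.
  %-≡ : ∀ {m m′} k k′ n .⦃ _ : NonZero n ⦄ → m + k * n ≡ m′ + k′ * n → m % n ≡ m′ % n
  %-≡ {m} {m′} k k′ n e = begin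
    m % n              ≡⟨ [m+kn]%n≡m%n m k n ⟨
    (m + k * n) % n    ≡⟨ cong (_% n) e ⟩
    (m′ + k′ * n) % n  ≡⟨ [m+kn]%n≡m%n m′ k′ n ⟩
    m′ % n             ∎

  suc-% : ∀ m n .⦃ _ : NonZero n ⦄ → suc m % n ≡ suc (m % n) % n
  suc-% m n = %-≡ 0 (m / n) n (trans (ℕ.+-identityʳ (suc m)) (cong suc (m≡m%n+[m/n]*n m n)))

  if-yes : ∀ {a b} {A : Set a} {B : Set b} (A? : Dec A) {x y : B} → A → (if does A? then x else y) ≡ x
  if-yes A? a = cong (if_then _ else _) (dec-true A? a)

  if-no : ∀ {a b} {A : Set a} {B : Set b} (A? : Dec A) {x y : B} → ¬ A → (if does A? then x else y) ≡ y
  if-no A? ¬a = cong (if_then _ else _) (dec-false A? ¬a)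

  ∣∑∣≤∑∣∣ : ∀ n (F : ℕ → ℤ) → ℤ.∣ ∑ℤ n F ∣ ≤ ∑ℕ n (λ a → ℤ.∣ F a ∣)
  ∣∑∣≤∑∣∣ zero    F = z≤n
  ∣∑∣≤∑∣∣ (suc n) F = ℕ.≤-trans (ℤ.∣i+j∣≤∣i∣+∣j∣ (F 0) _) (ℕ.+-monoʳ-≤ ℤ.∣ F 0 ∣ (∣∑∣≤∑∣∣ n (F ∘ suc)))

  -- For disjoint supports, where bounds do not add up: it serves the kernel living on one class mod
  -- p and the summands whose exponents are distinct mod m.
  ∑ℕ-at-most-one : ∀ n {F : ℕ → ℕ} {d} → (∀ i → i < n → F i ≤ d) →
    (∀ i j → i < n → j < n → ¬ F i ≡ 0 → ¬ F j ≡ 0 → i ≡ j) → ∑ℕ n F ≤ d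
  ∑ℕ-at-most-one zero                le unique = z≤n
  ∑ℕ-at-most-one (suc n) {F} {d} le unique = go (F 0 ≟ 0)
    where
    go : Dec (F 0 ≡ 0) → F 0 + ∑ℕ n (F ∘ suc) ≤ d
    go (yes F0≡0) = subst (λ x → x + ∑ℕ n (F ∘ suc) ≤ d) (sym F0≡0)
      (∑ℕ-at-most-one n (λ i i<n → le (suc i) (s<s i<n))
        λ i j i<n j<n Fi≢0 Fj≢0 → ℕ.suc-injective (unique (suc i) (suc j) (s<s i<n) (s<s j<n) Fi≢0 Fj≢0))
    go (no F0≢0) = subst (_≤ d) (sym (trans (cong (_+_ (F 0))
        (trans (Sumℕ.∑-cong n λ i i<n → F-suc i i<n (F (suc i) ≟ 0)) (Sumℕ.∑-0 n))) (ℕ.+-identityʳ (F 0))))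
      (le 0 z<s)
      where
      F-suc : ∀ i → i < n → Dec (F (suc i) ≡ 0) → F (suc i) ≡ 0
      F-suc i i<n (yes F≡0) = F≡0
      F-suc i i<n (no  F≢0) = contradiction (unique 0 (suc i) z<s (s<s i<n) F0≢0 F≢0) λ ()

  ∑ℕ-vanishing : ∀ n {F : ℕ → ℕ} → (∀ i → i < n → F i ≤ 1) → ∀ {k} → k < n → F k ≡ 0 → ∑ℕ n F ≤ ℕ.pred n
  ∑ℕ-vanishing (suc n) {F} le {zero} _ F0≡0 = subst (λ x → x + ∑ℕ n (F ∘ suc) ≤ n) (sym F0≡0)
    (ℕ.≤-trans (∑ℕ-mono n λ i i<n → le (suc i) (s<s i<n))
      (ℕ.≤-reflexive (trans (∑ℕ-const n 1) (ℕ.*-identityʳ n))))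
  ∑ℕ-vanishing (suc (suc n)) {F} le {suc k} (s≤s k<n) Fk≡0 =
    ℕ.+-mono-≤ (le 0 z<s) (∑ℕ-vanishing (suc n) (λ i i<n → le (suc i) (s<s i<n)) k<n Fk≡0)

  ∣-+* : ∀ {d x y} k l → x + k * d ≡ y + l * d → d ∣ x → d ∣ y
  ∣-+* {d} {x} {y} k l e d∣x = ∣m+n∣m⇒∣n {m = l * d} (subst (d ∣_) (trans e (ℕ.+-comm y (l * d)))
    (∣m∣n⇒∣m+n d∣x (n∣m*n k))) (n∣m*n l)

  ∣-shift-≮ : ∀ {d i j} C → j < d → d ∣ i + C → d ∣ j + C → ¬ i < j
  ∣-shift-≮ {d} {i} {j} C j<d d∣i+C d∣j+C i<j =
    >⇒∤ ⦃ ℕ.>-nonZero (ℕ.m<n⇒0<n∸m i<j) ⦄ (ℕ.≤-<-trans (ℕ.m∸n≤m j i) j<d)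
      (∣m+n∣m⇒∣n (subst (d ∣_) (begin
        j + C                  ≡⟨ cong (_+ C) (ℕ.m+[n∸m]≡n (ℕ.<⇒≤ i<j)) ⟨
        i + (j ∸ i) + C        ≡⟨ swap i (j ∸ i) C ⟩
        i + C + (j ∸ i)        ∎) d∣j+C) d∣i+C)
    where
    swap : ∀ x y z → x + y + z ≡ x + z + y
    swap = solve-∀

  ∣-shift-unique : ∀ {d i j} C → i < d → j < d → d ∣ i + C → d ∣ j + C → i ≡ j
  ∣-shift-unique C i<d j<d d∣i+C d∣j+C = ℕ.≤-antisym
    (ℕ.≮⇒≥ (∣-shift-≮ C i<d d∣j+C d∣i+C)) (ℕ.≮⇒≥ (∣-shift-≮ C j<d d∣i+C d∣j+C))

  ∣-%-shift : ∀ {d m n} .⦃ _ : NonZero d ⦄ C → m % d ≡ n % d → d ∣ m + C → d ∣ n + C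
  ∣-%-shift {d} {m} {n} C e = ∣-+* (n / d) (m / d) (begin
    m + C + n / d * d                          ≡⟨ cong (λ x → x + C + n / d * d) (m≡m%n+[m/n]*n m d) ⟩
    m % d + m / d * d + C + n / d * d          ≡⟨ cong (λ x → x + m / d * d + C + n / d * d) e ⟩
    n % d + m / d * d + C + n / d * d          ≡⟨ swap (n % d) (m / d * d) C (n / d * d) ⟩
    n % d + n / d * d + C + m / d * d          ≡⟨ cong (λ x → x + C + m / d * d) (m≡m%n+[m/n]*n n d) ⟨
    n + C + m / d * d                          ∎)
    where
    swap : ∀ x y z w → x + y + z + w ≡ x + w + z + y
    swap = solve-∀

  -- `C * pred d` plays the part of -C, since adding C to it gives a multiple of d.
  ∣-complement : ∀ d .⦃ _ : NonZero d ⦄ C → ∃[ a ] a < d × d ∣ a + C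
  ∣-complement d C = (C * ℕ.pred d) % d , m%n<n (C * ℕ.pred d) d ,
    ∣-+* 0 (C * ℕ.pred d / d) (begin
      C * d + 0                                              ≡⟨ ℕ.+-identityʳ (C * d) ⟩
      C * d                                                  ≡⟨ cong (C *_) (ℕ.suc-pred d) ⟨
      C * suc (ℕ.pred d)                                     ≡⟨ trans (ℕ.*-suc C (ℕ.pred d)) (ℕ.+-comm C _) ⟩
      C * ℕ.pred d + C                                       ≡⟨ cong (_+ C) (m≡m%n+[m/n]*n (C * ℕ.pred d) d) ⟩
      (C * ℕ.pred d) % d + C * ℕ.pred d / d * d + C          ≡⟨ swap ((C * ℕ.pred d) % d) _ C ⟩
      (C * ℕ.pred d) % d + C + C * ℕ.pred d / d * d          ∎) (n∣m*n C)
    where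
    swap : ∀ x y z → x + y + z ≡ x + z + y
    swap = solve-∀

  coprime-∣-* : ∀ {m n o} → Coprime m n → m ∣ o → n ∣ o → m * n ∣ o
  coprime-∣-* {m} {n} m⊥n m∣o (divides k refl) =
    *-monoˡ-∣ n (coprime-divisor m⊥n (subst (m ∣_) (ℕ.*-comm k n) m∣o))

  [∣?]-cong : ∀ {d m n} → (d ∣ m → d ∣ n) → (d ∣ n → d ∣ m) → [ d ∣? m ] ≡ [ d ∣? n ]
  [∣?]-cong {d} {m} {n} to from = go (d ∣? n)
    where
    go : Dec (d ∣ n) → [ d ∣? m ] ≡ [ d ∣? n ]
    go (yes d∣n) = trans ([true] (d ∣? m) (from d∣n)) (sym ([true] (d ∣? n) d∣n))
    go (no  d∤n) = trans ([false] (d ∣? m) (d∤n ∘ to)) (sym ([false] (d ∣? n) d∤n))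

  -- Source of the bracket in the difference equation of the kernel `OrderPQ.kernelPQ`, which is
  -- built from a quotient by pq.
  suc-/ : ∀ m n .⦃ _ : NonZero n ⦄ → suc m / n ≡ m / n + [ n ∣? suc m ]
  suc-/ m n = go (suc (m % n) ≟ n)
    where
    suc-m≡ : suc m ≡ suc (m % n) + m / n * n
    suc-m≡ = cong suc (m≡m%n+[m/n]*n m n)

    quotient≡ : suc m / n ≡ suc (m % n) / n + m / n
    quotient≡ = begin
      suc m / n                              ≡⟨ cong (_/ n) suc-m≡ ⟩
      (suc (m % n) + m / n * n) / n          ≡⟨ +-distrib-/-∣ʳ (suc (m % n)) (n∣m*n (m / n)) ⟩
      suc (m % n) / n + m / n * n / n        ≡⟨ cong (_+_ (suc (m % n) / n)) (m*n/n≡m (m / n) n) ⟩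
      suc (m % n) / n + m / n                ∎

    go : Dec (suc (m % n) ≡ n) → suc m / n ≡ m / n + [ n ∣? suc m ]
    go (yes e) = begin
      suc m / n                         ≡⟨ quotient≡ ⟩
      suc (m % n) / n + m / n           ≡⟨ cong (λ x → x / n + m / n) e ⟩
      n / n + m / n                     ≡⟨ cong (_+ m / n) (n/n≡1 n) ⟩
      1 + m / n                         ≡⟨ ℕ.+-comm 1 (m / n) ⟩
      m / n + 1                         ≡⟨ cong (_+_ (m / n)) ([true] (n ∣? suc m) (divides (suc (m / n)) (trans suc-m≡ (cong (_+ m / n * n) e)))) ⟨
      m / n + [ n ∣? suc m ]            ∎
    go (no ne) = begin
      suc m / n                         ≡⟨ quotient≡ ⟩
      suc (m % n) / n + m / n           ≡⟨ cong (_+ m / n) (m<n⇒m/n≡0 lt) ⟩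
      m / n                             ≡⟨ ℕ.+-identityʳ (m / n) ⟨
      m / n + 0                         ≡⟨ cong (_+_ (m / n)) ([false] (n ∣? suc m) λ n∣ → >⇒∤ lt
                                             (∣-+* 0 (m / n) (trans (ℕ.+-identityʳ (suc m)) suc-m≡) n∣)) ⟨
      m / n + [ n ∣? suc m ]            ∎
      where
      lt : suc (m % n) < n
      lt = ℕ.≤∧≢⇒< (m%n<n m n) ne

  ∣m-n∣≤ : ∀ {d} m n → m ≤ d → n ≤ d → ℤ.∣ + m ℤ.- + n ∣ ≤ d
  ∣m-n∣≤ {d} m n m≤d n≤d = subst (λ z → ℤ.∣ z ∣ ≤ d) (sym (ℤ.m-n≡m⊖n m n))
    (ℕ.≤-trans (ℤ.∣m⊝n∣≤m⊔n m n) (ℕ.⊔-lub m≤d n≤d))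

open Arithmetic

-- Reduction modulo functions periodic mod p or mod q

module PeriodicReduction where

  open ≡ using (refl; sym; trans; module ≡-Reasoning)

  open ≡-Reasoning

  -- In ℤ[y] / Φ p q, functions of n that are periodic mod p or mod q are killed by
  -- Σ_{n < pq} (-) yⁿ.  Here the values of V on one class a mod p are reduced so that
  -- the first p + q - 1 exponents disappear.  These exponents, as edges joining their
  -- classes mod p and mod q, form a spanning tree of K_{p,q}; deleting the edges at a
  -- breaks it up, and `level` is the value of V at the edge through which the
  -- component of n hangs on a.
  module Row (p q : ℕ) .⦃ p≢0 : NonZero p ⦄ .⦃ q≢0 : NonZero q ⦄
    (q⁻¹ b : ℕ) (q⁻¹-inverse : q⁻¹ * q ≡ 1 + b * p)
    (V : ℕ → ℤ) (a : ℕ) (a<p : a < p) where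

    private
      -a : ℕ
      -a = p ∸ a

      a-a : a + -a ≡ p
      a-a = ℕ.m+[n∸m]≡n (ℕ.<⇒≤ a<p)

    -- The i < p with n ≡ a + i q mod p.
    index : ℕ → ℕ
    index n = q⁻¹ * (n + -a) % p

    index< : ∀ n → index n < p
    index< n = m%n<n (q⁻¹ * (n + -a)) p

    index-spec : ∀ n → n % p ≡ (a + index n * q) % p
    index-spec n = %-≡ (1 + b * (n + -a)) (X / p * q) p (sym (begin
      a + i * q + X / p * q * p             ≡⟨ collect a i q (X / p) p ⟩
      a + (i + X / p * p) * q               ≡⟨ cong (λ x → a + x * q) (m≡m%n+[m/n]*n X p) ⟨
      a + q⁻¹ * (n + -a) * q                ≡⟨ commute a q⁻¹ (n + -a) q ⟩
      a + q⁻¹ * q * (n + -a)                ≡⟨ cong (λ x → a + x * (n + -a)) q⁻¹-inverse ⟩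
      a + (1 + b * p) * (n + -a)            ≡⟨ expand a b p n -a ⟩
      n + (a + -a) + b * (n + -a) * p       ≡⟨ cong (λ x → n + x + b * (n + -a) * p) a-a ⟩
      n + p + b * (n + -a) * p              ≡⟨ ℕ.+-assoc n p _ ⟩
      n + (1 + b * (n + -a)) * p            ∎))
      where
      X = q⁻¹ * (n + -a)
      i = index n
      collect : ∀ a i q x p → a + i * q + x * q * p ≡ a + (i + x * p) * q
      collect = solve-∀
      commute : ∀ a x y q → a + x * y * q ≡ a + x * q * y
      commute = solve-∀
      expand : ∀ a b p n c → a + (1 + b * p) * (n + c) ≡ n + (a + c) + b * (n + c) * p
      expand = solve-∀

    -- The reason for numbering the classes mod p along multiples of q: the exponents n and n + q
    -- share their class mod q, and passing between them is a cyclic successor on the classes mod p.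
    index-+q : ∀ n → index (n + q) ≡ suc (index n) % p
    index-+q n = begin
      index (n + q)                        ≡⟨ %-≡ 0 b p eq ⟩
      suc (q⁻¹ * (n + -a)) % p             ≡⟨ suc-% (q⁻¹ * (n + -a)) p ⟩
      suc (index n) % p                    ∎
      where
      expand : ∀ x n q c → x * (n + q + c) + 0 ≡ x * q + x * (n + c)
      expand = solve-∀
      swap : ∀ b p x → 1 + b * p + x ≡ suc x + b * p
      swap = solve-∀
      eq : q⁻¹ * (n + q + -a) + 0 * p ≡ suc (q⁻¹ * (n + -a)) + b * p
      eq = trans (expand q⁻¹ n q -a) (trans (cong (_+ q⁻¹ * (n + -a)) q⁻¹-inverse) (swap b p _))

    index-+p : Periodic p index
    index-+p n = %-≡ 0 q⁻¹ p (expand q⁻¹ n p -a)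
      where
      expand : ∀ x n p c → x * (n + p + c) + 0 ≡ x * (n + c) + x * p
      expand = solve-∀

    index≡0⇒ : ∀ {n} → index n ≡ 0 → n % p ≡ a
    index≡0⇒ {n} i≡0 = begin
      n % p                      ≡⟨ index-spec n ⟩
      (a + index n * q) % p      ≡⟨ cong (λ i → (a + i * q) % p) i≡0 ⟩
      (a + 0) % p                ≡⟨ cong (_% p) (ℕ.+-identityʳ a) ⟩
      a % p                      ≡⟨ m<n⇒m%n≡m a<p ⟩
      a                          ∎

    ⇒index≡0 : ∀ {n} → n % p ≡ a → index n ≡ 0
    ⇒index≡0 {n} n%p≡a = trans (%-≡ 0 (q⁻¹ * suc (n / p)) p (begin
      q⁻¹ * (n + -a) + 0                             ≡⟨ cong (λ n → q⁻¹ * (n + -a) + 0) (m≡m%n+[m/n]*n n p) ⟩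
      q⁻¹ * (n % p + n / p * p + -a) + 0             ≡⟨ cong (λ r → q⁻¹ * (r + n / p * p + -a) + 0) n%p≡a ⟩
      q⁻¹ * (a + n / p * p + -a) + 0                 ≡⟨ regroup q⁻¹ a (n / p * p) -a ⟩
      q⁻¹ * (a + -a + n / p * p)                     ≡⟨ cong (λ x → q⁻¹ * (x + n / p * p)) a-a ⟩
      q⁻¹ * (suc (n / p) * p)                        ≡⟨ ℕ.*-assoc q⁻¹ (suc (n / p)) p ⟨
      q⁻¹ * suc (n / p) * p                          ∎)) (0%n≡0 p)
      where
      regroup : ∀ x a y c → x * (a + y + c) + 0 ≡ x * (a + c + y)
      regroup = solve-∀
      0%n≡0 : ∀ n .⦃ _ : NonZero n ⦄ → 0 % n ≡ 0
      0%n≡0 (suc n) = refl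

    private
      -- Consecutive classes i and i + 1 are linked by a pair n, n + q of tree edges with n < p - 1.
      -- Only the class of p - 1 has no such link to its successor, because p - 1 + q is the first
      -- exponent outside the tree; so the cycle of classes is cut after this index.
      lastIndex : ℕ
      lastIndex = index (ℕ.pred p)

      -- The edge at the class `a` that is linked to the class of index p - 1. The classes up to the
      -- cut hang on `a` through the exponent `a`, those behind the cut through this one.
      wrapped : ℕ
      wrapped = (a + ℕ.pred p * q) % p + q

    level : ℕ → ℤ
    level i = if does (i ≤? lastIndex) then V a else V wrapped

    value : ℕ → ℤ
    value n = if does (index n ≟ 0) then V n else level (index n)

    -- On the first p + q - 1 exponents `value` depends only on the class mod q, so subtracting its
    -- values at the least residues makes it vanish there. Off the class `a`, `value` depends only
    -- on the class mod p. Both corrections are thus periodic.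
    reduced : ℕ → ℤ
    reduced n = value n ℤ.- value (n % q)

    value-on : ∀ {n} → index n ≡ 0 → value n ≡ V n
    value-on {n} = if-yes (index n ≟ 0)

    value-off : ∀ {n} → ¬ index n ≡ 0 → value n ≡ level (index n)
    value-off {n} = if-no (index n ≟ 0)

    wrapped-row : wrapped % p ≡ a
    wrapped-row = trans (%-≡ ((a + ℕ.pred p * q) / p) q p (begin
      (a + ℕ.pred p * q) % p + q + (a + ℕ.pred p * q) / p * p   ≡⟨ swap ((a + ℕ.pred p * q) % p) q _ ⟩
      (a + ℕ.pred p * q) % p + (a + ℕ.pred p * q) / p * p + q   ≡⟨ cong (_+ q) (m≡m%n+[m/n]*n (a + ℕ.pred p * q) p) ⟨
      a + ℕ.pred p * q + q                                      ≡⟨ collect a (ℕ.pred p) q ⟩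
      a + q * suc (ℕ.pred p)                                    ≡⟨ cong (λ n → a + q * n) (ℕ.suc-pred p) ⟩
      a + q * p                                                 ∎)) (m<n⇒m%n≡m a<p)
      where
      swap : ∀ x y z → x + y + z ≡ x + z + y
      swap = solve-∀
      collect : ∀ a p q → a + p * q + q ≡ a + q * suc p
      collect = solve-∀

    value∈row : ∀ n → ∃[ m ] m % p ≡ a × value n ≡ V m
    value∈row n = go (index n ≟ 0) (index n ≤? lastIndex)
      where
      go : Dec (index n ≡ 0) → Dec (index n ≤ lastIndex) → ∃[ m ] m % p ≡ a × value n ≡ V m
      go (yes i≡0) _        = n , index≡0⇒ i≡0 , value-on i≡0
      go (no  i≢0) (yes i≤) = a , m<n⇒m%n≡m a<p , trans (value-off i≢0) (if-yes (index n ≤? lastIndex) i≤)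
      go (no  i≢0) (no  i≰) = wrapped , wrapped-row , trans (value-off i≢0) (if-no (index n ≤? lastIndex) i≰)

    -- Every value of `value` is attained by `V` on the class `a`, so `reduced` is a single
    -- difference of `V` within that class.
    ∣reduced∣≤ : ∀ {D} → (∀ m n → m % p ≡ a → n % p ≡ a → ℤ.∣ V m ℤ.- V n ∣ ≤ D) → ∀ n → ℤ.∣ reduced n ∣ ≤ D
    ∣reduced∣≤ {D} bound n with value∈row n | value∈row (n % q)
    ... | m , m∈a , e | m′ , m′∈a , e′ =
      subst (λ x → ℤ.∣ x ∣ ≤ D) (sym (cong₂ ℤ._-_ e e′)) (bound m m′ m∈a m′∈a)

    -- For n < p - 1 the step from i to i + 1 never crosses the cut. It leaves the class `a`, and
    -- then n is `a` itself; or it stays in one component; or it enters the class `a`, and then n +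
    -- q is `wrapped`.
    value-+q : ∀ n → n < ℕ.pred p → value (n + q) ≡ value n
    value-+q n n<p-1 = go (index n ≟ 0) (suc i ≟ p)
      where
      i = index n

      n<p : n < p
      n<p = ℕ.<-≤-trans n<p-1 ℕ.pred[n]≤n

      n≡ : n ≡ (a + i * q) % p
      n≡ = trans (sym (m<n⇒m%n≡m n<p)) (index-spec n)

      i≢last : ¬ i ≡ lastIndex
      i≢last i≡last = ℕ.<⇒≢ n<p-1 (begin
        n                             ≡⟨ n≡ ⟩
        (a + i * q) % p               ≡⟨ cong (λ i → (a + i * q) % p) i≡last ⟩
        (a + lastIndex * q) % p       ≡⟨ index-spec (ℕ.pred p) ⟨
        ℕ.pred p % p                  ≡⟨ m<n⇒m%n≡m (ℕ.≤-reflexive (ℕ.suc-pred p)) ⟩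
        ℕ.pred p                      ∎)

      level-suc : level (suc i) ≡ level i
      level-suc with i ≤? lastIndex
      ... | yes i≤ = trans (if-yes (suc i ≤? lastIndex) (ℕ.≤∧≢⇒< i≤ i≢last)) (sym (if-yes (i ≤? lastIndex) i≤))
      ... | no  i≰ = trans (if-no (suc i ≤? lastIndex) (i≰ ∘ ℕ.<⇒≤)) (sym (if-no (i ≤? lastIndex) i≰))

      index-step : ¬ suc i ≡ p → index (n + q) ≡ suc i
      index-step 1+i≢p = trans (index-+q n) (m<n⇒m%n≡m (ℕ.≤∧≢⇒< (index< n) 1+i≢p))

      go : Dec (i ≡ 0) → Dec (suc i ≡ p) → value (n + q) ≡ value n
      go (yes i≡0) (yes 1+i≡p) = contradiction n<p-1 (ℕ.≤⇒≯ (ℕ.≤-trans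
        (ℕ.≤-reflexive (cong ℕ.pred (trans (sym 1+i≡p) (cong suc i≡0)))) z≤n))
      go (yes i≡0) (no 1+i≢p) = begin
        value (n + q)               ≡⟨ value-off (λ e → ℕ.1+n≢0 (trans (sym (index-step 1+i≢p)) e)) ⟩
        level (index (n + q))       ≡⟨ cong level (trans (index-step 1+i≢p) (cong suc i≡0)) ⟩
        level 1                     ≡⟨ if-yes (1 ≤? lastIndex) (ℕ.n≢0⇒n>0 λ last≡0 → i≢last (trans i≡0 (sym last≡0))) ⟩
        V a                         ≡⟨ cong V (trans (sym (index≡0⇒ i≡0)) (m<n⇒m%n≡m n<p)) ⟩
        V n                         ≡⟨ value-on i≡0 ⟨
        value n                     ∎
      go (no i≢0) (no 1+i≢p) = begin
        value (n + q)               ≡⟨ value-off (λ e → ℕ.1+n≢0 (trans (sym (index-step 1+i≢p)) e)) ⟩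
        level (index (n + q))       ≡⟨ cong level (index-step 1+i≢p) ⟩
        level (suc i)               ≡⟨ level-suc ⟩
        level i                     ≡⟨ value-off i≢0 ⟨
        value n                     ∎
      go (no i≢0) (yes 1+i≡p) = begin
        value (n + q)               ≡⟨ value-on (trans (index-+q n) (trans (cong (_% p) 1+i≡p) (n%n≡0 p))) ⟩
        V (n + q)                   ≡⟨ cong (λ m → V (m + q)) (trans n≡ (cong (λ i → (a + i * q) % p) i≡p-1)) ⟩
        V wrapped                   ≡⟨ if-no (i ≤? lastIndex) (λ i≤ → i≢last (ℕ.≤-antisym i≤ (subst (lastIndex ≤_) (sym i≡p-1) (ℕ.<⇒≤pred (index< (ℕ.pred p)))))) ⟨
        level i                     ≡⟨ value-off i≢0 ⟨
        value n                     ∎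
        where
        i≡p-1 : i ≡ ℕ.pred p
        i≡p-1 = cong ℕ.pred 1+i≡p

    reduced≡0 : ∀ n → n < ℕ.pred p + q → reduced n ≡ 0ℤ
    reduced≡0 n n< = ℤ.i≡j⇒i-j≡0 (begin
      value n                              ≡⟨ cong value n≡ ⟩
      value (n % q + n / q * q)            ≡⟨ steps (n / q) (subst (_< ℕ.pred p + q) n≡ n<) ⟩
      value (n % q)                        ∎)
      where
      n≡ = m≡m%n+[m/n]*n n q

      steps : ∀ k → n % q + k * q < ℕ.pred p + q → value (n % q + k * q) ≡ value (n % q)
      steps zero    _  = cong value (ℕ.+-identityʳ (n % q))
      steps (suc k) lt = begin
        value (n % q + (q + k * q))        ≡⟨ cong value (swap (n % q) q (k * q)) ⟩
        value (n % q + k * q + q)          ≡⟨ value-+q (n % q + k * q) lt′ ⟩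
        value (n % q + k * q)              ≡⟨ steps k (ℕ.<-≤-trans lt′ (ℕ.m≤m+n (ℕ.pred p) q)) ⟩
        value (n % q)                      ∎
        where
        swap : ∀ x y z → x + (y + z) ≡ x + z + y
        swap = solve-∀
        lt′ : n % q + k * q < ℕ.pred p
        lt′ = ℕ.+-cancelʳ-< q _ _ (subst (_< ℕ.pred p + q) (swap (n % q) q (k * q)) lt)

    rowPart : ℕ → ℤ
    rowPart n = if does (index n ≟ 0) then 0ℤ else ℤ.- level (index n)

    reduced-spec : ∀ n → (if does (n % p ≟ a) then V n else 0ℤ) ≡ reduced n ℤ.+ (rowPart n ℤ.+ value (n % q))
    reduced-spec n = go (index n ≟ 0)
      where
      cancel : ∀ x y → x ≡ x ℤ.- y ℤ.+ (0ℤ ℤ.+ y)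
      cancel = ℤ-solve
      cancel′ : ∀ x y → 0ℤ ≡ x ℤ.- y ℤ.+ (ℤ.- x ℤ.+ y)
      cancel′ = ℤ-solve

      go : Dec (index n ≡ 0) → (if does (n % p ≟ a) then V n else 0ℤ) ≡ reduced n ℤ.+ (rowPart n ℤ.+ value (n % q))
      go (yes i≡0) = begin
        (if does (n % p ≟ a) then V n else 0ℤ)             ≡⟨ if-yes (n % p ≟ a) (index≡0⇒ i≡0) ⟩
        V n                                                ≡⟨ value-on i≡0 ⟨
        value n                                            ≡⟨ cancel (value n) (value (n % q)) ⟩
        reduced n ℤ.+ (0ℤ ℤ.+ value (n % q))               ≡⟨ cong (λ x → reduced n ℤ.+ (x ℤ.+ value (n % q))) (if-yes (index n ≟ 0) i≡0) ⟨
        reduced n ℤ.+ (rowPart n ℤ.+ value (n % q))        ∎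
      go (no i≢0) = begin
        (if does (n % p ≟ a) then V n else 0ℤ)             ≡⟨ if-no (n % p ≟ a) (i≢0 ∘ ⇒index≡0) ⟩
        0ℤ                                                 ≡⟨ cancel′ (value n) (value (n % q)) ⟩
        reduced n ℤ.+ (ℤ.- value n ℤ.+ value (n % q))      ≡⟨ cong (λ x → reduced n ℤ.+ (ℤ.- x ℤ.+ value (n % q))) (value-off i≢0) ⟩
        reduced n ℤ.+ (ℤ.- level (index n) ℤ.+ value (n % q)) ≡⟨ cong (λ x → reduced n ℤ.+ (x ℤ.+ value (n % q))) (if-no (index n ≟ 0) i≢0) ⟨
        reduced n ℤ.+ (rowPart n ℤ.+ value (n % q))        ∎

    rowPart-periodic : Periodic p rowPart
    rowPart-periodic n = cong (λ i → if does (i ≟ 0) then 0ℤ else ℤ.- level i) (index-+p n)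

  record Reduction (p q d : ℕ) (V : ℕ → ℤ) : Set where
    field
      remainder         : ℕ → ℤ
      p-part q-part     : ℕ → ℤ
      decomposition     : ∀ n → V n ≡ remainder n ℤ.+ (p-part n ℤ.+ q-part n)
      p-part-periodic   : Periodic p p-part
      q-part-periodic   : Periodic q q-part
      remainder≡0       : ∀ n → n < ℕ.pred p + q → remainder n ≡ 0ℤ
      remainder-bounded : ∀ n → ℤ.∣ remainder n ∣ ≤ d

  reduction : ∀ p q .⦃ _ : NonZero p ⦄ .⦃ _ : NonZero q ⦄ (q⁻¹ b : ℕ) → q⁻¹ * q ≡ 1 + b * p →
    ∀ {d} (V : ℕ → ℤ) (D : ℕ → ℕ) → (∀ m n → m % p ≡ n % p → ℤ.∣ V m ℤ.- V n ∣ ≤ D (n % p)) →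
    ∑ℕ p D ≤ d → Reduction p q d V
  reduction p q q⁻¹ b inv {d} V D bound ∑D≤d = record
    { remainder         = remainder
    ; p-part            = λ n → ∑ℤ p λ a → Residue.rowPart a n
    ; q-part            = λ n → ∑ℤ p λ a → Residue.value a (n % q)
    ; decomposition     = λ n → begin
        V n                                                             ≡⟨ Sumℤ.∑-pick p (m%n<n n p) (λ _ → V n) ⟨
        ∑ℤ p (λ a → if does (n % p ≟ a) then V n else 0ℤ)               ≡⟨ Sumℤ.∑-cong p (λ a a<p → cong (λ r → if does (n % p ≟ r) then V n else 0ℤ) (m<n⇒m%n≡m a<p)) ⟨
        ∑ℤ p (λ a → if does (n % p ≟ a % p) then V n else 0ℤ)           ≡⟨ Sumℤ.∑-cong p (λ a _ → Residue.reduced-spec a n) ⟩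
        ∑ℤ p (λ a → Residue.reduced a n ℤ.+ (Residue.rowPart a n ℤ.+ Residue.value a (n % q)))
          ≡⟨ trans (Sumℤ.∑-+ p _ _) (cong (ℤ._+_ (remainder n)) (Sumℤ.∑-+ p _ _)) ⟩
        remainder n ℤ.+ ((∑ℤ p λ a → Residue.rowPart a n) ℤ.+ (∑ℤ p λ a → Residue.value a (n % q))) ∎
    ; p-part-periodic   = λ n → Sumℤ.∑-cong p λ a _ → Residue.rowPart-periodic a n
    ; q-part-periodic   = λ n → cong (λ r → ∑ℤ p λ a → Residue.value a r) ([m+n]%n≡m%n n q)
    ; remainder≡0       = λ n n< → trans (Sumℤ.∑-cong p λ a _ → Residue.reduced≡0 a n n<) (Sumℤ.∑-0 p)
    ; remainder-bounded = λ n → ℕ.≤-trans (∣∑∣≤∑∣∣ p λ a → Residue.reduced a n)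
        (ℕ.≤-trans (∑ℕ-mono p λ a a<p → Residue.∣reduced∣≤ a (row-bound a a<p) n) ∑D≤d)
    }
    where
    -- `a % p` makes the module available for every natural number `a`, as the sums over `a`
    -- require; below p it is `a`.
    module Residue (a : ℕ) = Row p q q⁻¹ b inv V (a % p) (m%n<n a p)

    remainder : ℕ → ℤ
    remainder n = ∑ℤ p λ a → Residue.reduced a n

    row-bound : ∀ a → a < p → ∀ m n → m % p ≡ a % p → n % p ≡ a % p → ℤ.∣ V m ℤ.- V n ∣ ≤ D a
    row-bound a a<p m n m∈a n∈a = subst (λ r → ℤ.∣ V m ℤ.- V n ∣ ≤ D r)
      (trans n∈a (m<n⇒m%n≡m a<p)) (bound m n (trans m∈a (sym n∈a)))

open PeriodicReduction

-- Explicit inverses of y^κ - 1 as functions on ℤ/pq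

module Kernels where

  open ≡ using (refl; sym; trans; module ≡-Reasoning)

  open ≡-Reasoning

  -- Modulo functions that are periodic mod p or mod q, V(n) - V(n + κ) is c at n ≡ - κ mod pq
  -- and 0 elsewhere; so Σ V(n) yⁿ / c inverts y^κ - 1.
  record Kernel (p q κ c d : ℕ) : Set where
    field
      kernel          : ℕ → ℤ
      kernel-periodic : Periodic (p * q) kernel
      p-part q-part   : ℕ → ℤ
      p-part-periodic : Periodic p p-part
      q-part-periodic : Periodic q q-part
      difference      : ∀ n → kernel n ≡
        kernel (n + κ) ℤ.+ (+ (c * [ p * q ∣? n + κ ]) ℤ.+ (p-part n ℤ.+ q-part n))
      reductions      : ∀ C → Reduction p q d (λ n → kernel (n + C))

  module _ (p q κ : ℕ) (1<p : 1 < p) (1<q : 1 < q) (p⊥q : Coprime p q) where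
    private instance
      p≢0 : NonZero p
      p≢0 = ℕ.>-nonZero (ℕ.<⇒≤ 1<p)
      q≢0 : NonZero q
      q≢0 = ℕ.>-nonZero (ℕ.<⇒≤ 1<q)
      pq≢0 : NonZero (p * q)
      pq≢0 = ℕ.m*n≢0 p q

    private
      q-inverse : ∃[ a ] ∃[ b ] a * q ≡ 1 + b * p
      q-inverse = coprime-inverse (Coprimality.sym p⊥q) 1<p

      reduce : ∀ {d} (V : ℕ → ℤ) (D : ℕ → ℕ) → (∀ m n → m % p ≡ n % p → ℤ.∣ V m ℤ.- V n ∣ ≤ D (n % p)) →
        ∑ℕ p D ≤ d → Reduction p q d V
      reduce = reduction p q (proj₁ q-inverse) (proj₁ (proj₂ q-inverse)) (proj₂ (proj₂ q-inverse))

    module OrderQ (p∣κ : p ∣ κ) (κ⊥q : Coprime κ q) where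
      private
        inverse = coprime-inverse κ⊥q 1<q
        w b : ℕ
        w = proj₁ inverse
        b = proj₁ (proj₂ inverse)

        wκ≡1+bq : w * κ ≡ 1 + b * q
        wκ≡1+bq = proj₂ (proj₂ inverse)

      -- n / κ mod q
      r : ℕ → ℕ
      r n = n * w % q

      r-+κ : ∀ n → r (n + κ) ≡ suc (r n) % q
      r-+κ n = trans (%-≡ 0 b q (begin
        (n + κ) * w + 0 * q          ≡⟨ expand n κ w ⟩
        n * w + w * κ                ≡⟨ cong (_+_ (n * w)) wκ≡1+bq ⟩
        n * w + (1 + b * q)          ≡⟨ ℕ.+-suc (n * w) (b * q) ⟩
        suc (n * w) + b * q          ∎)) (suc-% (n * w) q)
        where
        expand : ∀ n κ w → (n + κ) * w + 0 ≡ n * w + w * κ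
        expand = solve-∀

      r≡0⇒q∣ : ∀ {n} → r n ≡ 0 → q ∣ n
      r≡0⇒q∣ {n} r≡0 = ∣-+* 0 (n * b) (trans (expand n w κ) (trans (cong (n *_) wκ≡1+bq) (expand′ n b q)))
        (∣m⇒∣m*n κ (m%n≡0⇒n∣m (n * w) q r≡0))
        where
        expand : ∀ n w κ → n * w * κ + 0 ≡ n * (w * κ)
        expand = solve-∀
        expand′ : ∀ n b q → n * (1 + b * q) ≡ n + n * b * q
        expand′ = solve-∀

      q∣⇒r≡0 : ∀ {n} → q ∣ n → r n ≡ 0
      q∣⇒r≡0 {n} q∣n = n∣m⇒m%n≡0 (n * w) q (∣m⇒∣m*n w q∣n)

      suc-r : ∀ n → suc (r n) ≡ r (n + κ) + q * [ q ∣? n + κ ]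
      suc-r n = go (suc (r n) ≟ q)
        where
        go : Dec (suc (r n) ≡ q) → suc (r n) ≡ r (n + κ) + q * [ q ∣? n + κ ]
        go (yes e) = begin
          suc (r n)                           ≡⟨ e ⟩
          q                                   ≡⟨ ℕ.*-identityʳ q ⟨
          0 + q * 1                           ≡⟨ cong₂ (λ x y → x + q * y) r≡0 ([true] (q ∣? n + κ) (r≡0⇒q∣ {n + κ} r≡0)) ⟨
          r (n + κ) + q * [ q ∣? n + κ ]      ∎
          where
          r≡0 : r (n + κ) ≡ 0
          r≡0 = trans (r-+κ n) (trans (cong (_% q) e) (n%n≡0 q))
        go (no ne) = begin
          suc (r n)                           ≡⟨ r≡suc ⟨
          r (n + κ)                           ≡⟨ ℕ.+-identityʳ _ ⟨
          r (n + κ) + 0                       ≡⟨ cong (_+_ (r (n + κ))) (ℕ.*-zeroʳ q) ⟨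
          r (n + κ) + q * 0                   ≡⟨ cong (λ y → r (n + κ) + q * y) ([false] (q ∣? n + κ) λ q∣ →
                                                   ℕ.1+n≢0 (trans (sym r≡suc) (q∣⇒r≡0 {n + κ} q∣))) ⟨
          r (n + κ) + q * [ q ∣? n + κ ]      ∎
          where
          r≡suc : r (n + κ) ≡ suc (r n)
          r≡suc = trans (r-+κ n) (m<n⇒m%n≡m (ℕ.≤∧≢⇒< (m%n<n (n * w) q) ne))

      -- With z = y^κ of order q, (z - 1) Σ_{r<q} r z^r = q - Σ_{r<q} z^r = q. As p divides κ, the
      -- exponent rκ is a multiple of p, and mod pq it is the only one in its class mod q; `V` takes
      -- the value r there.
      V : ℕ → ℕ
      V n = [ p ∣? n ] * r n

      V≤ : ∀ n → V n ≤ ℕ.pred q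
      V≤ n = ℕ.≤-trans (ℕ.*-monoˡ-≤ (r n) ([≤1] (p ∣? n)))
        (ℕ.≤-trans (ℕ.≤-reflexive (ℕ.*-identityˡ (r n))) (ℕ.<⇒≤pred (m%n<n (n * w) q)))

      V≡0 : ∀ {n} → ¬ p ∣ n → V n ≡ 0
      V≡0 {n} p∤n = cong (_* r n) ([false] (p ∣? n) p∤n)

      [p∣]-+κ : ∀ n → [ p ∣? n + κ ] ≡ [ p ∣? n ]
      [p∣]-+κ n = [∣?]-cong (λ p∣n+κ → ∣m+n∣m⇒∣n (subst (p ∣_) (ℕ.+-comm n κ) p∣n+κ) p∣κ) (λ p∣n → ∣m∣n⇒∣m+n p∣n p∣κ)

      -- The same identity read off coefficientwise. The bracket on the left stands for Σ z^r; being
      -- periodic mod p, it is discarded as `p-part`. The multiple of q records the return of `r`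
      -- from q - 1 to 0.
      V-difference : ∀ n → V n + [ p ∣? n ] ≡ V (n + κ) + q * [ p * q ∣? n + κ ]
      V-difference n = go (p ∣? n)
        where
        I = [ p ∣? n ]
        go : Dec (p ∣ n) → V n + I ≡ V (n + κ) + q * [ p * q ∣? n + κ ]
        go (yes p∣n) = begin
          I * r n + I                                   ≡⟨ cong (λ i → i * r n + i) ([true] (p ∣? n) p∣n) ⟩
          1 * r n + 1                                   ≡⟨ simplify (r n) ⟩
          suc (r n)                                     ≡⟨ suc-r n ⟩
          r (n + κ) + q * [ q ∣? n + κ ]                ≡⟨ cong₂ (λ x y → x + q * y) (sym (trans (cong (_* r (n + κ)) (trans ([p∣]-+κ n) ([true] (p ∣? n) p∣n))) (ℕ.*-identityˡ _)))
                                                             (both (q ∣? n + κ)) ⟩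
          V (n + κ) + q * [ p * q ∣? n + κ ]            ∎
          where
          simplify : ∀ x → 1 * x + 1 ≡ suc x
          simplify = solve-∀
          both : Dec (q ∣ n + κ) → [ q ∣? n + κ ] ≡ [ p * q ∣? n + κ ]
          both (yes q∣) = trans ([true] (q ∣? n + κ) q∣)
            (sym ([true] (p * q ∣? n + κ) (coprime-∣-* p⊥q (∣m∣n⇒∣m+n p∣n p∣κ) q∣)))
          both (no q∤) = trans ([false] (q ∣? n + κ) q∤) (sym ([false] (p * q ∣? n + κ) (q∤ ∘ m*n∣⇒n∣ p q)))
        go (no p∤n) = begin
          I * r n + I                                   ≡⟨ cong (λ i → i * r n + i) ([false] (p ∣? n) p∤n) ⟩
          0                                             ≡⟨ ℕ.*-zeroʳ q ⟨
          0 * r (n + κ) + q * 0                         ≡⟨ cong₂ (λ x y → x * r (n + κ) + q * y) (trans ([p∣]-+κ n) ([false] (p ∣? n) p∤n))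
                                                             ([false] (p * q ∣? n + κ) λ pq∣ → p∤n (∣m+n∣m⇒∣n (subst (p ∣_) (ℕ.+-comm n κ) (m*n∣⇒m∣ p q pq∣)) p∣κ)) ⟨
          V (n + κ) + q * [ p * q ∣? n + κ ]            ∎

      kernelQ : Kernel p q κ q (ℕ.pred q)
      kernelQ = record
        { kernel          = λ n → + V n
        ; kernel-periodic = λ n → cong +_ (cong₂ _*_
            ([∣?]-cong (λ p∣ → ∣m+n∣m⇒∣n (subst (p ∣_) (ℕ.+-comm n (p * q)) p∣) (m∣m*n q)) (λ p∣n → ∣m∣n⇒∣m+n p∣n (m∣m*n q)))
            (%-≡ 0 (p * w) q (expand n p q w)))
        ; p-part          = λ n → ℤ.- + [ p ∣? n ]
        ; q-part          = λ _ → 0ℤ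
        ; p-part-periodic = λ n → cong (λ i → ℤ.- + i)
            ([∣?]-cong (λ p∣ → ∣m+n∣m⇒∣n (subst (p ∣_) (ℕ.+-comm n p) p∣) ∣-refl) (λ p∣n → ∣m∣n⇒∣m+n p∣n ∣-refl))
        ; q-part-periodic = λ _ → refl
        ; difference      = λ n → move (+ V n) (+ [ p ∣? n ]) (+ V (n + κ)) (+ (q * [ p * q ∣? n + κ ])) (cong +_ (V-difference n))
        -- Shifted by C, `V` lives on the single class of -C mod p, so only that class oscillates,
        -- by at most q - 1.
        ; reductions      = λ C → reduce (λ n → + V (n + C)) (λ a → [ p ∣? a + C ] * ℕ.pred q)
            (λ m n m≡n → bound C m n m≡n (p ∣? m + C))
            (∑ℕ-at-most-one p
              (λ a _ → ℕ.≤-trans (ℕ.*-monoˡ-≤ (ℕ.pred q) ([≤1] (p ∣? a + C))) (ℕ.≤-reflexive (ℕ.*-identityˡ (ℕ.pred q))))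
              (λ a a′ a<p a′<p a≢0 a′≢0 → ∣-shift-unique C a<p a′<p (nonzero⇒∣ a≢0) (nonzero⇒∣ a′≢0)))
        }
        where
        expand : ∀ n p q w → (n + p * q) * w + 0 ≡ n * w + p * w * q
        expand = solve-∀

        move : ∀ v i v′ j → v ℤ.+ i ≡ v′ ℤ.+ j → v ≡ v′ ℤ.+ (j ℤ.+ (ℤ.- i ℤ.+ 0ℤ))
        move v i v′ j e = trans (cancel v i) (trans (cong (ℤ._- i) e) (regroup v′ j i))
          where
          cancel : ∀ v i → v ≡ v ℤ.+ i ℤ.- i
          cancel = ℤ-solve
          regroup : ∀ v j i → v ℤ.+ j ℤ.- i ≡ v ℤ.+ (j ℤ.+ (ℤ.- i ℤ.+ 0ℤ))
          regroup = ℤ-solve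

        nonzero⇒∣ : ∀ {m} → ¬ [ p ∣? m ] * ℕ.pred q ≡ 0 → p ∣ m
        nonzero⇒∣ {m} ≢0 = decidable-stable (p ∣? m) λ p∤m → ≢0 (cong (_* ℕ.pred q) ([false] (p ∣? m) p∤m))

        bound : ∀ C m n → m % p ≡ n % p → Dec (p ∣ m + C) →
          ℤ.∣ + V (m + C) ℤ.- + V (n + C) ∣ ≤ [ p ∣? n % p + C ] * ℕ.pred q
        bound C m n m≡n (yes p∣m) = ∣m-n∣≤ (V (m + C)) (V (n + C)) (≤D (m + C)) (≤D (n + C))
          where
          ≤D : ∀ m → V m ≤ [ p ∣? n % p + C ] * ℕ.pred q
          ≤D m = ℕ.≤-trans (V≤ m) (ℕ.≤-reflexive (sym (trans
            (cong (_* ℕ.pred q) ([true] (p ∣? n % p + C) (∣-%-shift C (trans m≡n (sym (m%n%n≡m%n n p))) p∣m)))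
            (ℕ.*-identityˡ (ℕ.pred q)))))
        bound C m n m≡n (no p∤m) = subst (_≤ [ p ∣? n % p + C ] * ℕ.pred q)
          (sym (cong₂ (λ x y → ℤ.∣ + x ℤ.- + y ∣) (V≡0 p∤m) (V≡0 λ p∣n → p∤m (∣-%-shift C (sym m≡n) p∣n)))) z≤n

    module OrderPQ (κ⊥p : Coprime κ p) (κ⊥q : Coprime κ q) where
      private
        inverse₁ = coprime-inverse {κ * q} {p} (Coprimality.sym (coprime-*ʳ (Coprimality.sym κ⊥p) p⊥q)) 1<p
        inverse₂ = coprime-inverse {κ * p} {q} (Coprimality.sym (coprime-*ʳ (Coprimality.sym κ⊥q) (Coprimality.sym p⊥q))) 1<q
        w₁ b₁ w₂ b₂ : ℕ
        w₁ = proj₁ inverse₁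
        b₁ = proj₁ (proj₂ inverse₁)
        w₂ = proj₁ inverse₂
        b₂ = proj₁ (proj₂ inverse₂)

        inv₁ : w₁ * (κ * q) ≡ 1 + b₁ * p
        inv₁ = proj₂ (proj₂ inverse₁)
        inv₂ : w₂ * (κ * p) ≡ 1 + b₂ * q
        inv₂ = proj₂ (proj₂ inverse₂)

        -- Inverses of q mod p and of p mod q, left in the form κ w because (n + κ) w = n w + κ w:
        -- passing from n to n + κ adds α to u and β to v, hence 1 to s modulo pq.
        α β : ℕ
        α = κ * w₁
        β = κ * w₂

        αq : α * q ≡ 1 + b₁ * p
        αq = trans (swap κ w₁ q) inv₁
          where
          swap : ∀ x y z → x * y * z ≡ y * (x * z)
          swap = solve-∀
        βp : β * p ≡ 1 + b₂ * q
        βp = trans (swap κ w₂ p) inv₂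
          where
          swap : ∀ x y z → x * y * z ≡ y * (x * z)
          swap = solve-∀

      -- n / κ ≡ u q + v p mod pq with 0 ≤ u < p and 0 ≤ v < q: the carry uq + vp ≥ pq is the
      -- indicator of the gaps of the numerical semigroup ⟨p , q⟩.
      u v s : ℕ → ℕ
      u n = n * w₁ % p
      v n = n * w₂ % q
      s n = u n * q + v n * p

      -- The first depends on n mod p only, the second on n mod q only; so both vanish under
      -- evaluation at y.
      carry₁ carry₂ : ℕ → ℕ
      carry₁ n = (u n + α) / p
      carry₂ n = (v n + β) / q

      -- The generating function of the semigroup ⟨p , q⟩ is Φ_pq(z) / (1 - z), so its gaps satisfy
      -- (1 - z) Σ z^g = 1 - Φ_pq(z). Hence minus the indicator of the gaps inverts z - 1 for z =
      -- y^κ.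
      V : ℕ → ℕ
      V n = s n / (p * q)

      private
        residue-step : ∀ n w m .⦃ _ : NonZero m ⦄ → n * w % m + κ * w ≡ (n + κ) * w % m + (n * w % m + κ * w) / m * m
        residue-step n w m = begin
          x + κ * w                              ≡⟨ m≡m%n+[m/n]*n (x + κ * w) m ⟩
          (x + κ * w) % m + (x + κ * w) / m * m  ≡⟨ cong (_+ (x + κ * w) / m * m) (%-≡ (n * w / m) 0 m (begin
            x + κ * w + n * w / m * m              ≡⟨ swap x (κ * w) _ ⟩
            x + n * w / m * m + κ * w              ≡⟨ cong (_+ κ * w) (m≡m%n+[m/n]*n (n * w) m) ⟨
            n * w + κ * w                          ≡⟨ expand n w κ ⟩
            (n + κ) * w + 0                        ∎)) ⟩
          (n + κ) * w % m + (x + κ * w) / m * m  ∎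
          where
          x = n * w % m
          swap : ∀ x y z → x + y + z ≡ x + z + y
          swap = solve-∀
          expand : ∀ n w κ → n * w + κ * w ≡ (n + κ) * w + 0
          expand = solve-∀

        -- The number on the right is α q + β p - 1, rewritten by α q = 1 + b₁ p so that nothing is
        -- subtracted.
        pq∣ : p * q ∣ (b₁ + β) * p
        pq∣ = coprime-∣-* p⊥q (n∣m*n (b₁ + β)) (divides (α + b₂) (ℕ.suc-injective (begin
          suc ((b₁ + β) * p)            ≡⟨ cong suc (ℕ.*-distribʳ-+ p b₁ β) ⟩
          1 + b₁ * p + β * p            ≡⟨ cong₂ _+_ αq (sym βp) ⟨
          α * q + (1 + b₂ * q)          ≡⟨ expand α q b₂ ⟩
          suc ((α + b₂) * q)            ∎)))
          where
          expand : ∀ α q b → α * q + (1 + b * q) ≡ suc ((α + b) * q)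
          expand = solve-∀

        L : ℕ
        L = quotient pq∣

        αq+βp : α * q + β * p ≡ suc (L * (p * q))
        αq+βp = begin
          α * q + β * p              ≡⟨ cong (_+ β * p) αq ⟩
          1 + b₁ * p + β * p         ≡⟨ cong suc (ℕ.*-distribʳ-+ p b₁ β) ⟨
          suc ((b₁ + β) * p)         ≡⟨ cong suc (_∣_.equality pq∣) ⟩
          suc (L * (p * q))          ∎

      -- Reducing u + α mod p and v + β mod q costs one multiple of pq for each unit of carry; `L`
      -- accounts for α q + β p exceeding 1.
      s-step : ∀ n → suc (s n) + L * (p * q) ≡ s (n + κ) + (carry₁ n + carry₂ n) * (p * q)
      s-step n = begin
        suc (s n) + L * (p * q)                              ≡⟨ ℕ.+-suc (s n) _ ⟨
        s n + suc (L * (p * q))                              ≡⟨ cong (_+_ (s n)) αq+βp ⟨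
        s n + (α * q + β * p)                                ≡⟨ collect (u n) q (v n) p α β ⟩
        (u n + α) * q + (v n + β) * p                        ≡⟨ cong₂ (λ x y → x * q + y * p) (residue-step n w₁ p) (residue-step n w₂ q) ⟩
        (u (n + κ) + carry₁ n * p) * q + (v (n + κ) + carry₂ n * q) * p
                                                             ≡⟨ expand (u (n + κ)) (carry₁ n) (v (n + κ)) (carry₂ n) p q ⟩
        s (n + κ) + (carry₁ n + carry₂ n) * (p * q)          ∎
        where
        collect : ∀ u q v p α β → u * q + v * p + (α * q + β * p) ≡ (u + α) * q + (v + β) * p
        collect = solve-∀
        expand : ∀ u a v b p q → (u + a * p) * q + (v + b * q) * p ≡ u * q + v * p + (a + b) * (p * q)
        expand = solve-∀

      -- κ (s(n) + 1) ≡ n + κ modulo p and modulo q.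
      private
        κs-p : ∀ n → κ * suc (s n) + κ * (n * w₁ / p) * q * p ≡ n + κ + (n * b₁ + κ * v n) * p
        κs-p n = begin
          κ * suc (u n * q + v n * p) + κ * (n * w₁ / p) * q * p    ≡⟨ collect κ (u n) q (v n) p (n * w₁ / p) ⟩
          κ * q * (u n + n * w₁ / p * p) + κ + κ * v n * p          ≡⟨ cong (λ x → κ * q * x + κ + κ * v n * p) (m≡m%n+[m/n]*n (n * w₁) p) ⟨
          κ * q * (n * w₁) + κ + κ * v n * p                        ≡⟨ cong (λ x → x + κ + κ * v n * p) (swap (κ * q) n w₁) ⟩
          n * (w₁ * (κ * q)) + κ + κ * v n * p                      ≡⟨ cong (λ x → n * x + κ + κ * v n * p) inv₁ ⟩
          n * (1 + b₁ * p) + κ + κ * v n * p                        ≡⟨ expand n b₁ p κ (v n) ⟩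
          n + κ + (n * b₁ + κ * v n) * p                            ∎
          where
          collect : ∀ κ u q v p x → κ * suc (u * q + v * p) + κ * x * q * p ≡ κ * q * (u + x * p) + κ + κ * v * p
          collect = solve-∀
          swap : ∀ x n w → x * (n * w) ≡ n * (w * x)
          swap = solve-∀
          expand : ∀ n b p κ v → n * (1 + b * p) + κ + κ * v * p ≡ n + κ + (n * b + κ * v) * p
          expand = solve-∀

        κs-q : ∀ n → κ * suc (s n) + κ * (n * w₂ / q) * p * q ≡ n + κ + (n * b₂ + κ * u n) * q
        κs-q n = begin
          κ * suc (u n * q + v n * p) + κ * (n * w₂ / q) * p * q    ≡⟨ collect κ (u n) q (v n) p (n * w₂ / q) ⟩
          κ * p * (v n + n * w₂ / q * q) + κ + κ * u n * q          ≡⟨ cong (λ x → κ * p * x + κ + κ * u n * q) (m≡m%n+[m/n]*n (n * w₂) q) ⟨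
          κ * p * (n * w₂) + κ + κ * u n * q                        ≡⟨ cong (λ x → x + κ + κ * u n * q) (swap (κ * p) n w₂) ⟩
          n * (w₂ * (κ * p)) + κ + κ * u n * q                      ≡⟨ cong (λ x → n * x + κ + κ * u n * q) inv₂ ⟩
          n * (1 + b₂ * q) + κ + κ * u n * q                        ≡⟨ expand n b₂ q κ (u n) ⟩
          n + κ + (n * b₂ + κ * u n) * q                            ∎
          where
          collect : ∀ κ u q v p x → κ * suc (u * q + v * p) + κ * x * p * q ≡ κ * p * (v + x * q) + κ + κ * u * q
          collect = solve-∀
          swap : ∀ x n w → x * (n * w) ≡ n * (w * x)
          swap = solve-∀
          expand : ∀ n b p κ v → n * (1 + b * p) + κ + κ * v * p ≡ n + κ + (n * b + κ * v) * p
          expand = solve-∀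

      pq∣1+s : ∀ n → [ p * q ∣? suc (s n) ] ≡ [ p * q ∣? n + κ ]
      pq∣1+s n = [∣?]-cong to from
        where
        to : p * q ∣ suc (s n) → p * q ∣ n + κ
        to pq∣1+s = coprime-∣-* p⊥q
          (∣-+* (κ * (n * w₁ / p) * q) (n * b₁ + κ * v n) (κs-p n) (∣n⇒∣m*n κ (m*n∣⇒m∣ p q pq∣1+s)))
          (∣-+* (κ * (n * w₂ / q) * p) (n * b₂ + κ * u n) (κs-q n) (∣n⇒∣m*n κ (m*n∣⇒n∣ p q pq∣1+s)))

        from : p * q ∣ n + κ → p * q ∣ suc (s n)
        from pq∣n+κ = coprime-∣-* p⊥q
          (coprime-divisor (Coprimality.sym κ⊥p)
            (∣-+* (n * b₁ + κ * v n) (κ * (n * w₁ / p) * q) (sym (κs-p n)) (m*n∣⇒m∣ p q pq∣n+κ)))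
          (coprime-divisor (Coprimality.sym κ⊥q)
            (∣-+* (n * b₂ + κ * u n) (κ * (n * w₂ / q) * p) (sym (κs-q n)) (m*n∣⇒n∣ p q pq∣n+κ)))

      -- `s-step` divided by pq. By `suc-/` the extra 1 changes the quotient exactly where pq
      -- divides `suc (s n)`, and this means that pq divides n + κ.
      V-difference : ∀ n → V n + [ p * q ∣? n + κ ] + L ≡ V (n + κ) + (carry₁ n + carry₂ n)
      V-difference n = begin
        V n + [ p * q ∣? n + κ ] + L                            ≡⟨ cong (λ i → V n + i + L) (pq∣1+s n) ⟨
        V n + [ p * q ∣? suc (s n) ] + L                        ≡⟨ cong (_+ L) (suc-/ (s n) (p * q)) ⟨
        suc (s n) / (p * q) + L                                 ≡⟨ +*-/ (suc (s n)) L ⟨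
        (suc (s n) + L * (p * q)) / (p * q)                     ≡⟨ cong (_/ (p * q)) (s-step n) ⟩
        (s (n + κ) + (carry₁ n + carry₂ n) * (p * q)) / (p * q) ≡⟨ +*-/ (s (n + κ)) (carry₁ n + carry₂ n) ⟩
        V (n + κ) + (carry₁ n + carry₂ n)                       ∎
        where
        +*-/ : ∀ x y → (x + y * (p * q)) / (p * q) ≡ x / (p * q) + y
        +*-/ x y = trans (+-distrib-/-∣ʳ x (n∣m*n y)) (cong (_+_ (x / (p * q))) (m*n/n≡m y (p * q)))

      V≤1 : ∀ n → V n ≤ 1
      V≤1 n = ℕ.<⇒≤pred (m<n*o⇒m/o<n {s n} {2} {p * q} (ℕ.<-≤-trans
        (ℕ.+-mono-< (ℕ.*-monoˡ-< q (m%n<n (n * w₁) p)) (ℕ.*-monoˡ-< p (m%n<n (n * w₂) q)))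
        (ℕ.≤-reflexive (double p q))))
        where
        double : ∀ p q → p * q + q * p ≡ 2 * (p * q)
        double = solve-∀

      V≡0 : ∀ {n} → p ∣ n → V n ≡ 0
      V≡0 {n} p∣n = m<n⇒m/n≡0 (subst (_< p * q)
        (cong (λ x → x * q + v n * p) (sym (n∣m⇒m%n≡0 (n * w₁) p (∣m⇒∣m*n w₁ p∣n))))
        (subst (v n * p <_) (ℕ.*-comm q p) (ℕ.*-monoˡ-< p (m%n<n (n * w₂) q))))

      -- V vanishes on the class of 0 mod p, hence the bound p - 1 instead of p.
      kernelPQ : Kernel p q κ 1 (ℕ.pred p)
      kernelPQ = record
        { kernel          = λ n → ℤ.- + V n
        ; kernel-periodic = λ n → cong (λ x → ℤ.- + (x / (p * q))) (cong₂ (λ x y → x * q + y * p)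
            (%-≡ 0 (q * w₁) p (expand n p q w₁)) (%-≡ 0 (p * w₂) q (expand′ n p q w₂)))
        ; p-part          = λ n → + L ℤ.- + carry₁ n
        ; q-part          = λ n → ℤ.- + carry₂ n
        ; p-part-periodic = λ n → cong (λ x → + L ℤ.- + ((x + α) / p)) (%-≡ 0 w₁ p (expand″ n p w₁))
        ; q-part-periodic = λ n → cong (λ x → ℤ.- + ((x + β) / q)) (%-≡ 0 w₂ q (expand″ n q w₂))
        ; difference      = λ n → subst (λ i → ℤ.- + V n ≡ ℤ.- + V (n + κ) ℤ.+ (+ i ℤ.+ (+ L ℤ.- + carry₁ n ℤ.- + carry₂ n)))
            (sym (ℕ.*-identityˡ [ p * q ∣? n + κ ]))
            (move (+ V n) (+ [ p * q ∣? n + κ ]) (+ L) (+ V (n + κ)) (+ carry₁ n) (+ carry₂ n) (cong +_ (V-difference n)))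
        ; reductions      = λ C → reduce (λ n → ℤ.- + V (n + C)) (λ a → 1 ∸ [ p ∣? a + C ])
            (λ m n m≡n → subst (_≤ 1 ∸ [ p ∣? n % p + C ]) (sym (negated (V (m + C)) (V (n + C)))) (bound C m n m≡n (p ∣? m + C)))
            (let a , a<p , p∣a+C = ∣-complement p C in
             ∑ℕ-vanishing p (λ a _ → ℕ.m∸n≤m 1 [ p ∣? a + C ]) a<p (cong (_∸_ 1) ([true] (p ∣? a + C) p∣a+C)))
        }
        where
        expand : ∀ n p q w → (n + p * q) * w + 0 ≡ n * w + q * w * p
        expand = solve-∀
        expand′ : ∀ n p q w → (n + p * q) * w + 0 ≡ n * w + p * w * q
        expand′ = solve-∀
        expand″ : ∀ n p w → (n + p) * w + 0 ≡ n * w + w * p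
        expand″ = solve-∀

        move : ∀ v i l v′ a b → v ℤ.+ i ℤ.+ l ≡ v′ ℤ.+ (a ℤ.+ b) → ℤ.- v ≡ ℤ.- v′ ℤ.+ (i ℤ.+ (l ℤ.- a ℤ.- b))
        move v i l v′ a b e = trans (cancel v i l) (trans (cong (λ x → ℤ.- x ℤ.+ i ℤ.+ l) e) (regroup v′ i l a b))
          where
          cancel : ∀ v i l → ℤ.- v ≡ ℤ.- (v ℤ.+ i ℤ.+ l) ℤ.+ i ℤ.+ l
          cancel = ℤ-solve
          regroup : ∀ v i l a b → ℤ.- (v ℤ.+ (a ℤ.+ b)) ℤ.+ i ℤ.+ l ≡ ℤ.- v ℤ.+ (i ℤ.+ (l ℤ.- a ℤ.- b))
          regroup = ℤ-solve

        negated : ∀ x y → ℤ.∣ ℤ.- + x ℤ.- ℤ.- + y ∣ ≡ ℤ.∣ + x ℤ.- + y ∣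
        negated x y = trans (cong ℤ.∣_∣ (factor (+ x) (+ y))) (ℤ.∣-i∣≡∣i∣ (+ x ℤ.- + y))
          where
          factor : ∀ x y → ℤ.- x ℤ.- ℤ.- y ≡ ℤ.- (x ℤ.- y)
          factor = ℤ-solve

        bound : ∀ C m n → m % p ≡ n % p → Dec (p ∣ m + C) →
          ℤ.∣ + V (m + C) ℤ.- + V (n + C) ∣ ≤ 1 ∸ [ p ∣? n % p + C ]
        bound C m n m≡n (yes p∣m) = subst (_≤ 1 ∸ [ p ∣? n % p + C ])
          (sym (cong₂ (λ x y → ℤ.∣ + x ℤ.- + y ∣) (V≡0 p∣m) (V≡0 (∣-%-shift C m≡n p∣m)))) z≤n
        bound C m n m≡n (no p∤m) = subst (λ i → ℤ.∣ + V (m + C) ℤ.- + V (n + C) ∣ ≤ 1 ∸ i)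
          (sym ([false] (p ∣? n % p + C) λ p∣ → p∤m (∣-%-shift C (trans (m%n%n≡m%n n p) (sym m≡n)) p∣)))
          (∣m-n∣≤ (V (m + C)) (V (n + C)) (V≤1 (m + C)) (V≤1 (n + C)))

open Kernels

-- Evaluation at roots of unity and the inverse of ζ^i - ζ^j

module Evaluation {c ℓ} (R : CommutativeRing c ℓ) (ι : ℤ → CommutativeRing.Carrier R)
  (ι-+ : ∀ a b → CommutativeRing._≈_ R (ι (a ℤ.+ b)) (CommutativeRing._+_ R (ι a) (ι b)))
  (ι-0 : CommutativeRing._≈_ R (ι 0ℤ) (CommutativeRing.0# R)) where

  open CommutativeRing R hiding (_*_; _+_)
  open CommutativeRing R using () renaming (_*_ to _⊛_; _+_ to _⊕_)
  open Geometric R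
  open SemiringSolver commutativeSemiring using (solve; _:=_; _:*_; _:+_; con)
  open RingProperties ring using ([y-z]x≈yx-zx)
  open GroupProperties +-group using (∙-cancelˡ)
  open import Relation.Binary.Reasoning.Setoid setoid

  ι-∑ : ∀ n F → ι (∑ℤ n F) ≈ ∑ n (ι ∘ F)
  ι-∑ zero    F = ι-0
  ι-∑ (suc n) F = trans (ι-+ (F 0) _) (+-congˡ (ι-∑ n (F ∘ suc)))

  eval : ℕ → (ℕ → ℤ) → Carrier → Carrier
  eval n F y = ∑ n (λ i → ι (F i) ⊛ y ^ i)

  eval-cong : ∀ n {F G} → (∀ i → i < n → F i ≡ G i) → ∀ y → eval n F y ≈ eval n G y
  eval-cong n e y = ∑-cong n λ i i<n → *-congʳ (reflexive (cong ι (e i i<n)))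

  eval-+ : ∀ n F G y → eval n (λ i → F i ℤ.+ G i) y ≈ eval n F y ⊕ eval n G y
  eval-+ n F G y = trans (∑-cong n λ i _ → trans (*-congʳ (ι-+ (F i) (G i))) (distribʳ (y ^ i) _ _)) (∑-+ n _ _)

  module RootOfUnity (n : ℕ) (y : Carrier) (y^n≈1 : y ^ n ≈ 1#) where

    eval-suc : ∀ {F} → Periodic n F → y ⊛ eval n (F ∘ suc) y ≈ eval n F y
    -- With `G 0` added on both sides, the sum of `suc n` terms can be split at its first or at its
    -- last term, and the last equals the first by periodicity.
    eval-suc {F} periodic = ∙-cancelˡ (G 0) _ _ (begin
      G 0 ⊕ y ⊛ eval n (F ∘ suc) y                       ≈⟨ +-congˡ (*-distribˡ-∑ n y _) ⟩
      G 0 ⊕ ∑ n (λ i → y ⊛ (ι (F (suc i)) ⊛ y ^ i))      ≈⟨ +-congˡ (∑-cong n λ i _ →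
        solve 3 (λ y f z → y :* (f :* z) := f :* (y :* z)) refl y (ι (F (suc i))) (y ^ i)) ⟩
      ∑ (suc n) G                                        ≈⟨ ∑-last n G ⟩
      ∑ n G ⊕ G n                                        ≈⟨ +-congˡ (*-cong (reflexive (cong ι (periodic 0))) y^n≈1) ⟩
      ∑ n G ⊕ G 0                                        ≈⟨ +-comm _ _ ⟩
      G 0 ⊕ eval n F y                                   ∎)
      where
      G : ℕ → Carrier
      G i = ι (F i) ⊛ y ^ i

    eval-shift : ∀ k {F} → Periodic n F → y ^ k ⊛ eval n (λ i → F (i + k)) y ≈ eval n F y
    eval-shift zero {F} periodic =
      trans (*-identityˡ _) (eval-cong n (λ i _ → cong F (ℕ.+-identityʳ i)) y)
    eval-shift (suc k) {F} periodic = begin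
      y ⊛ y ^ k ⊛ eval n (λ i → F (i + suc k)) y         ≈⟨ solve 3 (λ y z e → (y :* z) :* e := z :* (y :* e)) refl y (y ^ k) _ ⟩
      y ^ k ⊛ (y ⊛ eval n (λ i → F (i + suc k)) y)       ≈⟨ *-congˡ (*-congˡ (eval-cong n (λ i _ → cong F (ℕ.+-suc i k)) y)) ⟩
      y ^ k ⊛ (y ⊛ eval n (λ i → F (suc i + k)) y)       ≈⟨ *-congˡ (eval-suc {λ i → F (i + k)} λ i →
                                                             ≡.trans (cong F (swap i n k)) (periodic (i + k))) ⟩
      y ^ k ⊛ eval n (λ i → F (i + k)) y                 ≈⟨ eval-shift k periodic ⟩
      eval n F y                                         ∎
      where
      swap : ∀ i n k → i + n + k ≡ i + k + n
      swap = solve-∀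

    y^n*k≈1 : ∀ k → y ^ (n * k) ≈ 1#
    y^n*k≈1 zero    = reflexive (cong (y ^_) (ℕ.*-zeroʳ n))
    y^n*k≈1 (suc k) = begin
      y ^ (n * suc k)            ≡⟨ cong (y ^_) (ℕ.*-suc n k) ⟩
      y ^ (n + n * k)            ≈⟨ ^-homo-* y n (n * k) ⟩
      y ^ n ⊛ y ^ (n * k)        ≈⟨ *-cong y^n≈1 (y^n*k≈1 k) ⟩
      1# ⊛ 1#                    ≈⟨ *-identityˡ 1# ⟩
      1#                         ∎

    y^k-inverse : .⦃ _ : NonZero n ⦄ → ∀ k → y ^ (k * ℕ.pred n) ⊛ y ^ k ≈ 1#
    y^k-inverse k = begin
      y ^ (k * ℕ.pred n) ⊛ y ^ k           ≈⟨ ^-homo-* y (k * ℕ.pred n) k ⟨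
      y ^ (k * ℕ.pred n + k)               ≡⟨ cong (y ^_) (≡.trans (ℕ.+-comm (k * ℕ.pred n) k) (≡.trans (≡.sym (ℕ.*-suc k (ℕ.pred n))) (≡.trans (cong (k *_) (ℕ.suc-pred n)) (ℕ.*-comm k n)))) ⟩
      y ^ (n * k)                          ≈⟨ y^n*k≈1 k ⟩
      1#                                   ∎

  -- Writing exponents as i + j l, the coefficient depends on i alone and the sum over j splits off
  -- as the factor `geo k (y ^ l)`.
  eval-periodic : ∀ k l {F} y → Periodic l F → geo k (y ^ l) ≈ 0# → eval (k * l) F y ≈ 0#
  eval-periodic k l {F} y periodic geo≈0 = begin
    eval (k * l) F y
      ≈⟨ ∑-blocks k l _ ⟩
    ∑ k (λ j → ∑ l (λ i → ι (F (i + j * l)) ⊛ y ^ (i + j * l)))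
      ≈⟨ ∑-cong k (λ j _ → ∑-cong l λ i _ → *-cong (reflexive (cong ι (periods j i))) (begin
           y ^ (i + j * l)           ≈⟨ ^-homo-* y i (j * l) ⟩
           y ^ i ⊛ y ^ (j * l)       ≡⟨ cong (λ e → y ^ i ⊛ y ^ e) (ℕ.*-comm j l) ⟩
           y ^ i ⊛ y ^ (l * j)       ≈⟨ *-congˡ (^-assocʳ y l j) ⟨
           y ^ i ⊛ (y ^ l) ^ j       ∎)) ⟩
    ∑ k (λ j → ∑ l (λ i → ι (F i) ⊛ (y ^ i ⊛ (y ^ l) ^ j)))
      ≈⟨ ∑-cong k (λ j _ → trans (∑-cong l λ i _ → solve 3 (λ f z w → f :* (z :* w) := w :* (f :* z)) refl (ι (F i)) (y ^ i) ((y ^ l) ^ j))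
                                  (trans (sym (*-distribˡ-∑ l ((y ^ l) ^ j) _)) (*-comm _ _))) ⟩
    ∑ k (λ j → eval l F y ⊛ (y ^ l) ^ j)
      ≈⟨ *-distribˡ-∑ k (eval l F y) _ ⟨
    eval l F y ⊛ geo k (y ^ l)
      ≈⟨ trans (*-congˡ geo≈0) (zeroʳ _) ⟩
    0# ∎
    where
    periods : ∀ j i → F (i + j * l) ≡ F i
    periods zero    i = cong F (ℕ.+-identityʳ i)
    periods (suc j) i = ≡.trans (cong F (swap i l (j * l))) (≡.trans (periodic (i + j * l)) (periods j i))
      where
      swap : ∀ i l x → i + (l + x) ≡ i + x + l
      swap = solve-∀

  eval-[∣] : ∀ n c y → eval (suc n) (λ i → + (c * [ suc n ∣? i ])) y ≈ ι (+ c)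
  eval-[∣] n c y = begin
    ι (+ (c * [ suc n ∣? 0 ])) ⊛ 1# ⊕ ∑ n (λ i → ι (+ (c * [ suc n ∣? suc i ])) ⊛ y ^ suc i)
      ≈⟨ +-cong (*-identityʳ _) (∑-cong n λ i i<n → trans
           (*-congʳ (trans (reflexive (cong (ι ∘ +_) (≡.trans (cong (c *_) ([false] (suc n ∣? suc i) (>⇒∤ (s<s i<n)))) (ℕ.*-zeroʳ c)))) ι-0))
           (zeroˡ _)) ⟩
    ι (+ (c * [ suc n ∣? 0 ])) ⊕ ∑ n (λ _ → 0#)
      ≈⟨ +-cong (reflexive (cong (ι ∘ +_) (≡.trans (cong (c *_) ([true] (suc n ∣? 0) (suc n ∣0))) (ℕ.*-identityʳ c)))) (∑-0 n) ⟩
    ι (+ c) ⊕ 0#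
      ≈⟨ +-identityʳ _ ⟩
    ι (+ c) ∎

  module PrimitiveRoot (p q : ℕ) .⦃ p≢0 : NonZero p ⦄ .⦃ q≢0 : NonZero q ⦄
    (y : Carrier) (geo-p≈0 : geo p (y ^ q) ≈ 0#) (geo-q≈0 : geo q (y ^ p) ≈ 0#) where

    y^pq≈1 : y ^ (p * q) ≈ 1#
    y^pq≈1 = begin
      y ^ (p * q)                                 ≈⟨ ^-assocʳ y p q ⟨
      (y ^ p) ^ q                                 ≈⟨ x≈y+z⇒x-z≈y (+-comm _ _) ⟨
      (1# ⊕ (y ^ p) ^ q) - 1#                     ≈⟨ +-assoc _ _ _ ⟩
      1# ⊕ ((y ^ p) ^ q - 1#)                     ≈⟨ +-congˡ (geo-telescope q (y ^ p)) ⟨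
      1# ⊕ (y ^ p - 1#) ⊛ geo q (y ^ p)           ≈⟨ +-congˡ (trans (*-congˡ geo-q≈0) (zeroʳ _)) ⟩
      1# ⊕ 0#                                     ≈⟨ +-identityʳ 1# ⟩
      1#                                          ∎

    open RootOfUnity (p * q) y y^pq≈1 public

    eval-p-periodic : ∀ {F} → Periodic p F → eval (p * q) F y ≈ 0#
    eval-p-periodic {F} periodic = trans (reflexive (cong (λ n → eval n F y) (ℕ.*-comm p q)))
      (eval-periodic q p y periodic geo-q≈0)

    eval-q-periodic : ∀ {F} → Periodic q F → eval (p * q) F y ≈ 0#
    eval-q-periodic periodic = eval-periodic p q y periodic geo-p≈0

    eval-modulo-periodic : ∀ {F G f g} → (∀ n → F n ≡ G n ℤ.+ (f n ℤ.+ g n)) → Periodic p f → Periodic q g →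
      eval (p * q) F y ≈ eval (p * q) G y
    eval-modulo-periodic {F} {G} {f} {g} e f-periodic g-periodic = begin
      eval N F y                                       ≈⟨ eval-cong N (λ n _ → e n) y ⟩
      eval N (λ n → G n ℤ.+ (f n ℤ.+ g n)) y           ≈⟨ eval-+ N G (λ n → f n ℤ.+ g n) y ⟩
      eval N G y ⊕ eval N (λ n → f n ℤ.+ g n) y        ≈⟨ +-congˡ (trans (eval-+ N f g y)
                                                            (trans (+-cong (eval-p-periodic f-periodic) (eval-q-periodic g-periodic)) (+-identityʳ 0#))) ⟩
      eval N G y ⊕ 0#                                  ≈⟨ +-identityʳ _ ⟩
      eval N G y                                       ∎
      where
      N = p * q

    -- Multiplication by y^κ undoes the shift by κ. After it the shifted kernel is the kernel again,
    -- and the bracket is concentrated at exponent 0, where it gives c.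
    eval-kernel : ∀ {κ c d} (K : Kernel p q κ c d) (let open Kernel K) →
      y ^ κ ⊛ eval (p * q) kernel y ≈ eval (p * q) kernel y ⊕ ι (+ c)
    eval-kernel {κ} {c} K = begin
      y ^ κ ⊛ eval N kernel y
        ≈⟨ *-congˡ (eval-modulo-periodic (λ n → ≡.trans (difference n) (≡.sym (ℤ.+-assoc (kernel (n + κ)) _ _))) p-part-periodic q-part-periodic) ⟩
      y ^ κ ⊛ eval N (λ n → kernel (n + κ) ℤ.+ + (c * [ N ∣? n + κ ])) y
        ≈⟨ trans (*-congˡ (eval-+ N _ _ y)) (distribˡ _ _ _) ⟩
      y ^ κ ⊛ eval N (λ n → kernel (n + κ)) y ⊕ y ^ κ ⊛ eval N (λ n → + (c * [ N ∣? n + κ ])) y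
        ≈⟨ +-cong (eval-shift κ kernel-periodic) (eval-shift κ {λ n → + (c * [ N ∣? n ])} λ n → cong (λ i → + (c * i))
             ([∣?]-cong (λ d∣ → ∣m+n∣m⇒∣n (subst (N ∣_) (ℕ.+-comm n N) d∣) ∣-refl) (λ d∣n → ∣m∣n⇒∣m+n d∣n ∣-refl))) ⟩
      eval N kernel y ⊕ eval N (λ n → + (c * [ N ∣? n ])) y
        ≈⟨ +-congˡ (subst (λ N → eval N (λ n → + (c * [ N ∣? n ])) y ≈ ι (+ c)) (ℕ.suc-pred N ⦃ ℕ.m*n≢0 p q ⦄) (eval-[∣] (ℕ.pred N) c y)) ⟩
      eval N kernel y ⊕ ι (+ c) ∎
      where
      open Kernel K
      N = p * q

    eval-reduction : ∀ {d V} (r : Reduction p q d V) (let open Reduction r) →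
      eval (p * q) V y ≈
      y ^ (ℕ.pred p + q) ⊛ eval (ℕ.pred p * ℕ.pred q) (λ n → remainder (n + (ℕ.pred p + q))) y
    eval-reduction {V = V} r = begin
      eval (p * q) V y
        ≈⟨ eval-modulo-periodic decomposition p-part-periodic q-part-periodic ⟩
      eval (p * q) remainder y
        ≡⟨ cong (λ n → eval n remainder y) (pq≡ p q) ⟩
      eval (W + N′) remainder y
        ≈⟨ ∑-split W N′ _ ⟩
      eval W remainder y ⊕ ∑ N′ (λ n → ι (remainder (W + n)) ⊛ y ^ (W + n))
        ≈⟨ +-cong (trans (∑-cong W λ n n<W → trans (*-congʳ (trans (reflexive (cong ι (remainder≡0 n n<W))) ι-0)) (zeroˡ _)) (∑-0 W))
             (∑-cong N′ λ n _ → trans (*-cong (reflexive (cong (ι ∘ remainder) (ℕ.+-comm W n))) (^-homo-* y W n))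
               (solve 3 (λ f w z → f :* (w :* z) := w :* (f :* z)) refl (ι (remainder (n + W))) (y ^ W) (y ^ n))) ⟩
      0# ⊕ ∑ N′ (λ n → y ^ W ⊛ (ι (remainder (n + W)) ⊛ y ^ n))
        ≈⟨ trans (+-identityˡ _) (sym (*-distribˡ-∑ N′ (y ^ W) _)) ⟩
      y ^ W ⊛ eval N′ (λ n → remainder (n + W)) y ∎
      where
      open Reduction r
      W = ℕ.pred p + q
      N′ = ℕ.pred p * ℕ.pred q
      pq≡ : ∀ p q .⦃ _ : NonZero p ⦄ .⦃ _ : NonZero q ⦄ → p * q ≡ ℕ.pred p + q + ℕ.pred p * ℕ.pred q
      pq≡ (suc p) (suc q) = expand p q
        where
        expand : ∀ p q → suc p * suc q ≡ p + suc q + p * q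
        expand = solve-∀

    module Inverse {κ c d} (K : Kernel p q κ c d) (m N k i j : ℕ) .⦃ m≢0 : NonZero m ⦄
      (ζ : Carrier) (y≈ζ^m : y ≈ ζ ^ m)
      (kN≡mκ : k * N ≡ m * κ) (j+k≡i : j + k ≡ i) (j≤ : j ≤ m * (p * q)) where
      open Kernel K

      private instance
        pq≢0 : NonZero (p * q)
        pq≢0 = ℕ.m*n≢0 p q

      -- The inverse is, up to a unit, Σ_{l < N} ζ^{k l} Σ_n kernel(n) yⁿ.  The exponents k l
      -- are distinct mod m, so after reducing each summand separately the supports are
      -- disjoint and the bounds do not add up.  The offset cancels ζ^j and the factor
      -- y^shift split off by the reductions.
      shift offset : ℕ
      shift = ℕ.pred p + q
      offset = m * shift + (m * (p * q) ∸ j)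

      exponent : ℕ → ℕ
      exponent l = k * l + offset

      -- With e and r the quotient and remainder of `exponent l` by m, ζ^(exponent l) is ζ^r y^e,
      -- and y^e turns kernel(n) into kernel(n - e). The factor `pred (p * q)` is -1 mod pq. The
      -- shift varies with l, which is why a `Kernel` supplies reductions for all shifts.
      coefficient : ℕ → ℕ → ℤ
      coefficient l n = Reduction.remainder (reductions (exponent l / m * ℕ.pred (p * q))) (n + shift)

      u : ℕ → ℤ
      u e = ∑ℤ N (λ l → if does (exponent l % m ≟ e % m) then coefficient l (e / m) else 0ℤ)

      private
        E G ω : Carrier
        E = eval (p * q) kernel y
        ω = ζ ^ k
        G = geo N ω

        φpq : ℕ
        φpq = ℕ.pred p * ℕ.pred q

      ζ^mn≈y^n : ∀ n → ζ ^ (m * n) ≈ y ^ n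
      ζ^mn≈y^n n = trans (sym (^-assocʳ ζ m n)) (^-congˡ n (sym y≈ζ^m))

      if-* : ∀ b x z → ι (if b then x else 0ℤ) ⊛ z ≈ (if b then ι x ⊛ z else 0#)
      if-* true  x z = refl
      if-* false x z = trans (*-congʳ ι-0) (zeroˡ z)

      -- Exponents are split as r + n m with r < m; for each l, `∑-pick` keeps the one r that equals
      -- `exponent l % m`.
      eval-u : eval (φpq * m) u ζ ≈ ∑ N (λ l → ζ ^ (exponent l % m) ⊛ eval φpq (coefficient l) y)
      eval-u = begin
        eval (φpq * m) u ζ
          ≈⟨ ∑-blocks φpq m _ ⟩
        ∑ φpq (λ n → ∑ m (λ r → ι (u (r + n * m)) ⊛ ζ ^ (r + n * m)))
          ≈⟨ ∑-cong φpq (λ n _ → begin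
            ∑ m (λ r → ι (u (r + n * m)) ⊛ ζ ^ (r + n * m))
              ≈⟨ ∑-cong m (λ r r<m → term n r r<m) ⟩
            ∑ m (λ r → ∑ N (λ l → if does (exponent l % m ≟ r) then ι (coefficient l n) ⊛ (ζ ^ r ⊛ y ^ n) else 0#))
              ≈⟨ ∑-comm m N _ ⟩
            ∑ N (λ l → ∑ m (λ r → if does (exponent l % m ≟ r) then ι (coefficient l n) ⊛ (ζ ^ r ⊛ y ^ n) else 0#))
              ≈⟨ ∑-cong N (λ l _ → ∑-pick m (m%n<n (exponent l) m) (λ r → ι (coefficient l n) ⊛ (ζ ^ r ⊛ y ^ n))) ⟩
            ∑ N (λ l → ι (coefficient l n) ⊛ (ζ ^ (exponent l % m) ⊛ y ^ n)) ∎) ⟩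
        ∑ φpq (λ n → ∑ N (λ l → ι (coefficient l n) ⊛ (ζ ^ (exponent l % m) ⊛ y ^ n)))
          ≈⟨ ∑-comm φpq N _ ⟩
        ∑ N (λ l → ∑ φpq (λ n → ι (coefficient l n) ⊛ (ζ ^ (exponent l % m) ⊛ y ^ n)))
          ≈⟨ ∑-cong N (λ l _ → trans (∑-cong φpq λ n _ →
               solve 3 (λ a b c → a :* (b :* c) := b :* (a :* c)) refl (ι (coefficient l n)) (ζ ^ (exponent l % m)) (y ^ n))
               (sym (*-distribˡ-∑ φpq (ζ ^ (exponent l % m)) _))) ⟩
        ∑ N (λ l → ζ ^ (exponent l % m) ⊛ eval φpq (coefficient l) y) ∎
        where
        term : ∀ n r → r < m → ι (u (r + n * m)) ⊛ ζ ^ (r + n * m) ≈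
          ∑ N (λ l → if does (exponent l % m ≟ r) then ι (coefficient l n) ⊛ (ζ ^ r ⊛ y ^ n) else 0#)
        term n r r<m = begin
          ι (u (r + n * m)) ⊛ ζ ^ (r + n * m)
            ≈⟨ *-cong (reflexive (cong₂ (λ r n → ι (∑ℤ N (λ l → if does (exponent l % m ≟ r) then coefficient l n else 0ℤ))) remainder≡ quotient≡))
                      (trans (^-homo-* ζ r (n * m)) (*-congˡ (trans (reflexive (cong (ζ ^_) (ℕ.*-comm n m))) (ζ^mn≈y^n n)))) ⟩
          ι (∑ℤ N (λ l → if does (exponent l % m ≟ r) then coefficient l n else 0ℤ)) ⊛ (ζ ^ r ⊛ y ^ n)
            ≈⟨ trans (*-congʳ (ι-∑ N _)) (trans (*-comm _ _) (*-distribˡ-∑ N (ζ ^ r ⊛ y ^ n) _)) ⟩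
          ∑ N (λ l → (ζ ^ r ⊛ y ^ n) ⊛ ι (if does (exponent l % m ≟ r) then coefficient l n else 0ℤ))
            ≈⟨ ∑-cong N (λ l _ → trans (*-comm _ _) (if-* (does (exponent l % m ≟ r)) (coefficient l n) _)) ⟩
          ∑ N (λ l → if does (exponent l % m ≟ r) then ι (coefficient l n) ⊛ (ζ ^ r ⊛ y ^ n) else 0#) ∎
          where
          remainder≡ : (r + n * m) % m ≡ r
          remainder≡ = ≡.trans ([m+kn]%n≡m%n r n m) (m<n⇒m%n≡m r<m)
          quotient≡ : (r + n * m) / m ≡ n
          quotient≡ = ≡.trans (+-distrib-/-∣ʳ r (n∣m*n n)) (cong₂ _+_ (m<n⇒m/n≡0 r<m) (m*n/n≡m n m))

      eval-kernel-shift : ∀ e → eval (p * q) (λ n → kernel (n + e * ℕ.pred (p * q))) y ≈ y ^ e ⊛ E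
      eval-kernel-shift e = begin
        E′                                             ≈⟨ *-identityˡ E′ ⟨
        1# ⊛ E′                                        ≈⟨ *-congʳ (trans (*-comm _ _) (y^k-inverse e)) ⟨
        (y ^ e ⊛ y ^ (e * ℕ.pred (p * q))) ⊛ E′        ≈⟨ *-assoc _ _ _ ⟩
        y ^ e ⊛ (y ^ (e * ℕ.pred (p * q)) ⊛ E′)        ≈⟨ *-congˡ (eval-shift (e * ℕ.pred (p * q)) kernel-periodic) ⟩
        y ^ e ⊛ E                                      ∎
        where
        E′ = eval (p * q) (λ n → kernel (n + e * ℕ.pred (p * q))) y

      y^shift*u : y ^ shift ⊛ eval (φpq * m) u ζ ≈ ζ ^ offset ⊛ (G ⊛ E)
      y^shift*u = begin
        y ^ shift ⊛ eval (φpq * m) u ζ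
          ≈⟨ trans (*-congˡ eval-u) (*-distribˡ-∑ N (y ^ shift) _) ⟩
        ∑ N (λ l → y ^ shift ⊛ (ζ ^ (exponent l % m) ⊛ eval φpq (coefficient l) y))
          ≈⟨ ∑-cong N (λ l _ → term l) ⟩
        ∑ N (λ l → (ζ ^ offset ⊛ E) ⊛ ω ^ l)
          ≈⟨ *-distribˡ-∑ N (ζ ^ offset ⊛ E) _ ⟨
        (ζ ^ offset ⊛ E) ⊛ G
          ≈⟨ trans (*-assoc _ _ _) (*-congˡ (*-comm E G)) ⟩
        ζ ^ offset ⊛ (G ⊛ E) ∎
        where
        term : ∀ l → y ^ shift ⊛ (ζ ^ (exponent l % m) ⊛ eval φpq (coefficient l) y) ≈ (ζ ^ offset ⊛ E) ⊛ ω ^ l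
        term l = begin
          y ^ shift ⊛ (ζ ^ r ⊛ eval φpq (coefficient l) y)
            ≈⟨ solve 3 (λ a b c → a :* (b :* c) := b :* (a :* c)) refl (y ^ shift) (ζ ^ r) _ ⟩
          ζ ^ r ⊛ (y ^ shift ⊛ eval φpq (coefficient l) y)
            ≈⟨ *-congˡ (eval-reduction (reductions (e * ℕ.pred (p * q)))) ⟨
          ζ ^ r ⊛ eval (p * q) (λ n → kernel (n + e * ℕ.pred (p * q))) y
            ≈⟨ *-congˡ (eval-kernel-shift e) ⟩
          ζ ^ r ⊛ (y ^ e ⊛ E)
            ≈⟨ trans (sym (*-assoc _ _ _)) (*-congʳ ζ^r*y^e) ⟩
          (ω ^ l ⊛ ζ ^ offset) ⊛ E
            ≈⟨ solve 3 (λ a b c → (a :* b) :* c := (b :* c) :* a) refl (ω ^ l) (ζ ^ offset) E ⟩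
          (ζ ^ offset ⊛ E) ⊛ ω ^ l ∎
          where
          r = exponent l % m
          e = exponent l / m
          ζ^r*y^e : ζ ^ r ⊛ y ^ e ≈ ω ^ l ⊛ ζ ^ offset
          ζ^r*y^e = begin
            ζ ^ r ⊛ y ^ e                 ≈⟨ *-congˡ (ζ^mn≈y^n e) ⟨
            ζ ^ r ⊛ ζ ^ (m * e)           ≈⟨ ^-homo-* ζ r (m * e) ⟨
            ζ ^ (r + m * e)               ≡⟨ cong (ζ ^_) (≡.trans (cong (_+_ (r)) (ℕ.*-comm m e)) (≡.sym (m≡m%n+[m/n]*n (exponent l) m))) ⟩
            ζ ^ (k * l + offset)           ≈⟨ ^-homo-* ζ (k * l) offset ⟩
            ζ ^ (k * l) ⊛ ζ ^ offset       ≈⟨ *-congʳ (^-assocʳ ζ k l) ⟨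
            ω ^ l ⊛ ζ ^ offset             ∎

      -- Telescoping: (ω - 1)(1 + ω + ... + ω^{N-1}) = y^κ - 1.
      ωGE≈ : ω ⊛ (G ⊛ E) ≈ G ⊛ E ⊕ ι (+ c)
      ωGE≈ = ∙-cancelˡ E _ _ (begin
        E ⊕ ω ⊛ (G ⊛ E)                  ≈⟨ solve 3 (λ e w g → e :+ w :* (g :* e) := (con 1 :+ w :* g) :* e) refl E ω G ⟩
        (1# ⊕ ω ⊛ G) ⊛ E                 ≈⟨ *-congʳ (trans (sym (geo-suc N ω)) (∑-last N (ω ^_))) ⟩
        (G ⊕ ω ^ N) ⊛ E                  ≈⟨ *-congʳ (+-congˡ (trans (^-assocʳ ζ k N) (trans (reflexive (cong (ζ ^_) kN≡mκ)) (ζ^mn≈y^n κ)))) ⟩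
        (G ⊕ y ^ κ) ⊛ E                  ≈⟨ distribʳ E G (y ^ κ) ⟩
        G ⊛ E ⊕ y ^ κ ⊛ E                ≈⟨ +-congˡ (eval-kernel K) ⟩
        G ⊛ E ⊕ (E ⊕ ι (+ c))            ≈⟨ solve 3 (λ a b c → a :+ (b :+ c) := b :+ (a :+ c)) refl (G ⊛ E) E (ι (+ c)) ⟩
        E ⊕ (G ⊛ E ⊕ ι (+ c))            ∎)

      private
        Uζ : Carrier
        Uζ = eval (φpq * m) u ζ

      -- The part `m * (p * q) ∸ j` of the offset is -j raised by a full period of ζ; `j≤` makes the
      -- truncated subtraction exact.
      ζ^j*ζ^offset : ζ ^ j ⊛ ζ ^ offset ≈ y ^ shift
      ζ^j*ζ^offset = begin
        ζ ^ j ⊛ ζ ^ offset                             ≈⟨ ^-homo-* ζ j offset ⟨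
        ζ ^ (j + offset)                               ≡⟨ cong (ζ ^_) (≡.trans (swap j (m * shift) _) (cong (_+_ (m * shift)) (ℕ.m+[n∸m]≡n j≤))) ⟩
        ζ ^ (m * shift + m * (p * q))                 ≈⟨ ^-homo-* ζ (m * shift) (m * (p * q)) ⟩
        ζ ^ (m * shift) ⊛ ζ ^ (m * (p * q))           ≈⟨ *-cong (ζ^mn≈y^n shift) (trans (ζ^mn≈y^n (p * q)) y^pq≈1) ⟩
        y ^ shift ⊛ 1#                                ≈⟨ *-identityʳ _ ⟩
        y ^ shift                                     ∎
        where
        swap : ∀ j a b → j + (a + b) ≡ a + (j + b)
        swap = solve-∀

      -- `y^shift*u` describes `Uζ` only after multiplication by y^shift, so the equation is proved
      -- in that form and the unit is cancelled. It is kept free of differences for the semiring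
      -- solver.
      ζ^i*u : ζ ^ i ⊛ Uζ ≈ ζ ^ j ⊛ Uζ ⊕ ι (+ c)
      ζ^i*u = begin
        ζ ^ i ⊛ Uζ                                      ≈⟨ cancel (ζ ^ i ⊛ Uζ) ⟨
        y⁻ ⊛ (y ^ shift ⊛ (ζ ^ i ⊛ Uζ))                 ≈⟨ *-congˡ scaled ⟩
        y⁻ ⊛ (y ^ shift ⊛ (ζ ^ j ⊛ Uζ ⊕ ι (+ c)))       ≈⟨ cancel _ ⟩
        ζ ^ j ⊛ Uζ ⊕ ι (+ c)                            ∎
        where
        y⁻ = y ^ (shift * ℕ.pred (p * q))

        cancel : ∀ z → y⁻ ⊛ (y ^ shift ⊛ z) ≈ z
        cancel z = trans (sym (*-assoc _ _ _)) (trans (*-congʳ (y^k-inverse shift)) (*-identityˡ z))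

        scaled : y ^ shift ⊛ (ζ ^ i ⊛ Uζ) ≈ y ^ shift ⊛ (ζ ^ j ⊛ Uζ ⊕ ι (+ c))
        scaled = begin
          y ^ shift ⊛ (ζ ^ i ⊛ Uζ)
            ≈⟨ *-congˡ (*-congʳ (trans (reflexive (cong (ζ ^_) (≡.sym j+k≡i))) (^-homo-* ζ j k))) ⟩
          y ^ shift ⊛ ((ζ ^ j ⊛ ω) ⊛ Uζ)
            ≈⟨ solve 4 (λ a b c d → a :* ((b :* c) :* d) := (b :* c) :* (a :* d)) refl (y ^ shift) (ζ ^ j) ω Uζ ⟩
          (ζ ^ j ⊛ ω) ⊛ (y ^ shift ⊛ Uζ)
            ≈⟨ *-congˡ y^shift*u ⟩
          (ζ ^ j ⊛ ω) ⊛ (ζ ^ offset ⊛ (G ⊛ E))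
            ≈⟨ solve 4 (λ a b c d → (a :* b) :* (c :* d) := (a :* c) :* (b :* d)) refl (ζ ^ j) ω (ζ ^ offset) (G ⊛ E) ⟩
          (ζ ^ j ⊛ ζ ^ offset) ⊛ (ω ⊛ (G ⊛ E))
            ≈⟨ *-congˡ ωGE≈ ⟩
          (ζ ^ j ⊛ ζ ^ offset) ⊛ (G ⊛ E ⊕ ι (+ c))
            ≈⟨ trans (distribˡ _ _ _) (+-congʳ (*-assoc _ _ _)) ⟩
          ζ ^ j ⊛ (ζ ^ offset ⊛ (G ⊛ E)) ⊕ (ζ ^ j ⊛ ζ ^ offset) ⊛ ι (+ c)
            ≈⟨ +-cong (*-congˡ (sym y^shift*u)) (*-congʳ ζ^j*ζ^offset) ⟩
          ζ ^ j ⊛ (y ^ shift ⊛ Uζ) ⊕ y ^ shift ⊛ ι (+ c)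
            ≈⟨ solve 4 (λ a b u c → a :* (b :* u) :+ b :* c := b :* (a :* u :+ c)) refl (ζ ^ j) (y ^ shift) Uζ (ι (+ c)) ⟩
          y ^ shift ⊛ (ζ ^ j ⊛ Uζ ⊕ ι (+ c)) ∎

      u-inverse : (ζ ^ i - ζ ^ j) ⊛ Uζ ≈ ι (+ c)
      u-inverse = trans ([y-z]x≈yx-zx Uζ (ζ ^ i) (ζ ^ j)) (x≈y+z⇒x-z≈y (trans ζ^i*u (+-comm _ _)))

      u-bounded : (∀ l l′ → l < N → l′ < N → exponent l % m ≡ exponent l′ % m → l ≡ l′) → ∀ e → ℤ.∣ u e ∣ ≤ d
      u-bounded distinct e = ℕ.≤-trans (∣∑∣≤∑∣∣ N _) (∑ℕ-at-most-one N
        (λ l _ → bounded (does (exponent l % m ≟ e % m)) (Reduction.remainder-bounded (reductions _) _))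
        (λ l l′ l<N l′<N ≢0 ≢0′ → distinct l l′ l<N l′<N (≡.trans (selected l ≢0) (≡.sym (selected l′ ≢0′)))))
        where
        bounded : ∀ b {x} → ℤ.∣ x ∣ ≤ d → ℤ.∣ if b then x else 0ℤ ∣ ≤ d
        bounded true  ∣x∣≤d = ∣x∣≤d
        bounded false _     = z≤n

        selected : ∀ l {x} → ¬ ℤ.∣ if does (exponent l % m ≟ e % m) then x else 0ℤ ∣ ≡ 0 → exponent l % m ≡ e % m
        selected l ≢0 = decidable-stable (exponent l % m ≟ e % m)
          λ ≢ → ≢0 (cong ℤ.∣_∣ (if-no (exponent l % m ≟ e % m) ≢))

open import Defs
open import Data.Fin using (Fin; toℕ)
open import Data.Fin.Properties using (toℕ<n)
open import Data.List using ([]; _∷_; map; length; filter; applyUpTo; foldr; tabulate)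
open import Data.List.Properties using (tabulate-cong; length-applyUpTo)
open import Data.List.Relation.Unary.All using (All; []; _∷_; all?)
open import Data.Vec as Vec using (Vec; []; _∷_)
open import Induction.WellFounded using (module FixPoint)
open import Relation.Binary.Definitions using (tri<; tri≈; tri>)
open import Relation.Unary using (Pred; Decidable)
open ≡ using (refl; sym; trans; module ≡-Reasoning)

-- The ring ℤ[x] and division by monic polynomials

module Polynomials where

  -- A record, so that the polynomials can be inferred from an equation.
  infix 4 _≋_
  record _≋_ (f g : Poly) : Set where
    constructor mk≋
    field coeff≡ : f ≈ g
  open _≋_ public

  infixr 7 _·_
  _·_ : ℤ → Poly → Poly
  a · f = map (a ℤ.*_) f

  coeff-+ : ∀ f g k → coeff (f +ᵖ g) k ≡ coeff f k ℤ.+ coeff g k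
  coeff-+ []      g       k       = sym (ℤ.+-identityˡ _)
  coeff-+ (a ∷ f) []      k       = sym (ℤ.+-identityʳ _)
  coeff-+ (a ∷ f) (b ∷ g) zero    = refl
  coeff-+ (a ∷ f) (b ∷ g) (suc k) = coeff-+ f g k

  coeff-· : ∀ a f k → coeff (a · f) k ≡ a ℤ.* coeff f k
  coeff-· a []      k       = sym (ℤ.*-zeroʳ a)
  coeff-· a (b ∷ f) zero    = refl
  coeff-· a (b ∷ f) (suc k) = coeff-· a f k

  coeff-neg : ∀ f k → coeff (-ᵖ f) k ≡ ℤ.- coeff f k
  coeff-neg []      k       = refl
  coeff-neg (b ∷ f) zero    = refl
  coeff-neg (b ∷ f) (suc k) = coeff-neg f k

  ≋-refl : ∀ {f} → f ≋ f
  ≋-refl = mk≋ λ _ → refl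

  ≋-sym : ∀ {f g} → f ≋ g → g ≋ f
  ≋-sym e = mk≋ λ k → sym (coeff≡ e k)

  ≋-trans : ∀ {f g h} → f ≋ g → g ≋ h → f ≋ h
  ≋-trans e e′ = mk≋ λ k → trans (coeff≡ e k) (coeff≡ e′ k)

  +-cong : ∀ {f f′ g g′} → f ≋ f′ → g ≋ g′ → f +ᵖ g ≋ f′ +ᵖ g′
  +-cong {f} {f′} {g} {g′} e e′ = mk≋ λ k →
    trans (coeff-+ f g k) (trans (cong₂ ℤ._+_ (coeff≡ e k) (coeff≡ e′ k)) (sym (coeff-+ f′ g′ k)))

  +-comm : ∀ f g → f +ᵖ g ≋ g +ᵖ f
  +-comm f g = mk≋ λ k →
    trans (coeff-+ f g k) (trans (ℤ.+-comm (coeff f k) _) (sym (coeff-+ g f k)))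

  +-assoc : ∀ f g h → (f +ᵖ g) +ᵖ h ≋ f +ᵖ (g +ᵖ h)
  +-assoc f g h = mk≋ λ k → begin
    coeff ((f +ᵖ g) +ᵖ h) k                    ≡⟨ coeff-+ (f +ᵖ g) h k ⟩
    coeff (f +ᵖ g) k ℤ.+ coeff h k             ≡⟨ cong (ℤ._+ _) (coeff-+ f g k) ⟩
    coeff f k ℤ.+ coeff g k ℤ.+ coeff h k      ≡⟨ ℤ.+-assoc (coeff f k) _ _ ⟩
    coeff f k ℤ.+ (coeff g k ℤ.+ coeff h k)    ≡⟨ cong (ℤ._+_ (coeff f k)) (coeff-+ g h k) ⟨
    coeff f k ℤ.+ coeff (g +ᵖ h) k             ≡⟨ coeff-+ f (g +ᵖ h) k ⟨
    coeff (f +ᵖ (g +ᵖ h)) k                    ∎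
    where open ≡-Reasoning

  +-identityʳ : ∀ f → f +ᵖ [] ≋ f
  +-identityʳ f = +-comm f []

  neg-cong : ∀ {f g} → f ≋ g → -ᵖ f ≋ -ᵖ g
  neg-cong {f} {g} e = mk≋ λ k →
    trans (coeff-neg f k) (trans (cong ℤ.-_ (coeff≡ e k)) (sym (coeff-neg g k)))

  +-inverseʳ : ∀ f → f +ᵖ (-ᵖ f) ≋ []
  +-inverseʳ f = mk≋ λ k →
    trans (coeff-+ f (-ᵖ f) k) (trans (cong (ℤ._+_ (coeff f k)) (coeff-neg f k)) (ℤ.+-inverseʳ (coeff f k)))

  ·-cong : ∀ a {f g} → f ≋ g → a · f ≋ a · g
  ·-cong a {f} {g} e = mk≋ λ k →
    trans (coeff-· a f k) (trans (cong (a ℤ.*_) (coeff≡ e k)) (sym (coeff-· a g k)))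

  ·-distribˡ : ∀ a f g → a · (f +ᵖ g) ≋ a · f +ᵖ a · g
  ·-distribˡ a f g = mk≋ λ k → begin
    coeff (a · (f +ᵖ g)) k                      ≡⟨ coeff-· a (f +ᵖ g) k ⟩
    a ℤ.* coeff (f +ᵖ g) k                      ≡⟨ cong (a ℤ.*_) (coeff-+ f g k) ⟩
    a ℤ.* (coeff f k ℤ.+ coeff g k)             ≡⟨ ℤ.*-distribˡ-+ a (coeff f k) _ ⟩
    a ℤ.* coeff f k ℤ.+ a ℤ.* coeff g k         ≡⟨ cong₂ ℤ._+_ (coeff-· a f k) (coeff-· a g k) ⟨
    coeff (a · f) k ℤ.+ coeff (a · g) k         ≡⟨ coeff-+ (a · f) (a · g) k ⟨
    coeff (a · f +ᵖ a · g) k                    ∎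
    where open ≡-Reasoning

  ·-distribʳ : ∀ a b f → (a ℤ.+ b) · f ≋ a · f +ᵖ b · f
  ·-distribʳ a b f = mk≋ λ k → begin
    coeff ((a ℤ.+ b) · f) k                     ≡⟨ coeff-· (a ℤ.+ b) f k ⟩
    (a ℤ.+ b) ℤ.* coeff f k                     ≡⟨ ℤ.*-distribʳ-+ (coeff f k) a b ⟩
    a ℤ.* coeff f k ℤ.+ b ℤ.* coeff f k         ≡⟨ cong₂ ℤ._+_ (coeff-· a f k) (coeff-· b f k) ⟨
    coeff (a · f) k ℤ.+ coeff (b · f) k         ≡⟨ coeff-+ (a · f) (b · f) k ⟨
    coeff (a · f +ᵖ b · f) k                    ∎
    where open ≡-Reasoning

  ·-assoc : ∀ a b f → (a ℤ.* b) · f ≋ a · (b · f)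
  ·-assoc a b f = mk≋ λ k →
    trans (coeff-· (a ℤ.* b) f k) (trans (ℤ.*-assoc a b _)
      (sym (trans (coeff-· a (b · f) k) (cong (a ℤ.*_) (coeff-· b f k)))))

  0· : ∀ f → 0ℤ · f ≋ []
  0· f = mk≋ λ k → coeff-· 0ℤ f k

  1· : ∀ f → 1ℤ · f ≋ f
  1· f = mk≋ λ k → trans (coeff-· 1ℤ f k) (ℤ.*-identityˡ _)

  ∷-cong : ∀ {a b f g} → a ≡ b → f ≋ g → a ∷ f ≋ b ∷ g
  ∷-cong a≡b e = mk≋ λ { zero → a≡b ; (suc k) → coeff≡ e k }

  0∷[] : 0ℤ ∷ [] ≋ []
  0∷[] = mk≋ λ { zero → refl ; (suc k) → refl }

  ·-0∷ : ∀ a f → a · (0ℤ ∷ f) ≋ 0ℤ ∷ a · f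
  ·-0∷ a f = ∷-cong (ℤ.*-zeroʳ a) ≋-refl

  +-interchange : ∀ f g h k → (f +ᵖ g) +ᵖ (h +ᵖ k) ≋ (f +ᵖ h) +ᵖ (g +ᵖ k)
  +-interchange f g h k =
    ≋-trans (+-assoc f g (h +ᵖ k)) (≋-trans (+-cong {f = f} ≋-refl
      (≋-trans (≋-sym (+-assoc g h k)) (≋-trans (+-cong (+-comm g h) ≋-refl) (+-assoc h g k))))
      (≋-sym (+-assoc f h (g +ᵖ k))))

  *-distribʳ : ∀ h f g → (f +ᵖ g) *ᵖ h ≋ f *ᵖ h +ᵖ g *ᵖ h
  *-distribʳ h []      g       = ≋-refl
  *-distribʳ h (a ∷ f) []      = ≋-sym (+-identityʳ _)
  *-distribʳ h (a ∷ f) (b ∷ g) =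
    ≋-trans (+-cong (·-distribʳ a b h) (∷-cong refl (*-distribʳ h f g)))
      (+-interchange (a · h) (b · h) (0ℤ ∷ f *ᵖ h) (0ℤ ∷ g *ᵖ h))

  *-congˡ : ∀ f {g h} → g ≋ h → f *ᵖ g ≋ f *ᵖ h
  *-congˡ []      e = ≋-refl
  *-congˡ (a ∷ f) e = +-cong (·-cong a e) (∷-cong refl (*-congˡ f e))

  *-zeroʳ : ∀ f → f *ᵖ [] ≋ []
  *-zeroʳ []      = ≋-refl
  *-zeroʳ (a ∷ f) = ≋-trans (∷-cong refl (*-zeroʳ f)) 0∷[]

  -- The defining recursion of `_*ᵖ_` transferred to its second argument, from which commutativity
  -- follows by induction.
  *-∷ : ∀ f b g → f *ᵖ (b ∷ g) ≋ b · f +ᵖ (0ℤ ∷ f *ᵖ g)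
  *-∷ []      b g = ≋-sym 0∷[]
  *-∷ (a ∷ f) b g = ∷-cong
    (trans (ℤ.+-identityʳ _) (trans (ℤ.*-comm a b) (sym (ℤ.+-identityʳ _))))
    (≋-trans (+-cong ≋-refl (*-∷ f b g))
      (≋-trans (≋-sym (+-assoc (a · g) (b · f) (0ℤ ∷ f *ᵖ g)))
      (≋-trans (+-cong (+-comm (a · g) (b · f)) ≋-refl) (+-assoc (b · f) (a · g) (0ℤ ∷ f *ᵖ g)))))

  *-comm : ∀ f g → f *ᵖ g ≋ g *ᵖ f
  *-comm []      g = ≋-sym (*-zeroʳ g)
  *-comm (a ∷ f) g = ≋-trans (+-cong ≋-refl (∷-cong refl (*-comm f g))) (≋-sym (*-∷ g a f))

  *-cong : ∀ {f f′ g g′} → f ≋ f′ → g ≋ g′ → f *ᵖ g ≋ f′ *ᵖ g′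
  *-cong {f} {f′} {g} {g′} e e′ =
    ≋-trans (*-congˡ f e′) (≋-trans (*-comm f g′) (≋-trans (*-congˡ g′ e) (*-comm g′ f′)))

  ·-*-assoc : ∀ a f g → (a · f) *ᵖ g ≋ a · (f *ᵖ g)
  ·-*-assoc a []      g = ≋-refl
  ·-*-assoc a (b ∷ f) g =
    ≋-trans (+-cong (·-assoc a b g) (≋-trans (∷-cong refl (·-*-assoc a f g)) (≋-sym (·-0∷ a (f *ᵖ g)))))
      (≋-sym (·-distribˡ a (b · g) (0ℤ ∷ f *ᵖ g)))

  0∷-* : ∀ f g → (0ℤ ∷ f) *ᵖ g ≋ 0ℤ ∷ (f *ᵖ g)
  0∷-* f g = +-cong (0· g) ≋-refl

  *-assoc : ∀ f g h → (f *ᵖ g) *ᵖ h ≋ f *ᵖ (g *ᵖ h)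
  *-assoc []      g h = ≋-refl
  *-assoc (a ∷ f) g h =
    ≋-trans (*-distribʳ h (a · g) (0ℤ ∷ f *ᵖ g))
      (+-cong (·-*-assoc a g h) (≋-trans (0∷-* (f *ᵖ g) h) (∷-cong refl (*-assoc f g h))))

  *-identityˡ : ∀ f → const 1ℤ *ᵖ f ≋ f
  *-identityˡ f = ≋-trans (+-cong (1· f) 0∷[]) (+-identityʳ f)

  polyRing : CommutativeRing 0ℓ 0ℓ
  polyRing = record
    { Carrier = Poly ; _≈_ = _≋_ ; _+_ = _+ᵖ_ ; _*_ = _*ᵖ_ ; -_ = -ᵖ_ ; 0# = [] ; 1# = const 1ℤ
    ; isCommutativeRing = record
      { *-comm = *-comm
      ; isRing = record
        { +-isAbelianGroup = record
          { comm = +-comm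
          ; isGroup = record
            { isMonoid = record
              { identity = (λ _ → ≋-refl) , +-identityʳ
              ; isSemigroup = record
                { assoc = +-assoc
                ; isMagma = record
                  { isEquivalence = record { refl = ≋-refl ; sym = ≋-sym ; trans = ≋-trans }
                  ; ∙-cong = +-cong } } }
            ; inverse = (λ f → ≋-trans (+-comm (-ᵖ f) f) (+-inverseʳ f)) , +-inverseʳ
            ; ⁻¹-cong = neg-cong } }
        ; *-cong = *-cong
        ; *-assoc = *-assoc
        ; *-identity = *-identityˡ , λ f → ≋-trans (*-comm f _) (*-identityˡ f)
        ; distrib = (λ f g h → ≋-trans (*-comm f (g +ᵖ h)) (≋-trans (*-distribʳ f g h)
                       (+-cong (*-comm g f) (*-comm h f))))
                  , *-distribʳ
        } } }

  infix 4 _<deg_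
  _<deg_ : Poly → ℕ → Set
  f <deg n = ∀ k → n ≤ k → coeff f k ≡ 0ℤ

  length-<deg : ∀ f → f <deg length f
  length-<deg []      k       _         = refl
  length-<deg (a ∷ f) (suc k) (s≤s le) = length-<deg f k le

  record Monic (n : ℕ) (g : Poly) : Set where
    field
      leading : coeff g n ≡ 1ℤ
      above   : g <deg suc n
  open Monic public

  monic-cong : ∀ {n f g} → f ≋ g → Monic n f → Monic n g
  monic-cong e m .leading     = trans (sym (coeff≡ e _)) (m .leading)
  monic-cong e m .above k n<k = trans (sym (coeff≡ e k)) (m .above k n<k)

  monic-+ : ∀ {n f g} → f <deg n → Monic n g → Monic n (f +ᵖ g)
  monic-+ {n} {f} {g} lt m .leading =
    trans (coeff-+ f g n) (cong₂ ℤ._+_ (lt n ℕ.≤-refl) (m .leading))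
  monic-+ {n} {f} {g} lt m .above k n<k =
    trans (coeff-+ f g k) (cong₂ ℤ._+_ (lt k (ℕ.<⇒≤ n<k)) (m .above k n<k))

  monic-X^ : ∀ n → Monic n (X^ n)
  monic-X^ zero    .leading          = refl
  monic-X^ (suc n) .leading          = monic-X^ n .leading
  monic-X^ zero    .above (suc k) _  = refl
  monic-X^ (suc n) .above (suc k) (s≤s n<k) = monic-X^ n .above k n<k

  monic-∷ : ∀ {n a f} → Monic n f → Monic (suc n) (a ∷ f)
  monic-∷ m .leading                 = m .leading
  monic-∷ m .above (suc k) (s≤s n<k) = m .above k n<k

  monic-tail : ∀ {n a f} → Monic (suc n) (a ∷ f) → Monic n f
  monic-tail m .leading     = m .leading
  monic-tail m .above k n<k = m .above (suc k) (s≤s n<k)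

  monic-0-tail : ∀ {a f} → Monic 0 (a ∷ f) → f ≋ []
  monic-0-tail m = mk≋ λ k → m .above (suc k) (s≤s z≤n)

  monic-* : ∀ {m n f g} → Monic m f → Monic n g → Monic (m + n) (f *ᵖ g)
  monic-* {f = []}     mf mg with () ← mf .leading
  monic-* {zero} {n} {a ∷ f} {g} mf mg = monic-cong (≋-sym e) mg
    where
    e : (a ∷ f) *ᵖ g ≋ g
    e = ≋-trans (*-cong (∷-cong (mf .leading) (monic-0-tail mf)) ≋-refl) (*-identityˡ g)
  monic-* {suc m} {n} {a ∷ f} {g} mf mg =
    monic-+ {f = a · g} (λ k le → trans (coeff-· a g k)
        (trans (cong (a ℤ.*_) (mg .above k (ℕ.≤-trans (s≤s (ℕ.m≤n+m n m)) le))) (ℤ.*-zeroʳ a)))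
      (monic-∷ {a = 0ℤ} (monic-* (monic-tail mf) mg))

  coeff-all-zero : ∀ {f} → All (_≡ 0ℤ) f → ∀ k → coeff f k ≡ 0ℤ
  coeff-all-zero []       k       = refl
  coeff-all-zero (e ∷ es) zero    = e
  coeff-all-zero (e ∷ es) (suc k) = coeff-all-zero es k

  monic-degree : ∀ {n g} → Monic n g → degree g ≡ n
  monic-degree {g = []}             m with () ← m .leading
  monic-degree {zero}  {g = a ∷ f} m with all? (ℤ._≟ 0ℤ) f
  ... | yes _  = refl
  ... | no ¬0 = contradiction (zeros f (monic-0-tail m)) ¬0
    where
    zeros : ∀ f → f ≋ [] → All (_≡ 0ℤ) f
    zeros []      e = []
    zeros (a ∷ f) e = coeff≡ e 0 ∷ zeros f (mk≋ λ k → coeff≡ e (suc k))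
  monic-degree {suc n} {g = a ∷ f} m with all? (ℤ._≟ 0ℤ) f
  ... | no _   = cong suc (monic-degree (monic-tail m))
  ... | yes 0s with () ← trans (sym (coeff-all-zero 0s n)) (m .leading)

  -- Source of both cancellation and uniqueness of quotients. Coefficients of the product beyond
  -- index n come from the tail `f` alone, so the tail vanishes by induction; then coefficient n is
  -- `a`.
  <deg-monic-multiple : ∀ {n g} → Monic n g → ∀ f → f *ᵖ g <deg n → f ≋ []
  <deg-monic-multiple {n} {g} m []      lt = ≋-refl
  <deg-monic-multiple {n} {g} m (a ∷ f) lt = mk≋ λ { zero → a≡0 ; (suc k) → coeff≡ f≋0 k }
    where
    open ≡-Reasoning

    f≋0 : f ≋ []
    f≋0 = <deg-monic-multiple m f λ k n≤k → begin
      coeff (f *ᵖ g) k                                       ≡⟨ ℤ.+-identityˡ _ ⟨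
      0ℤ ℤ.+ coeff (f *ᵖ g) k                                ≡⟨ cong (ℤ._+ _) (ℤ.*-zeroʳ a) ⟨
      a ℤ.* 0ℤ ℤ.+ coeff (f *ᵖ g) k                          ≡⟨ cong (λ c → a ℤ.* c ℤ.+ coeff (f *ᵖ g) k) (m .above (suc k) (s≤s n≤k)) ⟨
      a ℤ.* coeff g (suc k) ℤ.+ coeff (f *ᵖ g) k             ≡⟨ cong (ℤ._+ _) (coeff-· a g (suc k)) ⟨
      coeff (a · g) (suc k) ℤ.+ coeff (0ℤ ∷ f *ᵖ g) (suc k)  ≡⟨ coeff-+ (a · g) (0ℤ ∷ f *ᵖ g) (suc k) ⟨
      coeff ((a ∷ f) *ᵖ g) (suc k)                           ≡⟨ lt (suc k) (ℕ.m≤n⇒m≤1+n n≤k) ⟩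
      0ℤ                                                     ∎

    a≡0 : a ≡ 0ℤ
    a≡0 = begin
      a                                      ≡⟨ ℤ.*-identityʳ a ⟨
      a ℤ.* 1ℤ                               ≡⟨ cong (a ℤ.*_) (m .leading) ⟨
      a ℤ.* coeff g n                        ≡⟨ coeff-· a g n ⟨
      coeff (a · g) n                        ≡⟨ coeff≡ (+-identityʳ (a · g)) n ⟨
      coeff (a · g +ᵖ []) n                  ≡⟨ coeff≡ (+-cong {f = a · g} ≋-refl (≋-trans (∷-cong refl (*-cong {g = g} f≋0 ≋-refl)) 0∷[])) n ⟨
      coeff ((a ∷ f) *ᵖ g) n                 ≡⟨ lt n ℕ.≤-refl ⟩
      0ℤ                                     ∎

  infixl 7 _mod_
  _mod_ : Poly → (ng : ℕ × Poly) → Poly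
  f mod (n , g) = Vec.toList (proj₂ (divMod n g f))

  coeff-toList-≥ : ∀ {n} (v : Vec ℤ n) → Vec.toList v <deg n
  coeff-toList-≥ []      k       _         = refl
  coeff-toList-≥ (a ∷ v) (suc k) (s≤s n≤k) = coeff-toList-≥ v k n≤k

  coeff-init : ∀ {n} (v : Vec ℤ (suc n)) {k} → k < n →
    coeff (Vec.toList (Vec.init v)) k ≡ coeff (Vec.toList v) k
  coeff-init {suc n} (a ∷ v) {zero}  _         = refl
  coeff-init {suc n} (a ∷ v) {suc k} (s≤s k<n) = coeff-init v k<n

  coeff-last : ∀ {n} (v : Vec ℤ (suc n)) → coeff (Vec.toList v) n ≡ Vec.last v
  coeff-last {zero}  (a ∷ []) = refl
  coeff-last {suc n} (a ∷ v)  = coeff-last v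

  coeff-zipWith-tabulate : ∀ {n} (h : ℤ → ℤ → ℤ) (v : Vec ℤ n) (c : ℕ → ℤ) {k} → k < n →
    coeff (Vec.toList (Vec.zipWith h v (Vec.tabulate (λ i → c (toℕ i))))) k ≡ h (coeff (Vec.toList v) k) (c k)
  coeff-zipWith-tabulate h (a ∷ v) c {zero}  _         = refl
  coeff-zipWith-tabulate h (a ∷ v) c {suc k} (s≤s k<n) = coeff-zipWith-tabulate h v (λ i → c (suc i)) k<n

  module DivStep (n : ℕ) (g : Poly) (a : ℤ) (f : Poly) where
    shifted : Vec ℤ (suc n)
    shifted = a ∷ proj₂ (divMod n g f)

    carry : ℤ
    carry = Vec.last shifted

    coeff-mod-∷ : ∀ {k} → k < n →
      coeff ((a ∷ f) mod (n , g)) k ≡ coeff (a ∷ f mod (n , g)) k ℤ.- carry ℤ.* coeff g k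
    coeff-mod-∷ {k} k<n = trans
      (coeff-zipWith-tabulate (λ b c → b ℤ.- carry ℤ.* c) (Vec.init shifted) (coeff g) k<n)
      (cong (ℤ._- carry ℤ.* coeff g k) (coeff-init shifted k<n))

  coeff-zeros : ∀ n k → coeff (Vec.toList (Vec.replicate n 0ℤ)) k ≡ 0ℤ
  coeff-zeros zero    k       = refl
  coeff-zeros (suc n) zero    = refl
  coeff-zeros (suc n) (suc k) = coeff-zeros n k

  divMod-spec : ∀ {n g} → Monic n g → ∀ f → f ≋ proj₁ (divMod n g f) *ᵖ g +ᵖ f mod (n , g)
  divMod-spec {n} {g} m []      = mk≋ λ k → sym (coeff-zeros n k)
  divMod-spec {n} {g} m (a ∷ f) = mk≋ λ k → begin
    coeff (a ∷ f) k                                            ≡⟨ coeff≡ (∷-cong refl (divMod-spec m f)) k ⟩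
    coeff (a ∷ (Q *ᵖ g +ᵖ R)) k                                ≡⟨ coeff≡ (∷-cong {f = Q *ᵖ g +ᵖ R} (sym (ℤ.+-identityˡ a)) ≋-refl) k ⟩
    coeff ((0ℤ ∷ Q *ᵖ g) +ᵖ (a ∷ R)) k                         ≡⟨ coeff-+ (0ℤ ∷ Q *ᵖ g) (a ∷ R) k ⟩
    coeff (0ℤ ∷ Q *ᵖ g) k ℤ.+ coeff (a ∷ R) k                  ≡⟨ cong (ℤ._+_ (coeff (0ℤ ∷ Q *ᵖ g) k)) (split k) ⟩
    coeff (0ℤ ∷ Q *ᵖ g) k ℤ.+ (l ℤ.* coeff g k ℤ.+ coeff R′ k) ≡⟨ rearrange (coeff (0ℤ ∷ Q *ᵖ g) k) (l ℤ.* coeff g k) (coeff R′ k) ⟩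
    l ℤ.* coeff g k ℤ.+ coeff (0ℤ ∷ Q *ᵖ g) k ℤ.+ coeff R′ k   ≡⟨ cong (λ c → c ℤ.+ coeff (0ℤ ∷ Q *ᵖ g) k ℤ.+ coeff R′ k) (coeff-· l g k) ⟨
    coeff (l · g) k ℤ.+ coeff (0ℤ ∷ Q *ᵖ g) k ℤ.+ coeff R′ k   ≡⟨ cong (ℤ._+ coeff R′ k) (coeff-+ (l · g) (0ℤ ∷ Q *ᵖ g) k) ⟨
    coeff ((l ∷ Q) *ᵖ g) k ℤ.+ coeff R′ k                      ≡⟨ coeff-+ ((l ∷ Q) *ᵖ g) R′ k ⟨
    coeff ((l ∷ Q) *ᵖ g +ᵖ R′) k                               ∎
    where
    open ≡-Reasoning
    open DivStep n g a f renaming (carry to l)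
    Q R R′ : Poly
    Q = proj₁ (divMod n g f)
    R = f mod (n , g)
    R′ = (a ∷ f) mod (n , g)

    rearrange : ∀ x y z → x ℤ.+ (y ℤ.+ z) ≡ y ℤ.+ x ℤ.+ z
    rearrange = ℤ-solve

    cancel : ∀ x y → x ≡ y ℤ.+ (x ℤ.- y)
    cancel = ℤ-solve

    -- Subtracting l g cancels coefficient n because g is monic; below n this is the division step,
    -- and above n every term is 0.
    split : ∀ k → coeff (a ∷ R) k ≡ l ℤ.* coeff g k ℤ.+ coeff R′ k
    split k with ℕ.<-cmp k n
    ... | tri< k<n _ _ = trans (cancel (coeff (a ∷ R) k) (l ℤ.* coeff g k))
                           (cong (ℤ._+_ (l ℤ.* coeff g k)) (sym (coeff-mod-∷ k<n)))
    ... | tri≈ _ refl _ = begin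
      coeff (a ∷ R) k                       ≡⟨ coeff-last shifted ⟩
      l                                     ≡⟨ ℤ.*-identityʳ l ⟨
      l ℤ.* 1ℤ                              ≡⟨ ℤ.+-identityʳ _ ⟨
      l ℤ.* 1ℤ ℤ.+ 0ℤ                       ≡⟨ cong₂ (λ b c → l ℤ.* b ℤ.+ c) (m .leading) (coeff-toList-≥ (proj₂ (divMod k g (a ∷ f))) k ℕ.≤-refl) ⟨
      l ℤ.* coeff g k ℤ.+ coeff R′ k        ∎
    ... | tri> _ _ n<k = begin
      coeff (a ∷ R) k                       ≡⟨ coeff-toList-≥ shifted k n<k ⟩
      0ℤ                                    ≡⟨ ℤ.*-zeroʳ l ⟨
      l ℤ.* 0ℤ                              ≡⟨ ℤ.+-identityʳ _ ⟨
      l ℤ.* 0ℤ ℤ.+ 0ℤ                       ≡⟨ cong₂ (λ b c → l ℤ.* b ℤ.+ c) (m .above k n<k) (coeff-toList-≥ (proj₂ (divMod n g (a ∷ f))) k (ℕ.<⇒≤ n<k)) ⟨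
      l ℤ.* coeff g k ℤ.+ coeff R′ k        ∎

  -- Multiples of `g` are subtracted only when a nonzero `carry` occurs, and a list that fits into
  -- `n` places never produces one. This carries bounds on the list over to its remainder.
  mod-short : ∀ n g f → length f ≤ n → ∀ k → coeff (f mod (n , g)) k ≡ coeff f k
  mod-short n g []      _  k = coeff-zeros n k
  mod-short n g (a ∷ f) len k with k ℕ.<? n
  ... | no k≮n = trans (coeff-toList-≥ (proj₂ (divMod n g (a ∷ f))) k (ℕ.≮⇒≥ k≮n))
                       (sym (length-<deg (a ∷ f) k (ℕ.≤-trans len (ℕ.≮⇒≥ k≮n))))
  mod-short (suc n) g (a ∷ f) (s≤s len) k | yes k<n = begin
    coeff ((a ∷ f) mod (suc n , g)) k                           ≡⟨ coeff-mod-∷ k<n ⟩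
    coeff (a ∷ f mod (suc n , g)) k ℤ.- carry ℤ.* coeff g k     ≡⟨ cong (λ c → coeff (a ∷ f mod (suc n , g)) k ℤ.- c ℤ.* coeff g k) carry≡0 ⟩
    coeff (a ∷ f mod (suc n , g)) k ℤ.+ 0ℤ                      ≡⟨ ℤ.+-identityʳ _ ⟩
    coeff (a ∷ f mod (suc n , g)) k                             ≡⟨ coeff≡ (∷-cong refl (mk≋ ih)) k ⟩
    coeff (a ∷ f) k                                             ∎
    where
    open ≡-Reasoning
    open DivStep (suc n) g a f

    ih : f mod (suc n , g) ≈ f
    ih = mod-short (suc n) g f (ℕ.m≤n⇒m≤1+n len)

    carry≡0 : carry ≡ 0ℤ
    carry≡0 = trans (sym (coeff-last shifted)) (trans (ih n) (length-<deg f n len))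

open Polynomials

-- Cyclotomic polynomials of p^a q^b

module CyclotomicPolynomials where

  open CommutativeRing polyRing using (setoid; *-commutativeMonoid; commutativeSemiring; reflexive)
  open Geometric polyRing
  open BigOp *-commutativeMonoid using ()
    renaming (∑ to ∏; ∑-cong to ∏-cong; ∑-∙ to ∏-*; ∑-ε to ∏-1; ∑-split to ∏-split)
  open import Algebra.Properties.Ring (CommutativeRing.ring polyRing) using ([y-z]x≈yx-zx; x≈y⇒x∙y⁻¹≈ε; x∙y⁻¹≈ε⇒x≈y)
  open import Relation.Binary.Reasoning.Setoid setoid

  monic-cancelʳ : ∀ {n g f f′} → Monic n g → f *ᵖ g ≋ f′ *ᵖ g → f ≋ f′
  monic-cancelʳ {n} {g} {f} {f′} m e = x∙y⁻¹≈ε⇒x≈y f f′ (<deg-monic-multiple m (f -ᵖ f′) λ k _ →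
    coeff≡ (≋-trans ([y-z]x≈yx-zx g f f′) (x≈y⇒x∙y⁻¹≈ε e)) k)

  -- `(h -ᵖ Q) *ᵖ g` equals the remainder, and no nonzero multiple of the monic `g` has degree below
  -- n.
  quot-exact : ∀ {n f g h} → Monic n g → f ≋ h *ᵖ g → quot f g ≋ h
  quot-exact {n} {f} {g} {h} m f≋hg rewrite monic-degree m = ≋-sym (x∙y⁻¹≈ε⇒x≈y h Q
    (<deg-monic-multiple m (h -ᵖ Q) λ k n≤k → trans (coeff≡ remainder k) (coeff-toList-≥ (proj₂ (divMod n g f)) k n≤k)))
    where
    Q : Poly
    Q = proj₁ (divMod n g f)
    remainder : (h -ᵖ Q) *ᵖ g ≋ f mod (n , g)
    remainder = begin
      (h -ᵖ Q) *ᵖ g             ≈⟨ [y-z]x≈yx-zx g h Q ⟩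
      h *ᵖ g -ᵖ Q *ᵖ g          ≈⟨ x≈y+z⇒x-z≈y (≋-trans (≋-sym f≋hg) (≋-trans (divMod-spec m f) (+-comm (Q *ᵖ g) _))) ⟩
      f mod (n , g)             ∎

  var : Poly
  var = X^ 1

  var*≋0∷ : ∀ f → var *ᵖ f ≋ 0ℤ ∷ f
  var*≋0∷ f = ≋-trans (0∷-* (const 1ℤ) f) (∷-cong refl (*-identityˡ f))

  X^≋var^ : ∀ n → X^ n ≋ var ^ n
  X^≋var^ zero    = ≋-refl
  X^≋var^ (suc n) = ≋-trans (∷-cong refl (X^≋var^ n)) (≋-sym (var*≋0∷ (var ^ n)))

  X^-* : ∀ m n → X^ (m * n) ≋ (X^ n) ^ m
  X^-* m n = begin
    X^ (m * n)         ≈⟨ X^≋var^ (m * n) ⟩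
    var ^ (m * n)      ≡⟨ cong (var ^_) (ℕ.*-comm m n) ⟩
    var ^ (n * m)      ≈⟨ ^-assocʳ var n m ⟨
    (var ^ n) ^ m      ≈⟨ ^-congˡ m (X^≋var^ n) ⟨
    (X^ n) ^ m         ∎

  x^n-1 : ℕ → Poly
  x^n-1 n = X^ n -ᵖ X^ 0

  x^n-1-factor : ∀ m n → x^n-1 (m * n) ≋ x^n-1 n *ᵖ geo m (X^ n)
  x^n-1-factor m n = ≋-trans (+-cong (X^-* m n) ≋-refl) (≋-sym (geo-telescope m (X^ n)))

  monic-x^n-1 : ∀ {n} → 0 < n → Monic n (x^n-1 n)
  monic-x^n-1 {n} 0<n = monic-cong (+-comm (-ᵖ X^ 0) (X^ n))
    (monic-+ (λ { (suc k) _ → refl ; zero n≤0 → contradiction (ℕ.<-≤-trans 0<n n≤0) (λ ()) }) (monic-X^ n))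

  <deg-geo : ∀ {m} → 0 < m → ∀ n → geo n (X^ m) <deg n * m
  <deg-geo         0<m zero    k _  = refl
  <deg-geo {m} 0<m (suc n) k le =
    trans (coeff≡ (∑-last n (z ^_)) k) (trans (coeff-+ (geo n z) (z ^ n) k)
      (cong₂ ℤ._+_ (<deg-geo 0<m n k (ℕ.<⇒≤ lt))
                   (trans (sym (coeff≡ (X^-* n m) k)) (monic-X^ (n * m) .above k lt))))
    where
    z = X^ m
    lt : n * m < k
    lt = ℕ.<-≤-trans (ℕ.m<n+m (n * m) 0<m) le

  monic-geo : ∀ {m} → 0 < m → ∀ n → Monic (n * m) (geo (suc n) (X^ m))
  monic-geo {m} 0<m n = monic-cong (≋-sym (∑-last n (X^ m ^_)))
    (monic-+ (<deg-geo 0<m n) (monic-cong (X^-* n m) (monic-X^ (n * m))))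

  opaque
    -- Opaque, so that comparing products evaluates neither the divisibility tests nor the recursion
    -- inside `Φ`.
    Φ-factor : ℕ → ℕ → Poly
    Φ-factor n d = if does (d ∣? n) then Φ d else const 1ℤ

    factor-yes : ∀ {n d} → d ∣ n → Φ-factor n d ≡ Φ d
    factor-yes {n} {d} d∣n = cong (if_then Φ d else const 1ℤ) (dec-true (d ∣? n) d∣n)

    factor-no : ∀ {n d} → ¬ d ∣ n → Φ-factor n d ≡ const 1ℤ
    factor-no {n} {d} d∤n = cong (if_then Φ d else const 1ℤ) (dec-false (d ∣? n) d∤n)

  Φ-product : ℕ → ℕ → Poly
  Φ-product n N = ∏ N (Φ-factor n)

  opaque
    unfolding Φ-factor

    Φ-unfold : ∀ n → Φ n ≡ quot (x^n-1 n) (Φ-product n n)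
    Φ-unfold n = trans
      -- Unfolding the well-founded recursion requires the step to respect pointwise equality of the
      -- recursive calls; `tabulate-cong` provides this without function extensionality.
      (FixPoint.unfold-wfRec <-wellFounded (λ _ → Poly) step
        (λ n {IH} {IH′} e → cong (λ l → quot (x^n-1 n) (foldr _*ᵖ_ (const 1ℤ) l))
          (tabulate-cong λ d → cong (if does (toℕ d ∣? n) then_else const 1ℤ) (e (toℕ<n d)))) {n})
      (cong (quot (x^n-1 n)) (foldr-tabulate n (Φ-factor n)))
      where
      step : ∀ n → (∀ {d} → d < n → Poly) → Poly
      step n Φ′ = quot (X^ n -ᵖ X^ 0)
        (foldr _*ᵖ_ (const 1ℤ)
          (tabulate λ (d : Fin n) → if does (toℕ d ∣? n) then Φ′ (toℕ<n d) else const 1ℤ))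

      foldr-tabulate : ∀ N (F : ℕ → Poly) → foldr _*ᵖ_ (const 1ℤ) (tabulate {n = N} (F ∘ toℕ)) ≡ ∏ N F
      foldr-tabulate zero    F = refl
      foldr-tabulate (suc N) F = cong (F 0 *ᵖ_) (foldr-tabulate N (F ∘ suc))

  Φ≋ : ∀ {n k g h} → Φ-product n n ≋ g → Monic k g → x^n-1 n ≋ h *ᵖ g → Φ n ≋ h
  Φ≋ {n} {h = h} e m f≋hg = ≋-trans (reflexive (Φ-unfold n))
    (quot-exact (monic-cong (≋-sym e) m) (≋-trans f≋hg (*-congˡ h (≋-sym e))))

  -- Factors beyond n are trivial, so any N above n will do; this allows the products for
  -- different n to be compared over a common range.
  Factorizes : ℕ → Set
  Factorizes n = ∀ {N} → n < N → Φ-product n N ≋ x^n-1 n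

  -- The range splits at n: the divisors below it contribute g, n itself contributes `Φ n`, which is
  -- h, and everything beyond contributes 1.
  factorizes : ∀ {n k g h} → 0 < n → Φ-product n n ≋ g → Monic k g → x^n-1 n ≋ h *ᵖ g → Factorizes n
  factorizes {n} {k} {g} {h} 0<n e m f≋hg {N} n<N with ℕ.m≤n⇒∃[o]m+o≡n n<N
  ... | o , refl = begin
    Φ-product n (suc n + o)                                  ≡⟨ cong (Φ-product n) (ℕ.+-suc n o) ⟨
    Φ-product n (n + suc o)                                  ≈⟨ ∏-split n (suc o) (Φ-factor n) ⟩
    Φ-product n n *ᵖ (Φ-factor n (n + 0) *ᵖ ∏ o (λ i → Φ-factor n (n + suc i)))
      ≈⟨ *-cong e (*-cong (reflexive (trans (cong (Φ-factor n) (ℕ.+-identityʳ n)) (factor-yes {n} ∣-refl)))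
           (≋-trans (∏-cong o λ i _ → reflexive (factor-no {n} (>⇒∤ ⦃ ℕ.>-nonZero 0<n ⦄ (ℕ.m<m+n n z<s)))) (∏-1 o))) ⟩
    g *ᵖ (Φ n *ᵖ const 1ℤ)                                   ≈⟨ *-congˡ g (CommutativeRing.*-identityʳ polyRing (Φ n)) ⟩
    g *ᵖ Φ n                                                 ≈⟨ *-congˡ g (Φ≋ e m f≋hg) ⟩
    g *ᵖ h                                                   ≈⟨ *-comm g h ⟩
    h *ᵖ g                                                   ≈⟨ f≋hg ⟨
    x^n-1 n                                                  ∎

  properDivisor-cofactor : ∀ {n d} → d ∣ n → d < n → ∃[ e ] n ≡ d * e × ¬ e ≡ 1
  properDivisor-cofactor {n} {d} (divides e n≡ed) d<n = e , trans n≡ed (ℕ.*-comm e d) ,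
    λ { refl → ℕ.<⇒≢ d<n (sym (trans n≡ed (ℕ.*-identityˡ d))) }

  ∣-cancel-prime : ∀ {p z d e} .⦃ _ : NonZero p ⦄ → p * z ≡ d * e → p ∣ e → d ∣ z
  ∣-cancel-prime {p} {z} {d} pz≡de (divides c refl) = divides c (ℕ.*-cancelˡ-≡ z (c * d) p
    (trans pz≡de (rearrange d c p)))
    where
    rearrange : ∀ d c p → d * (c * p) ≡ p * (c * d)
    rearrange = solve-∀

  factorizes-1 : Factorizes 1
  factorizes-1 = factorizes {1} {g = const 1ℤ} {h = x^n-1 1} z<s
    (≋-trans (*-cong (reflexive (factor-no {1} {0} λ 0∣1 → contradiction (0∣⇒≡0 0∣1) λ ())) ≋-refl) (*-identityˡ (const 1ℤ)))
    (monic-X^ 0)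
    (≋-trans (≋-sym (*-identityˡ (x^n-1 1))) (*-comm (const 1ℤ) (x^n-1 1)))

  -- The cofactor of a proper divisor of p^(a+1) is divisible by p, so the proper divisors are the
  -- divisors of z = p^a. Their product is x^z - 1 by induction, leaving `geo p (X^ z)` for Φ.
  factorizes-prime-power : ∀ {p} → Prime p → ∀ a → Factorizes (p ℕ.^ a)
  factorizes-prime-power         pp zero    = factorizes-1
  factorizes-prime-power {p} pp (suc a) =
    factorizes {h = geo p (X^ z)} (ℕ.>-nonZero⁻¹ (p * z) ⦃ ℕ.m*n≢0 p z ⦄) (begin
      Φ-product (p * z) (p * z)    ≈⟨ ∏-cong (p * z) (λ d d<n → reflexive (same d d<n)) ⟩
      Φ-product z (p * z)          ≈⟨ factorizes-prime-power pp a z<pz ⟩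
      x^n-1 z                      ∎)
    (monic-x^n-1 0<z) (≋-trans (x^n-1-factor p z) (*-comm (x^n-1 z) (geo p (X^ z))))
    where
    z = p ℕ.^ a
    instance
      p≢0 : NonZero p
      p≢0 = prime⇒nonZero pp
      z≢0 : NonZero z
      z≢0 = ℕ.m^n≢0 p a
    0<z : 0 < z
    0<z = ℕ.>-nonZero⁻¹ z
    z<pz : z < p * z
    z<pz = m<n*m z (prime⇒n>1 pp)
    same : ∀ d → d < p * z → Φ-factor (p * z) d ≡ Φ-factor z d
    same d d<n with d ∣? p * z
    ... | no  d∤n = trans (factor-no {p * z} d∤n) (sym (factor-no {z} {d} λ d∣z → d∤n (∣-trans d∣z (n∣m*n p))))
    ... | yes d∣n with e , n≡de , e≢1 ← properDivisor-cofactor {d = d} d∣n d<n | p ∣? e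
    ...   | yes p∣e = trans (factor-yes {p * z} d∣n) (sym (factor-yes {z} {d} (∣-cancel-prime {d = d} n≡de p∣e)))
    ...   | no  p∤e = contradiction (coprime-^ʳ (prime∤⇒coprime pp p∤e) (suc a) (∣-refl , divides d n≡de)) e≢1

  open SemiringSolver commutativeSemiring using (solve; _:=_; _:*_)

  module Cyclotomic (p q : ℕ) (prime-p : Prime p) (prime-q : Prime q) (p⊥q : Coprime p q) where

    private instance
      p≢0 : NonZero p
      p≢0 = prime⇒nonZero prime-p
      q≢0 : NonZero q
      q≢0 = prime⇒nonZero prime-q

    monic-geo′ : ∀ {m} .⦃ _ : NonZero m ⦄ → ∀ n .⦃ _ : NonZero n ⦄ → Monic (ℕ.pred n * m) (geo n (X^ m))
    monic-geo′ {m} (suc n) = monic-geo {m} (ℕ.>-nonZero⁻¹ m) n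

    module Step (z : ℕ) .⦃ z≢0 : NonZero z ⦄
      (fac-z  : Factorizes z) (fac-pz : Factorizes (p * z)) (fac-qz : Factorizes (q * z))
      (nontrivial-divisor : ∀ {e} → e ∣ p * (q * z) → ¬ e ≡ 1 → p ∣ e ⊎ q ∣ e) where

      private
        n = p * (q * z)
        w = X^ z
        instance
          n≢0 : NonZero n
          n≢0 = ℕ.m*n≢0 p (q * z) ⦃ p≢0 ⦄ ⦃ ℕ.m*n≢0 q z ⦄

        n≡qpz : n ≡ q * (p * z)
        n≡qpz = swap p q z
          where
          swap : ∀ p q z → p * (q * z) ≡ q * (p * z)
          swap = solve-∀

        qz<n : q * z < n
        qz<n = m<n*m (q * z) ⦃ ℕ.m*n≢0 q z ⦄ (prime⇒n>1 prime-p)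
        pz<n : p * z < n
        pz<n = subst (p * z <_) (sym n≡qpz) (m<n*m (p * z) ⦃ ℕ.m*n≢0 p z ⦄ (prime⇒n>1 prime-q))
        z<n : z < n
        z<n = ℕ.<-trans (m<n*m z (prime⇒n>1 prime-q)) qz<n

      -- Inclusion-exclusion: a proper divisor of n = pqz divides pz or qz, and it divides
      -- both only if it divides z.
      divisors : ∀ d → d < n → Φ-factor n d *ᵖ Φ-factor z d ≋ Φ-factor (q * z) d *ᵖ Φ-factor (p * z) d
      divisors d d<n with d ∣? q * z | d ∣? p * z
      ... | yes d∣qz | yes d∣pz = reflexive (cong₂ _*ᵖ_
        (trans (factor-yes {n} (∣-trans d∣qz (n∣m*n p))) (sym (factor-yes d∣qz)))
        (trans (factor-yes {z} (coprime-factors p⊥q (d∣pz , d∣qz))) (sym (factor-yes d∣pz))))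
      ... | yes d∣qz | no d∤pz = reflexive (cong₂ _*ᵖ_
        (trans (factor-yes {n} (∣-trans d∣qz (n∣m*n p))) (sym (factor-yes d∣qz)))
        (trans (factor-no {z} (λ d∣z → d∤pz (∣-trans d∣z (n∣m*n p)))) (sym (factor-no d∤pz))))
      ... | no d∤qz | yes d∣pz = ≋-trans (*-comm (Φ-factor n d) _) (reflexive (cong₂ _*ᵖ_
        (trans (factor-no {z} (λ d∣z → d∤qz (∣-trans d∣z (n∣m*n q)))) (sym (factor-no d∤qz)))
        (trans (factor-yes {n} (subst (d ∣_) (sym n≡qpz) (∣-trans d∣pz (n∣m*n q)))) (sym (factor-yes d∣pz)))))
      ... | no d∤qz | no d∤pz = reflexive (cong₂ _*ᵖ_
        (trans (factor-no {n} d∤n) (sym (factor-no d∤qz)))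
        (trans (factor-no {z} (λ d∣z → d∤pz (∣-trans d∣z (n∣m*n p)))) (sym (factor-no d∤pz))))
        where
        d∤n : ¬ d ∣ n
        d∤n d∣n with e , n≡de , e≢1 ← properDivisor-cofactor {d = d} d∣n d<n
          with nontrivial-divisor (divides d n≡de) e≢1
        ... | inj₁ p∣e = d∤qz (∣-cancel-prime {d = d} n≡de p∣e)
        ... | inj₂ q∣e = d∤pz (∣-cancel-prime {d = d} (trans (sym n≡qpz) n≡de) q∣e)

      -- Inclusion-exclusion asks for division by x^z - 1. Multiplying by the product over the
      -- divisors of z turns it into an equation between products, from which the monic factor is
      -- cancelled.
      properProduct : Φ-product n n ≋ x^n-1 (q * z) *ᵖ geo p w
      properProduct = monic-cancelʳ (monic-x^n-1 (ℕ.>-nonZero⁻¹ z)) (begin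
        Φ-product n n *ᵖ x^n-1 z                          ≈⟨ *-congˡ (Φ-product n n) (fac-z z<n) ⟨
        Φ-product n n *ᵖ Φ-product z n                    ≈⟨ ∏-* n (Φ-factor n) (Φ-factor z) ⟨
        ∏ n (λ d → Φ-factor n d *ᵖ Φ-factor z d)          ≈⟨ ∏-cong n divisors ⟩
        ∏ n (λ d → Φ-factor (q * z) d *ᵖ Φ-factor (p * z) d) ≈⟨ ∏-* n (Φ-factor (q * z)) (Φ-factor (p * z)) ⟩
        Φ-product (q * z) n *ᵖ Φ-product (p * z) n        ≈⟨ *-cong (fac-qz qz<n) (fac-pz pz<n) ⟩
        x^n-1 (q * z) *ᵖ x^n-1 (p * z)                    ≈⟨ *-congˡ (x^n-1 (q * z)) (≋-trans (x^n-1-factor p z) (*-comm (x^n-1 z) (geo p w))) ⟩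
        x^n-1 (q * z) *ᵖ (geo p w *ᵖ x^n-1 z)             ≈⟨ *-assoc (x^n-1 (q * z)) (geo p w) (x^n-1 z) ⟨
        x^n-1 (q * z) *ᵖ geo p w *ᵖ x^n-1 z               ∎)

      private
        bezout : ∃[ a ] ∃[ b ] a * p ≡ 1 + b * q
        bezout = coprime-inverse p⊥q (prime⇒n>1 prime-q)

        -- Since x^n - 1 = (x^(qz) - 1) `geo p (w ^ q)`, dividing by the proper part leaves the
        -- quotient of `geo p (w ^ q)` by `geo p w`. This quotient is `Φ n`, and comaximality shows
        -- that it is a polynomial.
        cofactor : ∃[ k ] geo p (w ^ q) ≋ geo p w *ᵖ k
        cofactor = geo-coprime p q (proj₁ bezout) (proj₁ (proj₂ bezout)) (proj₂ (proj₂ bezout)) w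

        k : Poly
        k = proj₁ cofactor

        x^n-1≋ : x^n-1 n ≋ k *ᵖ (x^n-1 (q * z) *ᵖ geo p w)
        x^n-1≋ = begin
          x^n-1 n                                        ≈⟨ x^n-1-factor p (q * z) ⟩
          x^n-1 (q * z) *ᵖ geo p (X^ (q * z))            ≈⟨ *-congˡ (x^n-1 (q * z)) (∑-cong p λ i _ → ^-congˡ i (X^-* q z)) ⟩
          x^n-1 (q * z) *ᵖ geo p (w ^ q)                 ≈⟨ *-congˡ (x^n-1 (q * z)) (proj₂ cofactor) ⟩
          x^n-1 (q * z) *ᵖ (geo p w *ᵖ k)                ≈⟨ solve 3 (λ a b c → a :* (b :* c) := c :* (a :* b)) ≋-refl (x^n-1 (q * z)) (geo p w) k ⟩
          k *ᵖ (x^n-1 (q * z) *ᵖ geo p w)                ∎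

        monic-proper : Monic (q * z + ℕ.pred p * z) (x^n-1 (q * z) *ᵖ geo p w)
        monic-proper = monic-* (monic-x^n-1 (ℕ.>-nonZero⁻¹ (q * z) ⦃ ℕ.m*n≢0 q z ⦄)) (monic-geo′ p)

        Φ≋k : Φ n ≋ k
        Φ≋k = Φ≋ properProduct monic-proper x^n-1≋

      factorizes-n : Factorizes n
      factorizes-n = factorizes {h = k} (ℕ.>-nonZero⁻¹ n) properProduct monic-proper x^n-1≋

      geo-p : geo p (w ^ q) ≋ geo p w *ᵖ Φ n
      geo-p = ≋-trans (proj₂ cofactor) (*-congˡ (geo p w) (≋-sym Φ≋k))

      -- `geo (p * q) w` has two factorizations, one through `geo p w` and one through `geo q w`;
      -- comparing them transfers `geo-p` to q.
      geo-q : geo q (w ^ p) ≋ geo q w *ᵖ Φ n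
      geo-q = monic-cancelʳ (monic-geo′ p) (begin
        geo q (w ^ p) *ᵖ geo p w              ≈⟨ *-comm (geo q (w ^ p)) (geo p w) ⟩
        geo p w *ᵖ geo q (w ^ p)              ≈⟨ geo-* q p w ⟨
        geo (q * p) w                         ≡⟨ cong (λ m → geo m w) (ℕ.*-comm q p) ⟩
        geo (p * q) w                         ≈⟨ geo-* p q w ⟩
        geo q w *ᵖ geo p (w ^ q)              ≈⟨ *-congˡ (geo q w) geo-p ⟩
        geo q w *ᵖ (geo p w *ᵖ Φ n)           ≈⟨ solve 3 (λ a b c → a :* (b :* c) := (a :* c) :* b) ≋-refl (geo q w) (geo p w) (Φ n) ⟩
        geo q w *ᵖ Φ n *ᵖ geo p w             ∎)

    pᵃqᵇ : ℕ → ℕ → ℕ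
    pᵃqᵇ a b = p ℕ.^ a * q ℕ.^ b

    pᵃqᵇ≢0 : ∀ a b → NonZero (pᵃqᵇ a b)
    pᵃqᵇ≢0 a b = ℕ.m*n≢0 (p ℕ.^ a) (q ℕ.^ b) ⦃ ℕ.m^n≢0 p a ⦄ ⦃ ℕ.m^n≢0 q b ⦄

    coprime-pᵃqᵇ : ∀ {e} → ¬ p ∣ e → ¬ q ∣ e → ∀ a b → Coprime e (pᵃqᵇ a b)
    coprime-pᵃqᵇ p∤e q∤e a b = coprime-*ʳ (coprime-^ʳ (prime∤⇒coprime prime-p p∤e) a)
                                          (coprime-^ʳ (prime∤⇒coprime prime-q q∤e) b)

    divisor-pᵃqᵇ : ∀ a b {e} → e ∣ pᵃqᵇ a b → ¬ e ≡ 1 → p ∣ e ⊎ q ∣ e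
    divisor-pᵃqᵇ a b {e} e∣n e≢1 with p ∣? e | q ∣? e
    ... | yes p∣e | _       = inj₁ p∣e
    ... | no  _   | yes q∣e = inj₂ q∣e
    ... | no  p∤e | no  q∤e = contradiction (coprime-pᵃqᵇ p∤e q∤e a b (∣-refl , e∣n)) e≢1

    p*pᵃqᵇ : ∀ a b → p * pᵃqᵇ a b ≡ pᵃqᵇ (suc a) b
    p*pᵃqᵇ a b = sym (ℕ.*-assoc p (p ℕ.^ a) (q ℕ.^ b))

    q*pᵃqᵇ : ∀ a b → q * pᵃqᵇ a b ≡ pᵃqᵇ a (suc b)
    q*pᵃqᵇ a b = swap (p ℕ.^ a) q (q ℕ.^ b)
      where
      swap : ∀ x y z → y * (x * z) ≡ x * (y * z)
      swap = solve-∀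

    pq*pᵃqᵇ : ∀ a b → p * (q * pᵃqᵇ a b) ≡ pᵃqᵇ (suc a) (suc b)
    pq*pᵃqᵇ a b = trans (cong (p *_) (q*pᵃqᵇ a b)) (p*pᵃqᵇ a (suc b))

    divisor-pqpᵃqᵇ : ∀ a b {e} → e ∣ p * (q * pᵃqᵇ a b) → ¬ e ≡ 1 → p ∣ e ⊎ q ∣ e
    divisor-pqpᵃqᵇ a b {e} e∣n = divisor-pᵃqᵇ (suc a) (suc b) (subst (e ∣_) (pq*pᵃqᵇ a b) e∣n)

    -- Declared ahead of `Power`, with which it is mutually recursive: the case (a + 1, b + 1) rests
    -- on (a, b), (a + 1, b) and (a, b + 1).
    factorizes-pᵃqᵇ : ∀ a b → Factorizes (pᵃqᵇ a b)

    module Power (a b : ℕ) = Step (pᵃqᵇ a b) ⦃ pᵃqᵇ≢0 a b ⦄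
      (factorizes-pᵃqᵇ a b)
      (subst Factorizes (sym (p*pᵃqᵇ a b)) (factorizes-pᵃqᵇ (suc a) b))
      (subst Factorizes (sym (q*pᵃqᵇ a b)) (factorizes-pᵃqᵇ a (suc b)))
      (divisor-pqpᵃqᵇ a b)

    factorizes-pᵃqᵇ zero    b       = subst Factorizes (sym (ℕ.*-identityˡ (q ℕ.^ b))) (factorizes-prime-power prime-q b)
    factorizes-pᵃqᵇ (suc a) zero    = subst Factorizes (sym (ℕ.*-identityʳ (p ℕ.^ suc a))) (factorizes-prime-power prime-p (suc a))
    factorizes-pᵃqᵇ (suc a) (suc b) = subst Factorizes (pq*pᵃqᵇ a b) (Power.factorizes-n a b)

    Φ∣geo-p : ∀ a b → geo p (X^ pᵃqᵇ a b ^ q) ≋ geo p (X^ pᵃqᵇ a b) *ᵖ Φ (pᵃqᵇ (suc a) (suc b))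
    Φ∣geo-p a b = subst (λ n → geo p (X^ pᵃqᵇ a b ^ q) ≋ geo p (X^ pᵃqᵇ a b) *ᵖ Φ n) (pq*pᵃqᵇ a b) (Power.geo-p a b)

    Φ∣geo-q : ∀ a b → geo q (X^ pᵃqᵇ a b ^ p) ≋ geo q (X^ pᵃqᵇ a b) *ᵖ Φ (pᵃqᵇ (suc a) (suc b))
    Φ∣geo-q a b = subst (λ n → geo q (X^ pᵃqᵇ a b ^ p) ≋ geo q (X^ pᵃqᵇ a b) *ᵖ Φ n) (pq*pᵃqᵇ a b) (Power.geo-q a b)

open CyclotomicPolynomials

-- A lower bound for Euler's totient

opaque
  unfolding [_]

  length-filter : ∀ {ℓ} {P : Pred ℕ ℓ} (P? : Decidable P) (f : ℕ → ℕ) n →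
    length (filter P? (applyUpTo f n)) ≡ ∑ℕ n (λ i → [ P? (f i) ])
  length-filter P? f zero    = refl
  length-filter P? f (suc n) with does (P? (f 0))
  ... | true  = cong suc (length-filter P? (f ∘ suc) n)
  ... | false = length-filter P? (f ∘ suc) n

-- Counting starts at 1, so the multiple in each block of length `suc d` is its last element.
count-multiples : ∀ n d → ∑ℕ (n * suc d) (λ k → [ suc d ∣? suc k ]) ≡ n
count-multiples n d = begin
  ∑ℕ (n * suc d) (λ k → [ suc d ∣? suc k ])
    ≡⟨ Sumℕ.∑-blocks n (suc d) _ ⟩
  ∑ℕ n (λ j → ∑ℕ (suc d) (λ i → [ suc d ∣? suc (i + j * suc d) ]))
    ≡⟨ Sumℕ.∑-cong n (λ j _ → block j) ⟩
  ∑ℕ n (λ _ → 1)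
    ≡⟨ trans (∑ℕ-const n 1) (ℕ.*-identityʳ n) ⟩
  n ∎
  where
  open ≡-Reasoning
  block : ∀ j → ∑ℕ (suc d) (λ i → [ suc d ∣? suc (i + j * suc d) ]) ≡ 1
  block j = trans (Sumℕ.∑-last d _) (cong₂ _+_
    (trans (Sumℕ.∑-cong d λ i i<d → [false] (suc d ∣? _) λ d∣ →
        contradiction (∣m+n∣n⇒∣m {suc d} {suc i} d∣ (n∣m*n j)) (>⇒∤ (s<s i<d)))
      (Sumℕ.∑-0 d))
    ([true] (suc d ∣? _) (divides (suc j) refl)))
    where
    ∣m+n∣n⇒∣m : ∀ {d m n} → d ∣ m + n → d ∣ n → d ∣ m
    ∣m+n∣n⇒∣m {d} {m} {n} d∣m+n = ∣m+n∣m⇒∣n (subst (d ∣_) (ℕ.+-comm m n) d∣m+n)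

module Totient (p′ q′ : ℕ) (prime-p : Prime (suc p′)) (prime-q : Prime (suc q′)) (p⊥q : Coprime (suc p′) (suc q′)) where
  private
    p = suc p′
    q = suc q′
  open Cyclotomic p q prime-p prime-q p⊥q

  inclusion-exclusion : ∀ a b k →
    1 + [ p * q ∣? k ] ≤ [ coprime? k (pᵃqᵇ a b) ] + ([ p ∣? k ] + [ q ∣? k ])
  inclusion-exclusion a b k = go (p ∣? k) (q ∣? k)
    where
    open ℕ.≤-Reasoning
    pq = [ p * q ∣? k ]
    c  = [ coprime? k (pᵃqᵇ a b) ]
    i  = [ p ∣? k ]
    j  = [ q ∣? k ]

    go : Dec (p ∣ k) → Dec (q ∣ k) → 1 + pq ≤ c + (i + j)
    go (no p∤k) (no q∤k) = begin
      1 + pq       ≡⟨ cong suc ([false] (p * q ∣? k) (p∤k ∘ m*n∣⇒m∣ p q)) ⟩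
      1            ≡⟨ [true] (coprime? k (pᵃqᵇ a b)) (coprime-pᵃqᵇ p∤k q∤k a b) ⟨
      c            ≤⟨ ℕ.m≤m+n c (i + j) ⟩
      c + (i + j)  ∎
    go (yes p∣k) (no q∤k) = begin
      1 + pq       ≡⟨ cong suc ([false] (p * q ∣? k) (q∤k ∘ m*n∣⇒n∣ p q)) ⟩
      1            ≡⟨ [true] (p ∣? k) p∣k ⟨
      i            ≤⟨ ℕ.m≤m+n i j ⟩
      i + j        ≤⟨ ℕ.m≤n+m (i + j) c ⟩
      c + (i + j)  ∎
    go (no p∤k) (yes q∣k) = begin
      1 + pq       ≡⟨ cong suc ([false] (p * q ∣? k) (p∤k ∘ m*n∣⇒m∣ p q)) ⟩
      1            ≡⟨ [true] (q ∣? k) q∣k ⟨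
      j            ≤⟨ ℕ.m≤n+m j i ⟩
      i + j        ≤⟨ ℕ.m≤n+m (i + j) c ⟩
      c + (i + j)  ∎
    go (yes p∣k) (yes q∣k) = begin
      1 + pq       ≤⟨ s≤s ([≤1] (p * q ∣? k)) ⟩
      1 + 1        ≡⟨ cong₂ _+_ ([true] (p ∣? k) p∣k) ([true] (q ∣? k) q∣k) ⟨
      i + j        ≤⟨ ℕ.m≤n+m (i + j) c ⟩
      c + (i + j)  ∎

  -- Summed over 1, ..., M = pqm, where the multiples of pq, p and q number m, qm and pm,
  -- `inclusion-exclusion` yields M + m ≤ φ(M) + qm + pm; and M + m - qm - pm = (p - 1)(q - 1) m.
  φ-lower-bound : ∀ a b → p′ * q′ * pᵃqᵇ a b ≤ φ (pᵃqᵇ (suc a) (suc b))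
  φ-lower-bound a b = ℕ.+-cancelʳ-≤ (q * m + p * m) (p′ * q′ * m) (φ M) (begin
    p′ * q′ * m + (q * m + p * m)                                           ≡⟨ expand p′ q′ m ⟩
    p * (q * m) + m                                                         ≡⟨ cong (_+ m) (pq*pᵃqᵇ a b) ⟩
    M + m                                                                   ≡⟨ cong₂ _+_ (trans (∑ℕ-const M 1) (ℕ.*-identityʳ M)) (count (p * q) m (trans (ℕ.*-comm m (p * q)) (trans (ℕ.*-assoc p q m) (pq*pᵃqᵇ a b)))) ⟨
    ∑ℕ M (λ _ → 1) + ∑ℕ M (λ k → [ p * q ∣? suc k ])                        ≡⟨ Sumℕ.∑-+ M _ _ ⟨
    ∑ℕ M (λ k → 1 + [ p * q ∣? suc k ])                                     ≤⟨ ∑ℕ-mono M (λ k _ → inclusion-exclusion (suc a) (suc b) (suc k)) ⟩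
    ∑ℕ M (λ k → [ coprime? (suc k) M ] + ([ p ∣? suc k ] + [ q ∣? suc k ])) ≡⟨ Sumℕ.∑-+ M _ _ ⟩
    ∑ℕ M (λ k → [ coprime? (suc k) M ]) + ∑ℕ M (λ k → [ p ∣? suc k ] + [ q ∣? suc k ])
      ≡⟨ cong₂ _+_ (sym (length-filter (λ k → coprime? (suc k) M) (λ k → k) M))
           (trans (Sumℕ.∑-+ M _ _) (cong₂ _+_
             (count p (q * m) (trans (ℕ.*-comm (q * m) p) (pq*pᵃqᵇ a b)))
             (count q (p * m) (trans (rotate p q m) (pq*pᵃqᵇ a b))))) ⟩
    φ M + (q * m + p * m)                                                   ∎)
    where
    open ℕ.≤-Reasoning
    M = pᵃqᵇ (suc a) (suc b)
    m = pᵃqᵇ a b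

    expand : ∀ p q m → p * q * m + (suc q * m + suc p * m) ≡ suc p * (suc q * m) + m
    expand = solve-∀

    rotate : ∀ p q m → p * m * q ≡ p * (q * m)
    rotate = solve-∀

    count : ∀ d n .⦃ _ : NonZero d ⦄ → n * d ≡ M → ∑ℕ M (λ k → [ d ∣? suc k ]) ≡ n
    count (suc d) n e = subst (λ M → ∑ℕ M (λ k → [ suc d ∣? suc k ]) ≡ n) e (count-multiples n d)

open import Data.Nat using (_^_)

-- The order of k modulo m and the primes dividing k / gcd(k , m)

record GcdFactors (k m : ℕ) : Set where
  field
    κ N g : ℕ
    k≡κg  : k ≡ κ * g
    m≡Ng  : m ≡ N * g
    κ⊥N   : Coprime κ N

gcdFactors : ∀ k m .⦃ _ : NonZero m ⦄ → GcdFactors k m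
gcdFactors k m = record
  { κ = k / gcd k m ; N = m / gcd k m ; g = gcd k m
  ; k≡κg = sym (m/n*n≡m (gcd[m,n]∣m k m))
  ; m≡Ng = sym (m/n*n≡m (gcd[m,n]∣n k m))
  ; κ⊥N  = coprime-/gcd k m }
  where
  instance
    gcd≢0 : NonZero (gcd k m)
    gcd≢0 = ℕ.≢-nonZero (gcd[m,n]≢0 k m (inj₂ (ℕ.≢-nonZero⁻¹ m)))

module _ {k m : ℕ} (F : GcdFactors k m) where
  open GcdFactors F

  kN≡mκ : k * N ≡ m * κ
  kN≡mκ = trans (cong (_* N) k≡κg) (trans (rotate κ g N) (cong (_* κ) (sym m≡Ng)))
    where
    rotate : ∀ x y z → x * y * z ≡ z * y * x
    rotate = solve-∀

  -- In other words, the additive order of k modulo m is a multiple of N, so its first N multiples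
  -- are distinct mod m.
  multiple-∣ : .⦃ _ : NonZero m ⦄ → ∀ {l} → m ∣ k * l → N ∣ l
  multiple-∣ {l} m∣kl = coprime-divisor (Coprimality.sym κ⊥N)
    (*-cancelʳ-∣ g ⦃ g≢0 ⦄ (subst₂ _∣_ m≡Ng (trans (cong (_* l) k≡κg) (rotate κ g l)) m∣kl))
    where
    g≢0 : NonZero g
    g≢0 = ℕ.≢-nonZero λ g≡0 → ℕ.≢-nonZero⁻¹ m (trans m≡Ng (trans (cong (N *_) g≡0) (ℕ.*-zeroʳ N)))
    rotate : ∀ x y z → x * y * z ≡ x * z * y
    rotate = solve-∀

  residues-distinct : .⦃ _ : NonZero m ⦄ → ∀ o l l′ → l < N → l′ < N →
    (k * l + o) % m ≡ (k * l′ + o) % m → l ≡ l′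
  residues-distinct o l l′ l<N l′<N e = ℕ.≤-antisym
    (ℕ.≮⇒≥ (not-< l<N (sym e))) (ℕ.≮⇒≥ (not-< l′<N e))
    where
    not-< : ∀ {l l′} → l′ < N → (k * l + o) % m ≡ (k * l′ + o) % m → ¬ l < l′
    not-< {l} {l′} l′<N e l<l′ = >⇒∤ ⦃ ℕ.>-nonZero (ℕ.m<n⇒0<n∸m l<l′) ⦄
      (ℕ.≤-<-trans (ℕ.m∸n≤m l′ l) l′<N) (multiple-∣ (∣m+n∣m⇒∣n {m = A / m * m} (divides (B / m) (ℕ.+-cancelˡ-≡ (A % m) _ _ (begin
        A % m + (A / m * m + k * (l′ ∸ l))    ≡⟨ ℕ.+-assoc (A % m) _ _ ⟨
        A % m + A / m * m + k * (l′ ∸ l)      ≡⟨ cong (_+ k * (l′ ∸ l)) (m≡m%n+[m/n]*n A m) ⟨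
        k * l + o + k * (l′ ∸ l)              ≡⟨ collect k l o (l′ ∸ l) ⟩
        k * (l + (l′ ∸ l)) + o                ≡⟨ cong (λ x → k * x + o) (ℕ.m+[n∸m]≡n (ℕ.<⇒≤ l<l′)) ⟩
        B                                     ≡⟨ m≡m%n+[m/n]*n B m ⟩
        B % m + B / m * m                     ≡⟨ cong (_+ B / m * m) e ⟨
        A % m + B / m * m                     ∎))) (n∣m*n (A / m))))
      where
      open ≡-Reasoning
      A = k * l + o
      B = k * l′ + o
      collect : ∀ k l o x → k * l + o + k * x ≡ k * (l + x) + o
      collect = solve-∀

  module _ {p : ℕ} (prime-p : Prime p) (a o : ℕ) (m≡pᵃo : m ≡ p ^ a * o) where
    private instance
      p≢0 : NonZero p
      p≢0 = prime⇒nonZero prime-p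

    -- `g` divides m, which contains p only to the power a. So p^(a+1) does not fit into the factor
    -- g of k = κ g.
    prime-power∣⇒prime∣κ : ¬ p ∣ o → p ^ suc a ∣ k → p ∣ κ
    prime-power∣⇒prime∣κ p∤o pˢ∣k = decidable-stable (p ∣? κ) λ p∤κ →
      >⇒∤ ⦃ ℕ.m^n≢0 p a ⦄ (m<n*m (p ^ a) ⦃ ℕ.m^n≢0 p a ⦄ (prime⇒n>1 prime-p))
        (coprime-divisor (power⊥ p∤o) (subst (p ^ suc a ∣_) (trans m≡pᵃo (ℕ.*-comm (p ^ a) o))
          (subst (p ^ suc a ∣_) (sym m≡Ng) (∣n⇒∣m*n N (coprime-divisor (power⊥ p∤κ) (subst (p ^ suc a ∣_) k≡κg pˢ∣k))))))
      where
      power⊥ : ∀ {e} → ¬ p ∣ e → Coprime (p ^ suc a) e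
      power⊥ p∤e = Coprimality.sym (coprime-^ʳ (prime∤⇒coprime prime-p p∤e) (suc a))

    -- As κ and N are coprime, p does not divide N, so all of p^a in m = N g lies in g; κ supplies
    -- one more factor p.
    prime∣κ⇒prime-power∣ : p ∣ κ → p ^ suc a ∣ k
    prime∣κ⇒prime-power∣ p∣κ = subst (p ^ suc a ∣_) (sym k≡κg) (*-pres-∣ p∣κ
      (coprime-divisor (Coprimality.sym (coprime-^ʳ (prime∤⇒coprime prime-p p∤N) a))
        (subst (p ^ a ∣_) (trans (sym m≡pᵃo) m≡Ng) (m∣m*n o))))
      where
      p∤N : ¬ p ∣ N
      p∤N p∣N = ℕ.<⇒≢ (prime⇒n>1 prime-p) (sym (κ⊥N (p∣κ , p∣N)))

-- From sums in a quotient of ℤ[x] to coefficient lists and norms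

coeff-applyUpTo-bounded : ∀ {d} (F : ℕ → ℤ) n → (∀ i → ℤ.∣ F i ∣ ≤ d) → ∀ i → ℤ.∣ coeff (applyUpTo F n) i ∣ ≤ d
coeff-applyUpTo-bounded F zero    bound i       = z≤n
coeff-applyUpTo-bounded F (suc n) bound zero    = bound 0
coeff-applyUpTo-bounded F (suc n) bound (suc i) = coeff-applyUpTo-bounded (F ∘ suc) n (bound ∘ suc) i

norm-bounded : ∀ {d} M f → length f ≤ φ M → (∀ i → ℤ.∣ coeff f i ∣ ≤ d) → ‖ f ‖∞[ M ] ≤ d
norm-bounded {d} M f len bound = max-bounded (representative M f)
  λ i → subst (λ c → ℤ.∣ c ∣ ≤ d) (sym (mod-short (φ M) (Φ M) f len i)) (bound i)
  where
  max-bounded : ∀ {n} (v : Vec ℤ n) → (∀ i → ℤ.∣ coeff (Vec.toList v) i ∣ ≤ d) →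
    Vec.foldr′ (λ a m → ℤ.∣ a ∣ ℕ.⊔ m) 0 v ≤ d
  max-bounded []      bound = z≤n
  max-bounded (a ∷ v) bound = ℕ.⊔-lub (bound 0) (max-bounded v (bound ∘ suc))

module Quotient (h : Poly) where
  open QuotientRing polyRing h public
  private
    module P = Geometric polyRing
    module Q = Geometric quotientRing
  open CommutativeRing quotientRing using () renaming
    (*-congˡ to *-congˡₕ; trans to transₕ; sym to symₕ; refl to reflₕ; +-congˡ to +-congˡₕ)

  const-+ : ∀ a b → const (a ℤ.+ b) ≈ₕ const a +ᵖ const b
  const-+ a b = ≈⇒≈ₕ ≋-refl

  open Evaluation quotientRing const const-+ (≈⇒≈ₕ 0∷[]) public

  X^≈ₕvar^ : ∀ n → X^ n ≈ₕ var Q.^ n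
  X^≈ₕvar^ zero    = reflₕ
  X^≈ₕvar^ (suc n) = transₕ (≈⇒≈ₕ (≋-sym (var*≋0∷ (X^ n)))) (*-congˡₕ {var} (X^≈ₕvar^ n))

  applyUpTo≈ₕeval : ∀ n F → applyUpTo F n ≈ₕ eval n F var
  applyUpTo≈ₕeval zero    F = reflₕ
  applyUpTo≈ₕeval (suc n) F = transₕ
    (≈⇒≈ₕ (≋-trans (∷-cong (sym (ℤ.+-identityʳ (F 0))) ≋-refl)
      (+-cong (≋-sym (CommutativeRing.*-identityʳ polyRing (const (F 0)))) (≋-sym (var*≋0∷ (applyUpTo (F ∘ suc) n))))))
    (+-congˡₕ {const (F 0) *ᵖ const 1ℤ} (transₕ (*-congˡₕ {var} (applyUpTo≈ₕeval n (F ∘ suc)))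
      (transₕ (Q.*-distribˡ-∑ n var _) (Q.∑-cong n λ i _ → ≈⇒≈ₕ (left-comm var (const (F (suc i))) (var Q.^ i))))))
    where
    left-comm : ∀ f g k → f *ᵖ (g *ᵖ k) ≋ g *ᵖ (f *ᵖ k)
    left-comm f g k = ≋-trans (≋-sym (*-assoc f g k)) (≋-trans (*-cong (*-comm f g) ≋-refl) (*-assoc g f k))

  -- Both rings have the same carrier and operations, but powers and sums are instantiated
  -- separately for each, so agreement at a variable exponent takes an induction.
  ^-≡ : ∀ f n → f Q.^ n ≡ f P.^ n
  ^-≡ f zero    = refl
  ^-≡ f (suc n) = cong (f *ᵖ_) (^-≡ f n)

  ∑-≡ : ∀ n {F G : ℕ → Poly} → (∀ i → F i ≡ G i) → Q.∑ n F ≡ P.∑ n G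
  ∑-≡ zero    e = refl
  ∑-≡ (suc n) e = cong₂ _+ᵖ_ (e 0) (∑-≡ n (e ∘ suc))

  geo≈ₕ0 : ∀ m n l k → P.geo n ((X^ m) P.^ l) ≋ k *ᵖ h → Q.geo n ((var Q.^ m) Q.^ l) ≈ₕ []
  geo≈ₕ0 m n l k e = transₕ
    (Q.∑-cong n λ i _ → Q.^-congˡ i (Q.^-congˡ l (symₕ (X^≈ₕvar^ m))))
    (transₕ (CommutativeRing.reflexive quotientRing (∑-≡ n λ i →
        trans (^-≡ (X^ m Q.^ l) i) (cong (P._^ i) (^-≡ (X^ m) l))))
      (transₕ (≈⇒≈ₕ e) (multiple≈ₕ0 k)))

-ᵖ≈[mod] : ∀ {f g h} → Quotient._≈ₕ_ h f g → f ≈ g [mod h ]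
-ᵖ≈[mod] {f} {g} {h} e = multiplier e , coeff≡ (x≈y+z⇒x-z≈y (≋-trans (≈multiple e) (+-comm g _)))
  where
  open Quotient h using (multiplier; ≈multiple)
  open Geometric polyRing using (x≈y+z⇒x-z≈y)

-- The inverse modulo Φ_M and the three cases

module Construction (p q : ℕ) (prime-p : Prime p) (prime-q : Prime q) (p⊥q : Coprime p q) (a b : ℕ) where
  open Cyclotomic p q prime-p prime-q p⊥q

  private
    m M : ℕ
    m = pᵃqᵇ a b
    M = pᵃqᵇ (suc a) (suc b)

    instance
      p≢0 : NonZero p
      p≢0 = prime⇒nonZero prime-p
      q≢0 : NonZero q
      q≢0 = prime⇒nonZero prime-q
      m≢0 : NonZero m
      m≢0 = pᵃqᵇ≢0 a b

    M≡m*pq : m * (p * q) ≡ M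
    M≡m*pq = trans (rotate m p q) (pq*pᵃqᵇ a b)
      where
      rotate : ∀ m p q → m * (p * q) ≡ p * (q * m)
      rotate = solve-∀

  -- A list of length at most φ M is its own remainder mod Φ M, so only a lower bound for
  -- φ M is needed.
  φ-≥ : ℕ.pred p * ℕ.pred q * m ≤ φ M
  φ-≥ = lemma p q prime-p prime-q p⊥q
    where
    lemma : ∀ p q (prime-p : Prime p) (prime-q : Prime q) (p⊥q : Coprime p q) →
      ℕ.pred p * ℕ.pred q * (p ^ a * q ^ b) ≤ φ (p ^ suc a * q ^ suc b)
    lemma zero     q        prime-p prime-q p⊥q = z≤n
    lemma (suc p′) zero     prime-p prime-q p⊥q = contradiction (prime⇒n>1 prime-q) λ ()
    lemma (suc p′) (suc q′) prime-p prime-q p⊥q = Totient.φ-lower-bound p′ q′ prime-p prime-q p⊥q a b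

  module _ {i j : ℕ} (j<i : j < i) (i<M : i < M) (F : GcdFactors (i ∸ j) m) where
    open GcdFactors F
    open Quotient (Φ M)

    inverse : ∀ {c d} → Kernel p q κ c d →
      ∃[ u ] ((X^ i -ᵖ X^ j) *ᵖ u ≈ const (+ c) [mod Φ M ]) × ‖ u ‖∞[ M ] ≤ d
    inverse {c} {d} K = U , -ᵖ≈[mod] congruence ,
      norm-bounded M U (ℕ.≤-trans (ℕ.≤-reflexive (length-applyUpTo u (ℕ.pred p * ℕ.pred q * m))) φ-≥)
        (coeff-applyUpTo-bounded u (ℕ.pred p * ℕ.pred q * m) (u-bounded (residues-distinct F offset)))
      where
      open CommutativeRing quotientRing using () renaming (refl to reflₕ)
      open Geometric polyRing using (geo)
      open Geometric quotientRing using () renaming (_^_ to _^ₕ_)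

      open PrimitiveRoot p q (var ^ₕ m)
        (geo≈ₕ0 m p q (geo p (X^ m)) (Φ∣geo-p a b)) (geo≈ₕ0 m q p (geo q (X^ m)) (Φ∣geo-q a b))
      open Inverse K m N (i ∸ j) i j var reflₕ (kN≡mκ F) (ℕ.m+[n∸m]≡n (ℕ.<⇒≤ j<i))
        (ℕ.≤-trans (ℕ.<⇒≤ (ℕ.<-trans j<i i<M)) (ℕ.≤-reflexive (sym M≡m*pq)))

      U : Poly
      U = applyUpTo u (ℕ.pred p * ℕ.pred q * m)

      congruence : (X^ i -ᵖ X^ j) *ᵖ U ≈ₕ const (+ c)
      congruence = CommutativeRing.trans quotientRing
        (CommutativeRing.*-cong quotientRing
          (CommutativeRing.+-cong quotientRing (X^≈ₕvar^ i) (CommutativeRing.-‿cong quotientRing (X^≈ₕvar^ j)))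
          (applyUpTo≈ₕeval _ u))
        u-inverse

  module _ {i j : ℕ} (j<i : j < i) (i<M : i < M) where
    private
      k : ℕ
      k = i ∸ j

      F : GcdFactors k m
      F = gcdFactors k m
      open GcdFactors F

      p∤qᵇ : ¬ p ∣ q ^ b
      p∤qᵇ p∣ = ℕ.<⇒≢ (prime⇒n>1 prime-p) (sym (coprime-^ʳ p⊥q b (∣-refl , p∣)))

      q∤κ : ¬ q ^ suc b ∣ k → ¬ q ∣ κ
      q∤κ qᵗ∤k q∣κ = qᵗ∤k (prime∣κ⇒prime-power∣ F prime-q b (p ^ a) (ℕ.*-comm (p ^ a) (q ^ b)) q∣κ)

      M∤k : ¬ M ∣ k
      M∤k = >⇒∤ ⦃ ℕ.>-nonZero (ℕ.m<n⇒0<n∸m j<i) ⦄ (ℕ.≤-<-trans (ℕ.m∸n≤m i j) i<M)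

    inverse-pˢ∣ : p ^ suc a ∣ k →
      ∃[ u ] ((X^ i -ᵖ X^ j) *ᵖ u ≈ const (+ q) [mod Φ M ]) × ‖ u ‖∞[ M ] ≤ q ∸ 1
    inverse-pˢ∣ pˢ∣k = inverse j<i i<M F (OrderQ.kernelQ p q κ (prime⇒n>1 prime-p) (prime⇒n>1 prime-q) p⊥q
      (prime-power∣⇒prime∣κ F prime-p a (q ^ b) refl p∤qᵇ pˢ∣k)
      -- If q divided κ, then q^t and hence M would divide k, against 0 < k < M.
      (prime∤⇒coprime prime-q (q∤κ λ qᵗ∣k → M∤k (coprime-∣-* pˢ⊥qᵗ pˢ∣k qᵗ∣k))))
      where
      pˢ⊥qᵗ : Coprime (p ^ suc a) (q ^ suc b)
      pˢ⊥qᵗ = Coprimality.sym (coprime-^ʳ (Coprimality.sym (coprime-^ʳ p⊥q (suc b))) (suc a))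

    inverse-otherwise : ¬ p ^ suc a ∣ k → ¬ q ^ suc b ∣ k →
      ∃[ u ] ((X^ i -ᵖ X^ j) *ᵖ u ≈ const (+ 1) [mod Φ M ]) × ‖ u ‖∞[ M ] ≤ p ∸ 1
    inverse-otherwise pˢ∤k qᵗ∤k = inverse j<i i<M F (OrderPQ.kernelPQ p q κ (prime⇒n>1 prime-p) (prime⇒n>1 prime-q) p⊥q
      (prime∤⇒coprime prime-p λ p∣κ → pˢ∤k (prime∣κ⇒prime-power∣ F prime-p a (q ^ b) refl p∣κ))
      (prime∤⇒coprime prime-q (q∤κ qᵗ∤k)))

theorem3 : ∀ (p q s t : ℕ) → Prime p → Prime q → p < q → 0 < s → 0 < t →
    let M = p ^ s * q ^ t in
    ∀ (i j : ℕ) → j < i → i < M →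
    let (c , d) = constants p q s t (i ∸ j) in
    ∃[ u ] ((X^ i -ᵖ X^ j) *ᵖ u ≈ const (+ c) [mod Φ M ]) × ‖ u ‖∞[ M ] ≤ d
theorem3 p q (suc a) (suc b) prime-p prime-q p<q _ _ i j j<i i<M =
  go (p ^ suc a ∣? i ∸ j) (q ^ suc b ∣? i ∸ j)
  where
  p⊥q : Coprime p q
  p⊥q = Coprimality.sym (prime⇒coprime prime-q ⦃ prime⇒nonZero prime-p ⦄ p<q)

  Goal : ℕ → ℕ × ℕ → Set
  Goal M (c , d) = ∃[ u ] ((X^ i -ᵖ X^ j) *ᵖ u ≈ const (+ c) [mod Φ M ]) × ‖ u ‖∞[ M ] ≤ d

  -- The decisions are arguments, so that matching on them reduces the tests inside `constants`.
  go : (pˢ∣? : Dec (p ^ suc a ∣ i ∸ j)) (qᵗ∣? : Dec (q ^ suc b ∣ i ∸ j)) →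
    Goal (p ^ suc a * q ^ suc b)
      (if does pˢ∣? then (q , q ∸ 1) else if does qᵗ∣? then (p , p ∸ 1) else (1 , p ∸ 1))
  go (yes pˢ∣k) _ = Construction.inverse-pˢ∣ p q prime-p prime-q p⊥q a b j<i i<M pˢ∣k
  -- The exchanged construction works modulo `Φ` of the product in the other order; commutativity
  -- transports its result.
  go (no _) (yes qᵗ∣k) = subst (λ M → Goal M (p , p ∸ 1)) (ℕ.*-comm (q ^ suc b) (p ^ suc a))
    (Construction.inverse-pˢ∣ q p prime-q prime-p (Coprimality.sym p⊥q) b a j<i
      (subst (i <_) (ℕ.*-comm (p ^ suc a) (q ^ suc b)) i<M) qᵗ∣k)
  go (no pˢ∤k) (no qᵗ∤k) = Construction.inverse-otherwise p q prime-p prime-q p⊥q a b j<i i<M pˢ∤k qᵗ∤k
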